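{- Let $r,s\geq 1$ be integers with $rs\geq 2$, let $r^s$ denote the rectangular partition with $s$ parts all equal to $r$, and let $\nu=(r^{s-1},r-1)$ be the partition obtained from $r^s$ by removing its unique corner cell (i.e. $s-1$ parts equal to $r$ and one part equal to $r-1$, the latter omitted if $r=1$). If $\dim \mathbf{M}_{\nu}=(rs-1)!$, then $\dim\mathbf{M}_{r^s}=(rs)!$. Moreover, $$\partial_{p_1}C_{r^s}(x;q,t)=B_{r^s}(q,t)\,C_{\nu}(x;q,t),\qquad G_{r^s}(q,t)=B_{r^s}(q,t)\,G_{\nu}(q,t).$$
   Context: Partitions are drawn in French convention: the partition $\mu=(\mu_1\geq\mu_2\geq\cdots)$ has $\mu_i$ cells in its $i$-th row counted from the bottom; cell $(i,j)$ is the $j$-th cell of row $i$ ($i,j\geq1$). For $\mu\vdash N$, list the pairs $(i-1,j-1)$, $(i,j)\in\mu$, in lexicographic order as $(p_1,q_1),\dots,(p_N,q_N)$ and set $\Delta_\mu(x,y)=\det\|x_a^{p_b}y_a^{q_b}\|_{a,b=1}^N$, a polynomial in $x_1,\dots,x_N,y_1,\dots,y_N$. Let $\mathbf{M}_\mu$ be the linear span (over $\mathbb{Q}$) of all partial derivatives $\partial_x^{p}\partial_y^{q}\Delta_\mu$ of all orders (including $\Delta_\mu$ itself). $S_N$ acts diagonally, $\sigma P(x_1,\dots,x_N;y_1,\dots,y_N)=P(x_{\sigma_1},\dots,x_{\sigma_N};y_{\sigma_1},\dots,y_{\sigma_N})$, and $\mathbf{M}_\mu$ is invariant. Let $\mathcal{H}_{h,k}(\mathbf{M}_\mu)$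 be the subspace of elements bihomogeneous of degree $h$ in $x$ and $k$ in $y$. The bigraded Frobenius characteristic is $C_\mu(x;q,t)=\sum_{h,k}t^hq^k\,\mathcal{F}(\mathrm{char}\,\mathcal{H}_{h,k}(\mathbf{M}_\mu))$ where for a character $\chi$ of $S_N$, $\mathcal{F}(\chi)=\frac1{N!}\sum_{\sigma\in S_N}\chi(\sigma)p_{\lambda(\sigma)}$ with $p_\lambda$ the power sum symmetric function indexed by the cycle type. $\partial_{p_1}$ denotes partial differentiation with respect to $p_1$ when a symmetric function is written as a polynomial in the power sums $p_1,p_2,\dots$; $G_\mu(q,t)=\partial_{p_1}^N C_\mu(x;q,t)$ (the bigraded Hilbert series of $\mathbf{M}_\mu$). Finally $B_\mu(q,t)=\sum_{(i,j)\in\mu}t^{i-1}q^{j-1}$. -}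

module Defs where

open import Data.Bool using (Bool; true; false; if_then_else_; _∧_)
open import Data.Nat as ℕ using (ℕ; zero; suc; _∸_; _≤_; _!)
open import Data.Nat.Properties using () renaming (_≟_ to _≟ℕ_)
open import Data.Integer using (+_)
open import Data.Rational as ℚ using (ℚ; 0ℚ; 1ℚ)
open import Data.Fin as Fin using (Fin; punchIn; toℕ)
open import Data.Fin.Properties using () renaming (_≟_ to _≟F_)
open import Data.Vec as Vec using (Vec; lookup; tabulate)
import Data.Vec.Properties as VecP
open import Data.List as List using (List; []; _∷_; _++_; map; foldr; concatMap; length; allFin; replicate; downFrom)
import Data.List.Properties as ListP
import Data.Nat.ListAction
open import Data.List.Relation.Unary.All using (All)
open import Data.Product using (Σ; _×_; _,_; proj₁; proj₂)
open import Relation.Nullary using (does; ¬_)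
open import Relation.Binary.PropositionalEquality using (_≡_)

qℕ : ℕ → ℚ
qℕ n = (+ n) ℚ./ 1

sumℚ : List ℚ → ℚ
sumℚ = foldr ℚ._+_ 0ℚ

ΣF : (d : ℕ) → (Fin d → ℚ) → ℚ
ΣF d f = sumℚ (map f (allFin d))

-- Partitions (lists of parts, bottom row first) and their cells

rowCells : ℕ → ℕ → List (ℕ × ℕ)
rowCells i m = map (λ j → (i , j)) (List.upTo m)

cellsFrom : ℕ → List ℕ → List (ℕ × ℕ)
cellsFrom i [] = []
cellsFrom i (m ∷ μ) = rowCells i m ++ cellsFrom (suc i) μ

-- the pairs (i-1,j-1), (i,j) ∈ μ, in lexicographic order
cells : List ℕ → List (ℕ × ℕ)
cells μ = cellsFrom 0 μ

size : List ℕ → ℕ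
size μ = length (cells μ)

rect : ℕ → ℕ → List ℕ
rect r s = replicate s r

rectMinusCorner : ℕ → ℕ → List ℕ
rectMinusCorner r s = replicate (s ∸ 1) r ++ lastPart r
  where
  lastPart : ℕ → List ℕ
  lastPart 0 = []
  lastPart 1 = []
  lastPart (suc (suc k)) = suc k ∷ []

-- Polynomials in x_1..x_N, y_1..y_N over ℚ (finite lists of terms)

Mono : ℕ → Set
Mono N = Vec ℕ N × Vec ℕ N

Poly : ℕ → Set
Poly N = List (ℚ × Mono N)

monoEq : ∀ {N} → Mono N → Mono N → Bool
monoEq (x , y) (x' , y') =
  does (VecP.≡-dec _≟ℕ_ x x') ∧ does (VecP.≡-dec _≟ℕ_ y y')

coeff : ∀ {N} → Poly N → Mono N → ℚ
coeff P m = sumℚ (map (λ t → if monoEq (proj₂ t) m then proj₁ t else 0ℚ) P)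

_≈P_ : ∀ {N} → Poly N → Poly N → Set
P ≈P Q = ∀ m → coeff P m ≡ coeff Q m

zeroP : ∀ {N} → Poly N
zeroP = []

oneP : ∀ {N} → Poly N
oneP {N} = (1ℚ , (Vec.replicate N 0 , Vec.replicate N 0)) ∷ []

_+P_ : ∀ {N} → Poly N → Poly N → Poly N
P +P Q = P ++ Q

scaleP : ∀ {N} → ℚ → Poly N → Poly N
scaleP c P = map (λ t → (c ℚ.* proj₁ t , proj₂ t)) P

_*P_ : ∀ {N} → Poly N → Poly N → Poly N
P *P Q = concatMap (λ t → map (λ u → (proj₁ t ℚ.* proj₁ u ,
            (Vec.zipWith ℕ._+_ (proj₁ (proj₂ t)) (proj₁ (proj₂ u)) ,
             Vec.zipWith ℕ._+_ (proj₂ (proj₂ t)) (proj₂ (proj₂ u))))) Q) P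

sumP : ∀ {N} → List (Poly N) → Poly N
sumP = foldr _+P_ zeroP

comb : ∀ {N d} → (Fin d → ℚ) → (Fin d → Poly N) → Poly N
comb {d = d} c b = sumP (map (λ i → scaleP (c i) (b i)) (allFin d))

xyPow : ∀ {N} → Fin N → ℕ → ℕ → Poly N
xyPow a p q = (1ℚ , (tabulate (λ b → if does (a ≟F b) then p else 0) ,
                     tabulate (λ b → if does (a ≟F b) then q else 0))) ∷ []

det : ∀ {N} (n : ℕ) → (Fin n → Fin n → Poly N) → Poly N
det zero M = oneP
det (suc n) M = sumP (map (λ j → scaleP (sgn j)
                  (M Fin.zero j *P det n (λ a b → M (Fin.suc a) (punchIn j b))))
                  (allFin (suc n)))
  where
  sgn : Fin (suc n) → ℚ
  sgn j = if does (toℕ j ℕ.% 2 ≟ℕ 0) then 1ℚ else ℚ.- 1ℚ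

Δ : (μ : List ℕ) → Poly (size μ)
Δ μ = det (size μ) (λ a b → xyPow a (proj₁ (List.lookup (cells μ) b))
                                    (proj₂ (List.lookup (cells μ) b)))

∂x : ∀ {N} → Fin N → Poly N → Poly N
∂x a = map (λ t → (proj₁ t ℚ.* qℕ (lookup (proj₁ (proj₂ t)) a) ,
                   (Vec.updateAt (proj₁ (proj₂ t)) a ℕ.pred , proj₂ (proj₂ t))))

∂y : ∀ {N} → Fin N → Poly N → Poly N
∂y a = map (λ t → (proj₁ t ℚ.* qℕ (lookup (proj₂ (proj₂ t)) a) ,
                   (proj₁ (proj₂ t) , Vec.updateAt (proj₂ (proj₂ t)) a ℕ.pred)))

data IsDeriv {N} (D : Poly N) : Poly N → Set where
  base : IsDeriv D D
  dx   : ∀ {P} (a : Fin N) → IsDeriv D P → IsDeriv D (∂x a P)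
  dy   : ∀ {P} (a : Fin N) → IsDeriv D P → IsDeriv D (∂y a P)

InM : (μ : List ℕ) → Poly (size μ) → Set
InM μ P = Σ (List (ℚ × Poly (size μ))) λ L →
            All (λ t → IsDeriv (Δ μ) (proj₂ t)) L ×
            (P ≈P sumP (map (λ t → scaleP (proj₁ t) (proj₂ t)) L))

IsBasis : ∀ {N} (S : Poly N → Set) (d : ℕ) → (Fin d → Poly N) → Set
IsBasis S d b =
  (∀ i → S (b i)) ×
  (∀ (c : Fin d → ℚ) → comb c b ≈P zeroP → ∀ i → c i ≡ 0ℚ) ×
  (∀ P → S P → Σ (Fin d → ℚ) λ c → P ≈P comb c b)

HasDim : ∀ {N} (S : Poly N → Set) → ℕ → Set
HasDim S d = Σ (Fin _ → _) λ b → IsBasis S d b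

dimM : (μ : List ℕ) → ℕ → Set
dimM μ d = HasDim (InM μ) d

degV : ∀ {N} → Vec ℕ N → ℕ
degV = Vec.foldr _ ℕ._+_ 0

Bihom : ∀ {N} → ℕ → ℕ → Poly N → Set
Bihom h k P = ∀ m → ¬ (coeff P m ≡ 0ℚ) → (degV (proj₁ m) ≡ h) × (degV (proj₂ m) ≡ k)

H : (μ : List ℕ) → ℕ → ℕ → Poly (size μ) → Set
H μ h k P = InM μ P × Bihom h k P

Perm : ℕ → Set
Perm N = Vec (Fin N) N

distinct : ∀ {N k} → Vec (Fin N) k → Bool
distinct Vec.[] = true
distinct (a Vec.∷ v) = Vec.foldr _ (λ b r → if does (a ≟F b) then false else r) true v ∧ distinct v

IsPerm : ∀ {N} → Perm N → Set
IsPerm σ = distinct σ ≡ true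

allVecs : (N k : ℕ) → List (Vec (Fin N) k)
allVecs N zero = Vec.[] ∷ []
allVecs N (suc k) = List.cartesianProductWith Vec._∷_ (allFin N) (allVecs N k)

perms : (N : ℕ) → List (Perm N)
perms N = List.filterᵇ distinct (allVecs N N)

-- diagonal action: (σP)(x_1,…,x_N; y_1,…,y_N) = P(x_{σ_1},…,x_{σ_N}; y_{σ_1},…,y_{σ_N})
-- (the exponent of x_a in P becomes the exponent of x_{σ_a})
permExp : ∀ {N} → Perm N → Vec ℕ N → Vec ℕ N
permExp {N} σ e = tabulate λ b →
  Data.Nat.ListAction.sum (map (λ a → if does (lookup σ a ≟F b) then lookup e a else 0) (allFin N))

act : ∀ {N} → Perm N → Poly N → Poly N
act σ = map (λ t → (proj₁ t , (permExp σ (proj₁ (proj₂ t)) , permExp σ (proj₂ (proj₂ t)))))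

IsChar : ∀ {N} (S : Poly N → Set) → (Perm N → ℚ) → Set
IsChar {N} S χ = Σ ℕ λ d → Σ (Fin d → Poly N) λ b → IsBasis S d b ×
  (∀ σ → IsPerm σ → Σ (Fin d → Fin d → ℚ) λ a →
     (∀ j → act σ (b j) ≈P comb (λ i → a i j) b) × (χ σ ≡ ΣF d (λ i → a i i)))

orbitLen : ∀ {N} → Perm N → Fin N → ℕ
orbitLen {N} σ i = go N 1 (lookup σ i)
  where
  go : ℕ → ℕ → Fin N → ℕ
  go zero k j = k
  go (suc f) k j = if does (j ≟F i) then k else go f (suc k) (lookup σ j)

cycleType : ∀ {N} → Perm N → List ℕ
cycleType {N} σ = concatMap (λ l → replicate (cnt (suc l) ℕ./ suc l) (suc l)) (downFrom N)
  where
  cnt : ℕ → ℕ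
  cnt L = length (List.filterᵇ (λ i → does (orbitLen σ i ≟ℕ L)) (allFin N))

-- Symmetric functions with coefficients in ℚ[q,t], written in the power-sum
-- basis: C h k λ is the coefficient of t^h q^k p_λ (λ a weakly decreasing list
-- of positive parts; other lists carry coefficient 0).

SymQT : Set
SymQT = ℕ → ℕ → List ℕ → ℚ

-- C is the bigraded Frobenius characteristic C_μ(x;q,t) of M_μ:
-- for every (h,k), with χ the character of 𝓗_{h,k}(M_μ),
-- C h k λ = (1/N!) Σ_{σ ∈ S_N, λ(σ) = λ} χ(σ)   (stated multiplied out by N!).
IsFrobChar : (μ : List ℕ) → SymQT → Set
IsFrobChar μ C = ∀ h k → Σ (Perm (size μ) → ℚ) λ χ → IsChar (H μ h k) χ ×
  (∀ lam → qℕ (size μ !) ℚ.* C h k lam ≡ sumℚ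
     (map χ (List.filterᵇ (λ σ → does (ListP.≡-dec _≟ℕ_ (cycleType σ) lam)) (perms (size μ)))))

∂p₁ : SymQT → SymQT
∂p₁ C h k lam = qℕ (suc (length (List.filterᵇ (λ n → does (n ≟ℕ 1)) lam))) ℚ.* C h k (lam ++ 1 ∷ [])

-- multiplication by B_μ(q,t) = Σ_{(i,j)∈μ} t^{i-1} q^{j-1}
mulB : List ℕ → SymQT → SymQT
mulB μ C h k lam = sumℚ (map (λ c → if does (proj₁ c ℕ.≤? h) ∧ does (proj₂ c ℕ.≤? k)
                                     then C (h ∸ proj₁ c) (k ∸ proj₂ c) lam else 0ℚ)
                              (cells μ))

iter : ℕ → (SymQT → SymQT) → SymQT → SymQT
iter zero f C = C
iter (suc n) f C = f (iter n f C)

Gser : (μ : List ℕ) → SymQT → ℕ → ℕ → ℚ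
Gser μ C h k = iter (size μ) ∂p₁ C h k []

{-# OPTIONS --safe #-}
module Submission where

-- Scale coefficients by factorials, so that derivations become shifts, and write φ for Δ in this form.
-- For the rectangle μ with top corner (A , B), the coefficient of x₀^A y₀^B in Δ_μ is, up to a nonzero
-- constant, Δ_ν in the remaining variables. If the f(∂)Δ_ν form a basis of M_ν, then so do the
-- f(∂) ∂_{x₀}^{A-p} ∂_{y₀}^{B-q} Δ_μ, (p , q) ∈ μ, for M_μ: their leading terms x₀^p y₀^q f(∂)Δ_ν make
-- them independent, and triangularity gives the trace of every permutation fixing 0, which is the
-- branching rule for C_μ.
--
-- They span because dim M_μ ≤ N!. Since Δ_μ is invariant under translations, it is a combination of
-- the N! products ∏ (1+x_a)^{p_a} (1+y_a)^{q_a}, where (p_a , q_a) runs through the cells in some order;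
-- these are eigenvectors of the operators (1+x_a)∂. Hence N!+1 products of such operators applied to
-- Δ_μ are dependent, and the lowest degree component of the relation is a relation between derivatives.

open import Defs
open import Algebra.Bundles using (CommutativeRing)
import Algebra.Properties.CommutativeMonoid.Sum
import Algebra.Properties.CommutativeSemigroup
open import Algebra.Properties.Group using (x∙y⁻¹≈ε⇒x≈y)
import Algebra.Properties.Semiring.Sum
open import Data.Bool using (Bool; true; false; if_then_else_; _∧_; T; T?)
open import Data.Bool.Properties using (T-≡)
open import Data.Fin as Fin using (Fin; zero; suc; toℕ; punchIn; punchOut; fromℕ; inject₁; combine; remQuot; _↑ˡ_; _↑ʳ_)
open import Data.Fin.Permutation using (permutation)
import Data.Fin.Properties as Fin
import Data.Integer as ℤ
import Data.Integer.Properties as ℤ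
import Data.Rational.Unnormalised as ℚᵘ
import Data.Rational.Unnormalised.Properties as ℚᵘ
open import Data.List as List using (List; []; _∷_; _++_; allFin)
import Data.List.Properties as List
open import Data.List.Membership.Propositional using (_∈_)
open import Data.List.Membership.Propositional.Properties using (∈-map⁺; ∈-map⁻; ∈-filter⁺; ∈-filter⁻; ∈-allFin; ∈-lookup; ∈-upTo⁺; ∈-++⁺ˡ; ∈-++⁺ʳ; ∈-cartesianProductWith⁺)
open import Data.List.Membership.Propositional.Properties.WithK using (unique∧set⇒bag)
open import Data.List.Relation.Binary.BagAndSetEquality using (∼bag⇒↭)
open import Data.List.Relation.Binary.Permutation.Propositional using (_↭_)
open import Data.List.Relation.Unary.Any using (here; there; index)
open import Data.List.Relation.Unary.Any.Properties using (lookup-index)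
open import Data.List.Relation.Unary.AllPairs using (AllPairs; []; _∷_)
import Data.List.Relation.Unary.AllPairs.Properties as AllPairs
import Data.List.Relation.Unary.All.Properties as All
open import Data.List.Relation.Unary.Unique.Propositional using (Unique)
import Data.List.Relation.Unary.Unique.Propositional.Properties as Unique
open import Data.List.Relation.Unary.All as All using (All; []; _∷_)
open import Data.Nat as ℕ using (ℕ; zero; suc; _∸_; _≤_; _<_; z≤n; s≤s; _!)
open import Data.Nat.DivMod using (n/1≡n)
import Data.Nat.ListAction as ℕL
import Data.Nat.Properties as ℕ
import Data.Nat.Solver
open import Data.Product using (Σ; ∃; _×_; _,_; proj₁; proj₂; uncurry)
import Data.Product.Properties as Product
open import Data.Rational as ℚ using (ℚ; 0ℚ; 1ℚ; _+_; _*_; -_)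
import Data.Rational.Properties as ℚ
import Data.Rational.Solver
open import Data.Sum using (_⊎_; inj₁; inj₂; [_,_]′)
open import Data.Vec as Vec using (Vec; []; _∷_; lookup; tabulate)
open import Data.Vec.Functional using (insertAt)
open import Data.Vec.Functional.Properties using (insertAt-lookup; insertAt-punchIn)
import Data.Vec.Properties as Vec
open import Function using (_∘_; id; mk⇔; Equivalence)
open import Relation.Binary using (Tri; tri<; tri≈; tri>)
open import Relation.Binary.PropositionalEquality using (_≡_; _≢_; _≗_; refl; sym; trans; cong; cong₂; subst; module ≡-Reasoning)
open import Relation.Nullary using (¬_; Dec; yes; no; does; contradiction)
open import Relation.Nullary.Decidable using (dec-true; dec-false; decidable-stable; _×-dec_; does-⇔)

-- The operator (1+x_a)∂ is the sum of ∂ and x_a∂, and the latter preserves degrees. In a product of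
-- d such operators applied to Δ_μ, the component whose degree is d less than that of Δ_μ is
-- therefore the derivative itself, and nothing of lower degree occurs: the operators of largest
-- order in a relation determine its lowest component. The shape of μ enters twice. Translation
-- invariance needs cells that are closed downwards and listed along a linear extension of the
-- componentwise order. Lifting needs in addition a corner that dominates every cell, so that A-p
-- and B-q are genuine differences; this singles out rectangles. `IsChar` provides only matrices in
-- an unspecified basis of each bigraded component. Traces have to be carried over to the families
-- of derivatives, and even the invariance of characters under conjugation has to be derived. Since
-- `∂p₁` involves only cycle types with a part 1, conjugation then reduces everything to
-- permutations fixing 0, where the branching rule applies.

module ∑ = Algebra.Properties.Semiring.Sum (CommutativeRing.semiring ℚ.+-*-commutativeRing)
module ℚ-Solver = Data.Rational.Solver.+-*-Solver
module ℕ-Solver = Data.Nat.Solver.+-*-Solver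
open ≡-Reasoning

-- Finite sums of rationals

opaque
  sum : ∀ {n} → (Fin n → ℚ) → ℚ
  sum {zero}  f = 0ℚ
  sum {suc n} f = f zero + sum (f ∘ suc)

opaque
  unfolding sum

  sum≡∑ : ∀ {n} (f : Fin n → ℚ) → sum f ≡ ∑.sum f
  sum≡∑ {zero}  f = refl
  sum≡∑ {suc n} f = cong (f zero +_) (sum≡∑ (f ∘ suc))

  sum-cong-≗ : ∀ {n} {f g : Fin n → ℚ} → f ≗ g → sum f ≡ sum g
  sum-cong-≗ {zero}  f≗g = refl
  sum-cong-≗ {suc n} f≗g = cong₂ _+_ (f≗g zero) (sum-cong-≗ (f≗g ∘ suc))

  ∑-distrib-+ : ∀ {n} (f g : Fin n → ℚ) → sum (λ i → f i + g i) ≡ sum f + sum g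
  ∑-distrib-+ f g = trans (sum≡∑ (λ i → f i + g i)) (trans (∑.∑-distrib-+ f g) (sym (cong₂ _+_ (sum≡∑ f) (sum≡∑ g))))

  sum-replicate-zero : ∀ n → sum {n} (λ _ → 0ℚ) ≡ 0ℚ
  sum-replicate-zero n = trans (sum≡∑ {n} (λ _ → 0ℚ)) (∑.sum-replicate-zero n)

  ∑-comm : ∀ {m n} (f : Fin m → Fin n → ℚ) → sum (λ i → sum (λ j → f i j)) ≡ sum (λ j → sum (λ i → f i j))
  ∑-comm {zero}  {n} f = sym (sum-replicate-zero n)
  ∑-comm {suc m} {n} f = trans (cong (sum (f zero) +_) (∑-comm (f ∘ suc))) (sym (∑-distrib-+ (f zero) (λ j → sum λ i → f (suc i) j)))

  sum-remove : ∀ {n} {i : Fin (suc n)} (f : Fin (suc n) → ℚ) → sum f ≡ f i + sum (f ∘ punchIn i)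
  sum-remove {i = i} f = trans (sum≡∑ f) (trans (∑.sum-remove {i = i} f) (cong (f i +_) (sym (sum≡∑ (f ∘ punchIn i)))))

  *-distribˡ-sum : ∀ {n} x (f : Fin n → ℚ) → x * sum f ≡ sum (λ i → x * f i)
  *-distribˡ-sum {zero}  x f = ℚ.*-zeroʳ x
  *-distribˡ-sum {suc n} x f = trans (ℚ.*-distribˡ-+ x (f zero) _) (cong (x * f zero +_) (*-distribˡ-sum x (f ∘ suc)))

  *-distribʳ-sum : ∀ {n} x (f : Fin n → ℚ) → sum f * x ≡ sum (λ i → f i * x)
  *-distribʳ-sum {zero}  x f = ℚ.*-zeroˡ x
  *-distribʳ-sum {suc n} x f = trans (ℚ.*-distribʳ-+ x (f zero) _) (cong (f zero * x +_) (*-distribʳ-sum x (f ∘ suc)))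

  sum-suc : ∀ {n} (f : Fin (suc n) → ℚ) → sum f ≡ f zero + sum (f ∘ suc)
  sum-suc f = refl

  sum-neg : ∀ {n} (f : Fin n → ℚ) → sum (λ i → - f i) ≡ - sum f
  sum-neg {zero}  f = refl
  sum-neg {suc n} f = trans (cong (- f zero +_) (sum-neg (f ∘ suc))) (sym (ℚ.neg-distrib-+ (f zero) (sum (f ∘ suc))))

  sum-↑ : ∀ m {n} (f : Fin (m ℕ.+ n) → ℚ) → sum f ≡ sum (λ i → f (i ↑ˡ n)) + sum (λ j → f (m ↑ʳ j))
  sum-↑ zero    f = sym (ℚ.+-identityˡ (sum f))
  sum-↑ (suc m) f = trans (cong (f zero +_) (sum-↑ m (f ∘ suc))) (sym (ℚ.+-assoc (f zero) _ _))

  sum-combine : ∀ m {n} (f : Fin (m ℕ.* n) → ℚ) → sum f ≡ sum {m} (λ i → sum {n} (λ j → f (combine i j)))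
  sum-combine zero        f = refl
  sum-combine (suc m) {n} f = trans (sum-↑ n f) (cong (sum (λ j → f (j ↑ˡ (m ℕ.* n))) +_) (sum-combine m {n} (λ l → f (n ↑ʳ l))))

  ΣF≡sum : ∀ d (f : Fin d → ℚ) → ΣF d f ≡ sum f
  ΣF≡sum d f = trans (cong sumℚ (List.map-tabulate id f)) (go d f)
    where
    go : ∀ d (f : Fin d → ℚ) → sumℚ (List.tabulate f) ≡ sum f
    go zero    f = refl
    go (suc d) f = cong (f zero +_) (go d (f ∘ suc))

recip : ∀ p → p ≢ 0ℚ → Σ ℚ λ q → q * p ≡ 1ℚ
recip p p≢0 = ℚ.1/_ p {{ℚ.≢-nonZero p≢0}} , ℚ.*-inverseˡ p {{ℚ.≢-nonZero p≢0}}

*-cancelˡ-≡ : ∀ p q r → p ≢ 0ℚ → p * q ≡ p * r → q ≡ r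
*-cancelˡ-≡ p q r p≢0 eq with recip p p≢0
... | t , tp≡1 = begin
  q            ≡⟨ ℚ.*-identityˡ q ⟨
  1ℚ * q       ≡⟨ cong (_* q) tp≡1 ⟨
  t * p * q    ≡⟨ ℚ.*-assoc t p q ⟩
  t * (p * q)  ≡⟨ cong (t *_) eq ⟩
  t * (p * r)  ≡⟨ ℚ.*-assoc t p r ⟨
  t * p * r    ≡⟨ cong (_* r) tp≡1 ⟩
  1ℚ * r       ≡⟨ ℚ.*-identityˡ r ⟩
  r            ∎

*-≡0ˡ : ∀ {p} q → p ≡ 0ℚ → p * q ≡ 0ℚ
*-≡0ˡ q refl = ℚ.*-zeroˡ q

*-≡0ʳ : ∀ p {q} → q ≡ 0ℚ → p * q ≡ 0ℚ
*-≡0ʳ p refl = ℚ.*-zeroʳ p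

*-cancel-≡0 : ∀ p q → p ≢ 0ℚ → p * q ≡ 0ℚ → q ≡ 0ℚ
*-cancel-≡0 p q p≢0 pq≡0 = *-cancelˡ-≡ p q 0ℚ p≢0 (trans pq≡0 (sym (ℚ.*-zeroʳ p)))

sum-zero : ∀ {n} (f : Fin n → ℚ) → (∀ i → f i ≡ 0ℚ) → sum f ≡ 0ℚ
sum-zero {n} f f≡0 = trans (sum-cong-≗ f≡0) (sum-replicate-zero n)

sum-single : ∀ {n} (i : Fin n) (f : Fin n → ℚ) → (∀ j → j ≢ i → f j ≡ 0ℚ) → sum f ≡ f i
sum-single {suc n} i f f≡0 = begin
  sum f                        ≡⟨ sum-remove {i = i} f ⟩
  f i + sum (f ∘ punchIn i) ≡⟨ cong (f i +_) (sum-zero _ λ j → f≡0 _ (Fin.punchInᵢ≢i i j)) ⟩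
  f i + 0ℚ                     ≡⟨ ℚ.+-identityʳ _ ⟩
  f i                          ∎

sum-two : ∀ {n} (i j : Fin n) → i ≢ j → (f : Fin n → ℚ) →
          (∀ l → l ≢ i → l ≢ j → f l ≡ 0ℚ) → sum f ≡ f i + f j
sum-two {suc n} i j i≢j f f≡0 = begin
  sum f                                         ≡⟨ sum-remove {i = i} f ⟩
  f i + sum (f ∘ punchIn i) ≡⟨ cong (f i +_) (sum-single (punchOut i≢j) (f ∘ punchIn i) rest) ⟩
  f i + f (punchIn i (punchOut i≢j)) ≡⟨ cong (λ l → f i + f l) (Fin.punchIn-punchOut i≢j) ⟩
  f i + f j                                     ∎
  where
  rest : ∀ l → l ≢ punchOut i≢j → f (punchIn i l) ≡ 0ℚ
  rest l l≢ = f≡0 _ (Fin.punchInᵢ≢i i l) λ eq → l≢ (Fin.punchIn-injective i _ _ (trans eq (sym (Fin.punchIn-punchOut i≢j))))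

kron : ∀ {n} → Fin n → Fin n → ℚ
kron i j = if does (i Fin.≟ j) then 1ℚ else 0ℚ

kron-refl : ∀ {n} (i : Fin n) → kron i i ≡ 1ℚ
kron-refl i rewrite dec-true (i Fin.≟ i) refl = refl

kron-≢ : ∀ {n} {i j : Fin n} → i ≢ j → kron i j ≡ 0ℚ
kron-≢ {i = i} {j} i≢j rewrite dec-false (i Fin.≟ j) i≢j = refl

sum-kronˡ : ∀ {n} (i : Fin n) (f : Fin n → ℚ) → sum (λ j → kron i j * f j) ≡ f i
sum-kronˡ i f = begin
  sum (λ j → kron i j * f j) ≡⟨ sum-single i _ (λ j j≢i → *-≡0ˡ (f j) (kron-≢ (j≢i ∘ sym))) ⟩
  kron i i * f i              ≡⟨ cong (_* f i) (kron-refl i) ⟩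
  1ℚ * f i                    ≡⟨ ℚ.*-identityˡ (f i) ⟩
  f i                         ∎

-- Linear algebra in spaces of functions X → ℚ

lc : ∀ {X : Set} {d} → (Fin d → ℚ) → (Fin d → X → ℚ) → X → ℚ
lc c v x = sum (λ i → c i * v i x)

Indep : ∀ {X : Set} {d} → (Fin d → X → ℚ) → Set
Indep {X} {d} v = ∀ (c : Fin d → ℚ) → (∀ x → lc c v x ≡ 0ℚ) → ∀ i → c i ≡ 0ℚ

InSpan : ∀ {X : Set} {d} → (Fin d → X → ℚ) → (X → ℚ) → Set
InSpan {X} {d} v w = Σ (Fin d → ℚ) λ c → ∀ x → w x ≡ lc c v x

lc-cong : ∀ {X : Set} {d} {c c′ : Fin d → ℚ} (v : Fin d → X → ℚ) → c ≗ c′ → ∀ x → lc c v x ≡ lc c′ v x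
lc-cong v c≗c′ x = sum-cong-≗ λ i → cong (_* v i x) (c≗c′ i)

lc-+ : ∀ {X : Set} {d} (c c′ : Fin d → ℚ) (v : Fin d → X → ℚ) x →
       lc (λ i → c i + c′ i) v x ≡ lc c v x + lc c′ v x
lc-+ c c′ v x = trans (sum-cong-≗ λ i → ℚ.*-distribʳ-+ (v i x) (c i) (c′ i)) (∑-distrib-+ (λ i → c i * v i x) (λ i → c′ i * v i x))

lc-neg : ∀ {X : Set} {d} (c : Fin d → ℚ) (v : Fin d → X → ℚ) x → lc (λ i → - c i) v x ≡ - lc c v x
lc-neg c v x = trans (sum-cong-≗ λ i → sym (ℚ.neg-distribˡ-* (c i) (v i x))) (sum-neg λ i → c i * v i x)

lc-scale : ∀ {X : Set} {d} q (c : Fin d → ℚ) (v : Fin d → X → ℚ) x → lc (λ i → q * c i) v x ≡ q * lc c v x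
lc-scale q c v x = trans (sum-cong-≗ λ i → ℚ.*-assoc q (c i) (v i x)) (sym (*-distribˡ-sum q λ i → c i * v i x))

lc-lc : ∀ {X : Set} {d e} (c : Fin e → ℚ) (B : Fin e → Fin d → ℚ) (v : Fin d → X → ℚ) x →
        sum (λ j → c j * lc (B j) v x) ≡ lc (λ i → sum λ j → c j * B j i) v x
lc-lc c B v x = begin
  sum (λ j → c j * sum (λ i → B j i * v i x)) ≡⟨ sum-cong-≗ (λ j → *-distribˡ-sum (c j) λ i → B j i * v i x) ⟩
  sum (λ j → sum λ i → c j * (B j i * v i x))    ≡⟨ ∑-comm _ ⟩
  sum (λ i → sum λ j → c j * (B j i * v i x)) ≡⟨ sum-cong-≗ (λ i → sum-cong-≗ λ j → ℚ.*-assoc (c j) (B j i) (v i x)) ⟨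
  sum (λ i → sum λ j → c j * B j i * v i x) ≡⟨ sum-cong-≗ (λ i → *-distribʳ-sum (v i x) λ j → c j * B j i) ⟨
  lc (λ i → sum λ j → c j * B j i) v x           ∎

coords-unique : ∀ {X : Set} {d} {v : Fin d → X → ℚ} → Indep v → ∀ c c′ →
                (∀ x → lc c v x ≡ lc c′ v x) → c ≗ c′
coords-unique {v = v} ind c c′ eq i = x∙y⁻¹≈ε⇒x≈y ℚ.+-0-group (c i) (c′ i) (ind (λ j → c j + - c′ j) vanish i)
  where
  vanish : ∀ x → lc (λ j → c j + - c′ j) v x ≡ 0ℚ
  vanish x = begin
    lc (λ j → c j + - c′ j) v x           ≡⟨ lc-+ c (λ j → - c′ j) v x ⟩
    lc c v x + lc (λ j → - c′ j) v x      ≡⟨ cong₂ _+_ (eq x) (lc-neg c′ v x) ⟩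
    lc c′ v x + - lc c′ v x               ≡⟨ ℚ.+-inverseʳ (lc c′ v x) ⟩
    0ℚ                                    ∎

¬⇒≡0 : ∀ {p} → ¬ (p ≢ 0ℚ) → p ≡ 0ℚ
¬⇒≡0 {p} ¬p≢0 with p ℚ.≟ 0ℚ
... | yes p≡0 = p≡0
... | no  p≢0 = contradiction p≢0 ¬p≢0

any-≢0 : ∀ {n} (f : Fin n → ℚ) → (∃ λ i → f i ≢ 0ℚ) ⊎ (∀ i → f i ≡ 0ℚ)
any-≢0 {zero}  f = inj₂ λ ()
any-≢0 {suc n} f with f zero ℚ.≟ 0ℚ | any-≢0 (f ∘ suc)
... | no  f₀≢0 | _               = inj₁ (zero , f₀≢0)
... | yes f₀≡0 | inj₁ (i , fᵢ≢0) = inj₁ (suc i , fᵢ≢0)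
... | yes f₀≡0 | inj₂ f≡0        = inj₂ λ { zero → f₀≡0 ; (suc i) → f≡0 i }

punchIn-last : ∀ {m} (j : Fin m) → punchIn (fromℕ m) j ≡ inject₁ j
punchIn-last zero    = refl
punchIn-last (suc j) = cong suc (punchIn-last j)

-- Gaussian elimination on coordinate `zero`. If it vanishes on all vectors, the last vector gets
-- coefficient 0 and the coordinate is dropped; otherwise a pivot `p` clears it from the other
-- vectors.
dependent : ∀ n (v : Fin (suc n) → Fin n → ℚ) →
            Σ (Fin (suc n) → ℚ) λ c → (∃ λ i → c i ≢ 0ℚ) × (∀ x → lc c v x ≡ 0ℚ)
dependent zero    v = (λ _ → 1ℚ) , (zero , λ ()) , λ ()
dependent (suc n) v with any-≢0 (λ i → v i zero)
... | inj₂ v₀≡0 with dependent n (λ i x → v (inject₁ i) (suc x))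
...   | c , (i , cᵢ≢0) , vanish = c⁺ , (inject₁ i , subst (_≢ 0ℚ) (sym (at-inject₁ i)) cᵢ≢0) , vanish⁺
  where
  last = fromℕ (suc n)
  c⁺ : Fin (suc (suc n)) → ℚ
  c⁺ = insertAt c last 0ℚ
  at-inject₁ : ∀ j → c⁺ (inject₁ j) ≡ c j
  at-inject₁ j = trans (cong c⁺ (sym (punchIn-last j))) (insertAt-punchIn c last 0ℚ j)
  vanish⁺ : ∀ x → lc c⁺ v x ≡ 0ℚ
  vanish⁺ zero    = sum-zero _ λ j → *-≡0ʳ (c⁺ j) (v₀≡0 j)
  vanish⁺ (suc x) = begin
    lc c⁺ v (suc x) ≡⟨ sum-remove {i = last} (λ j → c⁺ j * v j (suc x)) ⟩
    c⁺ last * v last (suc x)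
      + sum (λ j → c⁺ (punchIn last j) * v (punchIn last j) (suc x)) ≡⟨ cong₂ _+_ (*-≡0ˡ (v last (suc x)) (insertAt-lookup c last 0ℚ))
                                                                            (sum-cong-≗ λ j → cong₂ _*_ (insertAt-punchIn c last 0ℚ j) (cong (λ l → v l (suc x)) (punchIn-last j))) ⟩
    0ℚ + lc c (λ i x → v (inject₁ i) (suc x)) x ≡⟨ cong (0ℚ +_) (vanish x) ⟩
    0ℚ                                                               ∎
dependent (suc n) v | inj₁ (p , vₚ≢0) with recip (v p zero) vₚ≢0
... | r , rvₚ≡1 = result (dependent n w)
  where
  ratio : Fin (suc n) → ℚ
  ratio i = v (punchIn p i) zero * r
  w : Fin (suc n) → Fin n → ℚ
  w i x = v (punchIn p i) (suc x) + - (ratio i * v p (suc x))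
  result : Σ (Fin (suc n) → ℚ) (λ c → (∃ λ i → c i ≢ 0ℚ) × (∀ x → lc c w x ≡ 0ℚ)) →
           Σ (Fin (suc (suc n)) → ℚ) (λ c → (∃ λ i → c i ≢ 0ℚ) × (∀ x → lc c v x ≡ 0ℚ))
  result (c , (i , cᵢ≢0) , vanish) =
    c⁺ , (punchIn p i , subst (_≢ 0ℚ) (sym (insertAt-punchIn c p cₚ i)) cᵢ≢0) , vanish⁺
    where
    -- The multiples of `v p` subtracted in `w` are collected into one coefficient at the pivot.
    cₚ = - sum (λ i → c i * ratio i)
    c⁺ : Fin (suc (suc n)) → ℚ
    c⁺ = insertAt c p cₚ
    expand : ∀ x → lc c⁺ v x ≡ sum (λ i → c i * (v (punchIn p i) x + - (ratio i * v p x)))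
    expand x = begin
      lc c⁺ v x
        ≡⟨ sum-remove {i = p} (λ j → c⁺ j * v j x) ⟩
      c⁺ p * v p x + sum (λ j → c⁺ (punchIn p j) * v (punchIn p j) x)
        ≡⟨ cong₂ _+_ (cong (_* v p x) (insertAt-lookup c p cₚ)) (sum-cong-≗ λ j → cong (_* v (punchIn p j) x) (insertAt-punchIn c p cₚ j)) ⟩
      cₚ * v p x + sum (λ j → c j * v (punchIn p j) x)
        ≡⟨ cong (_+ sum (λ j → c j * v (punchIn p j) x)) first ⟩
      sum (λ i → - (c i * (ratio i * v p x))) + sum (λ j → c j * v (punchIn p j) x)
        ≡⟨ ∑-distrib-+ (λ i → - (c i * (ratio i * v p x))) (λ j → c j * v (punchIn p j) x) ⟨
      sum (λ i → - (c i * (ratio i * v p x)) + c i * v (punchIn p i) x)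
        ≡⟨ sum-cong-≗ (λ i → solve 3 (λ c a b → :- (c :* a) :+ c :* b := c :* (b :+ :- a)) refl (c i) (ratio i * v p x) (v (punchIn p i) x)) ⟩
      sum (λ i → c i * (v (punchIn p i) x + - (ratio i * v p x))) ∎
      where
      open ℚ-Solver
      first : cₚ * v p x ≡ sum (λ i → - (c i * (ratio i * v p x)))
      first = begin
        cₚ * v p x ≡⟨ ℚ.neg-distribˡ-* (sum λ i → c i * ratio i) (v p x) ⟨
        - (sum (λ i → c i * ratio i) * v p x) ≡⟨ cong -_ (*-distribʳ-sum (v p x) λ i → c i * ratio i) ⟩
        - sum (λ i → c i * ratio i * v p x) ≡⟨ sum-neg (λ i → c i * ratio i * v p x) ⟨
        sum (λ i → - (c i * ratio i * v p x)) ≡⟨ sum-cong-≗ (λ i → cong -_ (ℚ.*-assoc (c i) (ratio i) (v p x))) ⟩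
        sum (λ i → - (c i * (ratio i * v p x)))        ∎
    vanish⁺ : ∀ x → lc c⁺ v x ≡ 0ℚ
    vanish⁺ (suc x) = trans (expand (suc x)) (vanish x)
    vanish⁺ zero    = trans (expand zero) (sum-zero _ λ i → cancel (c i) (v (punchIn p i) zero))
      where
      cancel : ∀ c a → c * (a + - (a * r * v p zero)) ≡ 0ℚ
      cancel c a = begin
        c * (a + - (a * r * v p zero)) ≡⟨ cong (λ z → c * (a + - z)) (ℚ.*-assoc a r _) ⟩
        c * (a + - (a * (r * v p zero)))  ≡⟨ cong (λ z → c * (a + - (a * z))) rvₚ≡1 ⟩
        c * (a + - (a * 1ℚ)) ≡⟨ cong (λ z → c * (a + - z)) (ℚ.*-identityʳ a) ⟩
        c * (a + - a)                         ≡⟨ cong (c *_) (ℚ.+-inverseʳ a) ⟩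
        c * 0ℚ                                ≡⟨ ℚ.*-zeroʳ c ⟩
        0ℚ                                    ∎

-- A relation with coefficient 0 at `w` would be a relation among the independent `v`, hence
-- trivial; so `a zero` can be divided out.
dependence⇒InSpan : ∀ {X : Set} {d} (v : Fin d → X → ℚ) (w : X → ℚ) → Indep v → (a : Fin (suc d) → ℚ) →
  (∃ λ i → a i ≢ 0ℚ) → (∀ x → a zero * w x + lc (a ∘ suc) v x ≡ 0ℚ) → InSpan v w
dependence⇒InSpan v w ind a (i , aᵢ≢0) vanish with a zero ℚ.≟ 0ℚ
... | yes a₀≡0 = contradiction (a≡0 i) aᵢ≢0
  where
  a≡0 : ∀ i → a i ≡ 0ℚ
  a≡0 zero    = a₀≡0
  a≡0 (suc i) = ind (a ∘ suc) (λ x → begin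
    lc (a ∘ suc) v x                     ≡⟨ ℚ.+-identityˡ _ ⟨
    0ℚ + lc (a ∘ suc) v x ≡⟨ cong (_+ lc (a ∘ suc) v x) (*-≡0ˡ (w x) a₀≡0) ⟨
    a zero * w x + lc (a ∘ suc) v x  ≡⟨ vanish x ⟩
    0ℚ                                       ∎) i
... | no a₀≢0 with recip (a zero) a₀≢0
...   | r , ra₀≡1 = (λ i → - r * a (suc i)) , λ x → begin
  w x ≡⟨ ℚ.*-identityˡ (w x) ⟨
  1ℚ * w x ≡⟨ cong (_* w x) ra₀≡1 ⟨
  r * a zero * w x ≡⟨ solve 4 (λ r a w l → r :* a :* w := r :* (a :* w :+ l) :+ :- r :* l) refl r (a zero) (w x) (lc (a ∘ suc) v x) ⟩
  r * (a zero * w x + lc (a ∘ suc) v x) + - r * lc (a ∘ suc) v x ≡⟨ cong (λ z → r * z + - r * lc (a ∘ suc) v x) (vanish x) ⟩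
  r * 0ℚ + - r * lc (a ∘ suc) v x ≡⟨ cong (_+ - r * lc (a ∘ suc) v x) (ℚ.*-zeroʳ r) ⟩
  0ℚ + - r * lc (a ∘ suc) v x                                ≡⟨ ℚ.+-identityˡ _ ⟩
  - r * lc (a ∘ suc) v x ≡⟨ lc-scale (- r) (a ∘ suc) v x ⟨
  lc (λ i → - r * a (suc i)) v x                             ∎
  where open ℚ-Solver

-- Combinations over lists, repetitions allowed: the form in which `InM` presents its elements.
lincomb : ∀ {X I : Set} → (I → X → ℚ) → List (ℚ × I) → X → ℚ
lincomb f []            x = 0ℚ
lincomb f ((q , m) ∷ L) x = q * f m x + lincomb f L x

lincomb∈span : ∀ {X I : Set} {d} (f : I → X → ℚ) (v : Fin d → X → ℚ) → (∀ m → InSpan v (f m)) →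
               ∀ L → InSpan v (lincomb f L)
lincomb∈span f v f∈v []            = (λ _ → 0ℚ) , λ x → sym (sum-zero _ λ i → ℚ.*-zeroˡ (v i x))
lincomb∈span f v f∈v ((q , m) ∷ L) = let (a , fm≡) = f∈v m ; (b , L≡) = lincomb∈span f v f∈v L in
  (λ i → q * a i + b i) , λ x → begin
    q * f m x + lincomb f L x ≡⟨ cong₂ (λ y z → q * y + z) (fm≡ x) (L≡ x) ⟩
    q * lc a v x + lc b v x                  ≡⟨ cong (_+ lc b v x) (lc-scale q a v x) ⟨
    lc (λ i → q * a i) v x + lc b v x        ≡⟨ lc-+ (λ i → q * a i) b v x ⟨
    lc (λ i → q * a i + b i) v x             ∎

-- Steinitz exchange

replace : ∀ {A : Set} {d} → (Fin d → A) → Fin d → A → Fin d → A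
replace v p w i = if does (i Fin.≟ p) then w else v i

replace-p : ∀ {A : Set} {d} (v : Fin d → A) p w → replace v p w p ≡ w
replace-p v p w rewrite dec-true (p Fin.≟ p) refl = refl

replace-≢ : ∀ {A : Set} {d} (v : Fin d → A) p w {i} → i ≢ p → replace v p w i ≡ v i
replace-≢ v p w {i} i≢p rewrite dec-false (i Fin.≟ p) i≢p = refl

replace-map : ∀ {A B : Set} {d} (g : A → B) (v : Fin d → A) p w i →
              g (replace v p w i) ≡ replace (g ∘ v) p (g w) i
replace-map g v p w i with does (i Fin.≟ p)
... | true  = refl
... | false = refl

-- A nonzero coordinate of `w` at `p` lets `w` take the place of `v p`. `toOld` converts coordinates
-- with respect to `v′` into coordinates with respect to `v`.
module Exchange {X : Set} {d} (v : Fin d → X → ℚ) (p : Fin d) (w : X → ℚ)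
                (c : Fin d → ℚ) (w≡lc : ∀ x → w x ≡ lc c v x) (cₚ≢0 : c p ≢ 0ℚ) where

  v′ : Fin d → X → ℚ
  v′ = replace v p w

  toOld : (Fin d → ℚ) → Fin d → ℚ
  toOld a i = replace a p 0ℚ i + a p * c i

  lc-toOld : ∀ a x → lc a v′ x ≡ lc (toOld a) v x
  lc-toOld a x = begin
    lc a v′ x                                          ≡⟨ sum-cong-≗ split ⟩
    sum (λ i → replace a p 0ℚ i * v i x + kron p i * (a i * w x)) ≡⟨ ∑-distrib-+ (λ i → replace a p 0ℚ i * v i x) (λ i → kron p i * (a i * w x)) ⟩
    lc (replace a p 0ℚ) v x + sum (λ i → kron p i * (a i * w x)) ≡⟨ cong (lc (replace a p 0ℚ) v x +_) (sum-kronˡ p λ i → a i * w x) ⟩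
    lc (replace a p 0ℚ) v x + a p * w x ≡⟨ cong (λ z → lc (replace a p 0ℚ) v x + a p * z) (w≡lc x) ⟩
    lc (replace a p 0ℚ) v x + a p * lc c v x ≡⟨ cong (lc (replace a p 0ℚ) v x +_) (lc-scale (a p) c v x) ⟨
    lc (replace a p 0ℚ) v x + lc (λ i → a p * c i) v x ≡⟨ lc-+ (replace a p 0ℚ) (λ i → a p * c i) v x ⟨
    lc (toOld a) v x                                   ∎
    where
    split : ∀ i → a i * v′ i x ≡ replace a p 0ℚ i * v i x + kron p i * (a i * w x)
    split i with i Fin.≟ p
    ... | yes refl = begin
      a p * w x                                    ≡⟨ ℚ.*-identityˡ (a p * w x) ⟨
      1ℚ * (a p * w x) ≡⟨ cong (_* (a p * w x)) (kron-refl p) ⟨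
      kron p p * (a p * w x)                       ≡⟨ ℚ.+-identityˡ _ ⟨
      0ℚ + kron p p * (a p * w x) ≡⟨ cong (_+ kron p p * (a p * w x)) (ℚ.*-zeroˡ (v p x)) ⟨
      0ℚ * v p x + kron p p * (a p * w x)          ∎
    ... | no i≢p = begin
      a i * v i x                                  ≡⟨ ℚ.+-identityʳ _ ⟨
      a i * v i x + 0ℚ ≡⟨ cong (a i * v i x +_) (ℚ.*-zeroˡ (a i * w x)) ⟨
      a i * v i x + 0ℚ * (a i * w x) ≡⟨ cong (λ z → a i * v i x + z * (a i * w x)) (kron-≢ (i≢p ∘ sym)) ⟨
      a i * v i x + kron p i * (a i * w x)         ∎

  indep : Indep v → Indep v′
  indep ind a vanish i = by-cases (i Fin.≟ p)
    where
    old≡0 : ∀ i → toOld a i ≡ 0ℚ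
    old≡0 = ind (toOld a) λ x → trans (sym (lc-toOld a x)) (vanish x)
    aₚ≡0 : a p ≡ 0ℚ
    aₚ≡0 = *-cancel-≡0 (c p) (a p) cₚ≢0 (begin
      c p * a p                        ≡⟨ ℚ.*-comm (c p) (a p) ⟩
      a p * c p                        ≡⟨ ℚ.+-identityˡ _ ⟨
      0ℚ + a p * c p                   ≡⟨ cong (_+ a p * c p) (replace-p a p 0ℚ) ⟨
      toOld a p                        ≡⟨ old≡0 p ⟩
      0ℚ                               ∎)
    by-cases : Dec (i ≡ p) → a i ≡ 0ℚ
    by-cases (yes refl) = aₚ≡0
    by-cases (no i≢p)   = begin
      a i                              ≡⟨ replace-≢ a p 0ℚ i≢p ⟨
      replace a p 0ℚ i                 ≡⟨ ℚ.+-identityʳ _ ⟨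
      replace a p 0ℚ i + 0ℚ            ≡⟨ cong (replace a p 0ℚ i +_) (ℚ.*-zeroˡ (c i)) ⟨
      replace a p 0ℚ i + 0ℚ * c i      ≡⟨ cong (λ z → replace a p 0ℚ i + z * c i) aₚ≡0 ⟨
      toOld a i                        ≡⟨ old≡0 i ⟩
      0ℚ                               ∎

  span : ∀ u → InSpan v u → InSpan v′ u
  span u (a , u≡lc) with recip (c p) cₚ≢0
  ... | r , rcₚ≡1 = a′ , λ x → begin
      u x               ≡⟨ u≡lc x ⟩
      lc a v x          ≡⟨ lc-cong v coords x ⟩
      lc (toOld a′) v x ≡⟨ lc-toOld a′ x ⟨
      lc a′ v′ x        ∎
    where
    -- `v p` is eliminated by means of `w`: it equals `r` times the difference of `w` and the other
    -- terms of `lc c v`.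
    aₚ′ = a p * r
    a′ : Fin d → ℚ
    a′ = replace (λ i → a i + - (aₚ′ * c i)) p aₚ′
    coords : a ≗ toOld a′
    coords i = by-cases (i Fin.≟ p)
      where
      open ℚ-Solver
      b : Fin d → ℚ
      b i = a i + - (aₚ′ * c i)
      by-cases : Dec (i ≡ p) → a i ≡ toOld a′ i
      by-cases (yes refl) = begin
        a p                              ≡⟨ ℚ.*-identityʳ (a p) ⟨
        a p * 1ℚ                         ≡⟨ cong (a p *_) rcₚ≡1 ⟨
        a p * (r * c p)                  ≡⟨ ℚ.*-assoc (a p) r (c p) ⟨
        aₚ′ * c p                        ≡⟨ cong (_* c p) (replace-p b p aₚ′) ⟨
        a′ p * c p                       ≡⟨ ℚ.+-identityˡ _ ⟨
        0ℚ + a′ p * c p                  ≡⟨ cong (_+ a′ p * c p) (replace-p a′ p 0ℚ) ⟨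
        toOld a′ p                       ∎
      by-cases (no i≢p) = begin
        a i ≡⟨ solve 2 (λ a b → a := (a :+ :- b) :+ b) refl (a i) (aₚ′ * c i) ⟩
        b i + aₚ′ * c i ≡⟨ cong₂ (λ y z → y + z * c i) (replace-≢ b p aₚ′ i≢p) (replace-p b p aₚ′) ⟨
        a′ i + a′ p * c i ≡⟨ cong (_+ a′ p * c i) (replace-≢ a′ p 0ℚ i≢p) ⟨
        toOld a′ i                       ∎

-- The hypothesis on the dimension supplies an arbitrary basis `e`, whereas only exponents of
-- derivatives can be lifted to the larger diagram. The members of `e` are therefore exchanged, slot
-- by slot, for members of `f`.
module Steinitz {X I : Set} (f : I → X → ℚ) {d} (e : Fin d → X → ℚ) (e-indep : Indep e)
                (e∈f : ∀ i → Σ (List (ℚ × I)) λ L → ∀ x → e i x ≡ lincomb f L x)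
                (f∈e : ∀ m → InSpan e (f m)) where

  val : I ⊎ Fin d → X → ℚ
  val = [ f , e ]′

  record Stage (t : ℕ) : Set where
    field
      u       : Fin d → I ⊎ Fin d
      indep   : Indep (val ∘ u)
      span    : ∀ m → InSpan (val ∘ u) (f m)
      done    : ∀ i → toℕ i < t → ∃ λ m → u i ≡ inj₁ m
  open Stage

  val∈f : ∀ z → Σ (List (ℚ × I)) λ L → ∀ x → val z x ≡ lincomb f L x
  val∈f (inj₁ m) = (1ℚ , m) ∷ [] , λ x → sym (trans (ℚ.+-identityʳ _) (ℚ.*-identityˡ (f m x)))
  val∈f (inj₂ i) = e∈f i

  coordinate : ∀ {t} → (S : Stage t) → I → Fin d → ℚ
  coordinate S m = proj₁ (span S m)

  -- The vector in slot `p` has coordinate 1 at `p` and is a finite combination of members of `f`,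
  -- which therefore cannot all have coordinate 0 at `p`.
  find : ∀ {t} (S : Stage t) (p : Fin d) → ∃ λ m → coordinate S m p ≢ 0ℚ
  find S p with val∈f (u S p)
  ... | L , eq = search L λ vanish → contradiction (trans (sym (kron-refl p)) (trans (coords L eq p) vanish)) λ ()
    where
    total : List (ℚ × I) → Fin d → ℚ
    total L = proj₁ (lincomb∈span f (val ∘ u S) (span S) L)
    coords : ∀ L → (∀ x → val (u S p) x ≡ lincomb f L x) → kron p ≗ total L
    coords L eq = coords-unique (indep S) (kron p) (total L) λ x →
      trans (sum-kronˡ p λ i → val (u S i) x) (trans (eq x) (proj₂ (lincomb∈span f (val ∘ u S) (span S) L) x))
    search : ∀ L → total L p ≢ 0ℚ → ∃ λ m → coordinate S m p ≢ 0ℚ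
    search []            t≢0 = contradiction refl t≢0
    search ((q , m) ∷ L) t≢0 with coordinate S m p ℚ.≟ 0ℚ
    ... | no  c≢0 = m , c≢0
    ... | yes c≡0 = search L λ t≡0 → t≢0 (trans (cong₂ (λ y z → q * y + z) c≡0 t≡0) (trans (ℚ.+-identityʳ (q * 0ℚ)) (ℚ.*-zeroʳ q)))

  step : ∀ {t} → t < d → Stage t → Stage (suc t)
  step {t} t<d S = step-at (find S p)
    where
    p = Fin.fromℕ< t<d
    step-at : (∃ λ m → coordinate S m p ≢ 0ℚ) → Stage (suc t)
    step-at (m , cₚ≢0) = record
      { u     = u′
      ; indep = λ a vanish → E.indep (indep S) a λ x → trans (sym (lc-same a x)) (vanish x)
      ; span  = λ m′ → let (a , eq) = E.span (f m′) (span S m′) in a , λ x → trans (eq x) (sym (lc-same a x))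
      ; done  = λ i i<1+t → done′ i i<1+t (i Fin.≟ p)
      }
      where
      u′ = replace (u S) p (inj₁ m)
      module E = Exchange (val ∘ u S) p (f m) (coordinate S m) (proj₂ (span S m)) cₚ≢0
      lc-same : ∀ a x → lc a (val ∘ u′) x ≡ lc a E.v′ x
      lc-same a x = sum-cong-≗ λ i → cong (λ w → a i * w x) (replace-map val (u S) p (inj₁ m) i)
      done′ : ∀ i → toℕ i < suc t → Dec (i ≡ p) → ∃ λ m → u′ i ≡ inj₁ m
      done′ i _     (yes refl) = m , replace-p (u S) p (inj₁ m)
      done′ i i<1+t (no i≢p)   = proj₁ old , trans (replace-≢ (u S) p (inj₁ m) i≢p) (proj₂ old)
        where
        old : ∃ λ m → u S i ≡ inj₁ m
        old = done S i (ℕ.≤∧≢⇒< (ℕ.≤-pred i<1+t) λ i≡t → i≢p (Fin.toℕ-injective (trans i≡t (sym (Fin.toℕ-fromℕ< t<d)))))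

  stages : ∀ t → t ≤ d → Stage t
  stages zero    _   = record { u = inj₂ ; indep = e-indep ; span = f∈e ; done = λ _ () }
  stages (suc t) t<d = step t<d (stages t (ℕ.<⇒≤ t<d))

  selection : Σ (Fin d → I) λ g → Indep (f ∘ g) × (∀ m → InSpan (f ∘ g) (f m))
  selection = g , (λ a vanish → indep S a λ x → trans (lc-same a x) (vanish x))
                , (λ m → proj₁ (span S m) , λ x → trans (proj₂ (span S m) x) (lc-same (proj₁ (span S m)) x))
    where
    S = stages d ℕ.≤-refl
    g : Fin d → I
    g i = proj₁ (done S i (Fin.toℕ<n i))
    lc-same : ∀ a x → lc a (val ∘ u S) x ≡ lc a (f ∘ g) x
    lc-same a x = sum-cong-≗ λ i → cong (λ z → a i * val z x) (proj₂ (done S i (Fin.toℕ<n i)))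

-- The trace of w ↦ w ∘ T on the span of e, computed in a possibly larger family b: Q is only required
-- to express in terms of e those members of b that occur in P.
module Trace {X : Set} (T : X → X) {d D} (e : Fin d → X → ℚ) (e-indep : Indep e) (b : Fin D → X → ℚ)
             (P : Fin D → Fin d → ℚ) (e≡Pb : ∀ j x → e j x ≡ lc (λ i → P i j) b x)
             (Q : Fin d → Fin D → ℚ) (e≡PQe : ∀ l x → e l x ≡ sum (λ i → P i l * lc (λ j → Q j i) e x))
             (a : Fin d → Fin d → ℚ) (Te≡ae : ∀ j x → e j (T x) ≡ lc (λ l → a l j) e x) where

  mat : Fin D → Fin D → ℚ
  mat i′ i = sum λ l → P i′ l * sum λ j → a l j * Q j i

  -- Expressing `e` through `b` by P and going back by Q gives `e` again, so independence forces QP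
  -- = 1. As `mat` is PaQ, its trace is that of aQP = a.
  QP : ∀ j l → sum (λ i → Q j i * P i l) ≡ kron l j
  QP j l = coords-unique e-indep (λ j → sum λ i → Q j i * P i l) (kron l) same j
    where
    same : ∀ x → lc (λ j → sum λ i → Q j i * P i l) e x ≡ lc (kron l) e x
    same x = begin
      lc (λ j → sum λ i → Q j i * P i l) e x ≡⟨ lc-cong e (λ j → sum-cong-≗ λ i → ℚ.*-comm (Q j i) (P i l)) x ⟩
      lc (λ j → sum λ i → P i l * Q j i) e x ≡⟨ lc-lc (λ i → P i l) (λ i j → Q j i) e x ⟨
      sum (λ i → P i l * lc (λ j → Q j i) e x)  ≡⟨ e≡PQe l x ⟨
      e l x                                     ≡⟨ sum-kronˡ l (λ j → e j x) ⟨
      lc (kron l) e x                           ∎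

  trace : sum (λ l → a l l) ≡ sum (λ i → mat i i)
  trace = sym (begin
    sum (λ i → sum λ l → P i l * sum λ j → a l j * Q j i)
      ≡⟨ ∑-comm (λ i l → P i l * sum λ j → a l j * Q j i) ⟩
    sum (λ l → sum λ i → P i l * sum λ j → a l j * Q j i)
      ≡⟨ sum-cong-≗ inner ⟩
    sum (λ l → a l l) ∎)
    where
    open ℚ-Solver
    inner : ∀ l → sum (λ i → P i l * sum λ j → a l j * Q j i) ≡ a l l
    inner l = begin
      sum (λ i → P i l * sum λ j → a l j * Q j i)
        ≡⟨ sum-cong-≗ (λ i → *-distribˡ-sum (P i l) (λ j → a l j * Q j i)) ⟩
      sum (λ i → sum λ j → P i l * (a l j * Q j i))
        ≡⟨ ∑-comm (λ i j → P i l * (a l j * Q j i)) ⟩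
      sum (λ j → sum λ i → P i l * (a l j * Q j i))
        ≡⟨ sum-cong-≗ (λ j → sum-cong-≗ λ i → solve 3 (λ p a q → p :* (a :* q) := a :* (q :* p)) refl (P i l) (a l j) (Q j i)) ⟩
      sum (λ j → sum λ i → a l j * (Q j i * P i l))
        ≡⟨ sum-cong-≗ (λ j → *-distribˡ-sum (a l j) (λ i → Q j i * P i l)) ⟨
      sum (λ j → a l j * sum λ i → Q j i * P i l)
        ≡⟨ sum-cong-≗ (λ j → trans (cong (a l j *_) (QP j l)) (ℚ.*-comm (a l j) (kron l j))) ⟩
      sum (λ j → kron l j * a l j)
        ≡⟨ sum-kronˡ l (a l) ⟩
      a l l ∎

  mat-acts : ∀ i → (∀ x → b i x ≡ lc (λ j → Q j i) e x) → ∀ x → b i (T x) ≡ lc (λ i′ → mat i′ i) b x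
  mat-acts i b≡Qe x = begin
    b i (T x)
      ≡⟨ b≡Qe (T x) ⟩
    sum (λ j → Q j i * e j (T x))
      ≡⟨ sum-cong-≗ (λ j → cong (Q j i *_) (Te≡ae j x)) ⟩
    sum (λ j → Q j i * lc (λ l → a l j) e x)
      ≡⟨ lc-lc (λ j → Q j i) (λ j l → a l j) e x ⟩
    sum (λ l → (sum λ j → Q j i * a l j) * e l x)
      ≡⟨ sum-cong-≗ (λ l → cong₂ _*_ (sum-cong-≗ λ j → ℚ.*-comm (Q j i) (a l j)) (e≡Pb l x)) ⟩
    sum (λ l → (sum λ j → a l j * Q j i) * lc (λ i′ → P i′ l) b x)
      ≡⟨ lc-lc (λ l → sum λ j → a l j * Q j i) (λ l i′ → P i′ l) b x ⟩
    lc (λ i′ → sum λ l → (sum λ j → a l j * Q j i) * P i′ l) b x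
      ≡⟨ lc-cong b (λ i′ → sum-cong-≗ λ l → ℚ.*-comm (sum λ j → a l j * Q j i) (P i′ l)) x ⟩
    lc (λ i′ → mat i′ i) b x ∎

-- Natural numbers as rationals; falling factorials

qℕ-+ : ∀ m n → qℕ (m ℕ.+ n) ≡ qℕ m + qℕ n
qℕ-+ m n = ℚ.toℚᵘ-injective
  (ℚᵘ.≃-trans (ℚ.toℚᵘ-fromℚᵘ (ι (m ℕ.+ n)))
  (ℚᵘ.≃-trans (ℚᵘ.*≡* (cong (ℤ._* ℤ.+ 1) (sym (cong₂ ℤ._+_ (ℤ.*-identityʳ (ℤ.+ m)) (ℤ.*-identityʳ (ℤ.+ n))))))
  (ℚᵘ.≃-trans (ℚᵘ.+-cong (ℚᵘ.≃-sym (ℚ.toℚᵘ-fromℚᵘ (ι m))) (ℚᵘ.≃-sym (ℚ.toℚᵘ-fromℚᵘ (ι n))))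
              (ℚᵘ.≃-sym (ℚ.toℚᵘ-homo-+ (qℕ m) (qℕ n))))))
  where
  ι : ℕ → ℚᵘ.ℚᵘ
  ι k = ℚᵘ.mkℚᵘ (ℤ.+ k) 0

qℕ-* : ∀ m n → qℕ (m ℕ.* n) ≡ qℕ m * qℕ n
qℕ-* zero    n = sym (ℚ.*-zeroˡ (qℕ n))
qℕ-* (suc m) n = begin
  qℕ (n ℕ.+ m ℕ.* n)     ≡⟨ qℕ-+ n (m ℕ.* n) ⟩
  qℕ n + qℕ (m ℕ.* n)    ≡⟨ cong (qℕ n +_) (qℕ-* m n) ⟩
  qℕ n + qℕ m * qℕ n     ≡⟨ cong (_+ qℕ m * qℕ n) (ℚ.*-identityˡ (qℕ n)) ⟨
  1ℚ * qℕ n + qℕ m * qℕ n ≡⟨ ℚ.*-distribʳ-+ (qℕ n) 1ℚ (qℕ m) ⟨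
  (qℕ 1 + qℕ m) * qℕ n   ≡⟨ cong (_* qℕ n) (qℕ-+ 1 m) ⟨
  qℕ (suc m) * qℕ n      ∎

qℕ-≢0 : ∀ n .{{_ : ℕ.NonZero n}} → qℕ n ≢ 0ℚ
qℕ-≢0 (suc n) eq = ℕ.1+n≢0 {n} (ℤ.+-injective (trans (sym (ℤ.*-identityʳ (ℤ.+ suc n))) (ℚᵘ.drop-*≡* (ℚ./-injective-≃ (ℚᵘ.mkℚᵘ (ℤ.+ suc n) 0) (ℚᵘ.mkℚᵘ (ℤ.+ 0) 0) eq))))

opaque
  -- An opaque copy of `qℕ`, whose values would otherwise unfold to normalised fractions;
  -- computations rest on the laws below.
  ι : ℕ → ℚ
  ι = qℕ

  ι≡qℕ : ∀ n → ι n ≡ qℕ n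
  ι≡qℕ n = refl

  ι-0 : ι 0 ≡ 0ℚ
  ι-0 = refl

  ι-1 : ι 1 ≡ 1ℚ
  ι-1 = refl

  ι-+ : ∀ m n → ι (m ℕ.+ n) ≡ ι m + ι n
  ι-+ = qℕ-+

  ι-* : ∀ m n → ι (m ℕ.* n) ≡ ι m * ι n
  ι-* = qℕ-*

  ι-≢0 : ∀ n .{{_ : ℕ.NonZero n}} → ι n ≢ 0ℚ
  ι-≢0 = qℕ-≢0

if-yes : ∀ {A P : Set} (P? : Dec P) {x y : A} → P → (if does P? then x else y) ≡ x
if-yes P? {x} {y} p = cong (λ b → if b then x else y) (dec-true P? p)

if-no : ∀ {A P : Set} (P? : Dec P) {x y : A} → ¬ P → (if does P? then x else y) ≡ y
if-no P? {x} {y} ¬p = cong (λ b → if b then x else y) (dec-false P? ¬p)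

-- `falling p u` is u! times the coefficient of x^u in (1+x)^p.
falling : ℕ → ℕ → ℕ
falling p       zero    = 1
falling zero    (suc u) = 0
falling (suc p) (suc u) = suc p ℕ.* falling p u

falling-! : ∀ p → falling p p ≡ p !
falling-! zero    = refl
falling-! (suc p) = cong (suc p ℕ.*_) (falling-! p)

falling-> : ∀ {p u} → p < u → falling p u ≡ 0
falling-> {zero}  (s≤s _)   = refl
falling-> {suc p} (s≤s p<u) = trans (cong (suc p ℕ.*_) (falling-> p<u)) (ℕ.*-zeroʳ (suc p))

-- The identity (1+x)∂(1+x)^p = p(1+x)^p in scaled coefficients: ∂ raises `u` by one, x∂ multiplies
-- by `u`.
falling-rec : ∀ p u → p ℕ.* falling p u ≡ falling p (suc u) ℕ.+ u ℕ.* falling p u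
falling-rec zero    zero    = refl
falling-rec zero    (suc u) = sym (ℕ.*-zeroʳ (suc u))
falling-rec (suc p) zero    = sym (ℕ.+-identityʳ _)
falling-rec (suc p) (suc u) = begin
  suc p ℕ.* (suc p ℕ.* f) ≡⟨ cong (λ z → suc p ℕ.* (f ℕ.+ z)) (falling-rec p u) ⟩
  suc p ℕ.* (f ℕ.+ (falling p (suc u) ℕ.+ u ℕ.* f)) ≡⟨ solve 4 (λ p f g u → p :* (f :+ (g :+ u :* f)) := p :* g :+ (con 1 :+ u) :* (p :* f)) refl (suc p) f (falling p (suc u)) u ⟩
  suc p ℕ.* falling p (suc u) ℕ.+ suc u ℕ.* (suc p ℕ.* f) ∎
  where
  f = falling p u
  open ℕ-Solver

-- Determinants

Cells : ℕ → Set
Cells n = Fin n → ℕ × ℕ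

-- Columns of the determinants are functions of the exponent pair (u , v); rows evaluate them.
Col : Set
Col = ℕ → ℕ → ℚ

_≗₂_ : Col → Col → Set
f ≗₂ g = ∀ u v → f u v ≡ g u v

≡⇒≗₂ : ∀ {f g : Col} → f ≡ g → f ≗₂ g
≡⇒≗₂ refl u v = refl

_≟²_ : (c c′ : ℕ × ℕ) → Dec (c ≡ c′)
_≟²_ = Product.≡-dec ℕ._≟_ ℕ._≟_

-- The scaled coefficients of the monomial x^p y^q, where `c` is (p , q).
δ : ℕ × ℕ → Col
δ c u v = if does (c ≟² (u , v)) then ι (u ! ℕ.* v !) else 0ℚ

-- The scaled coefficients of (1+x)^p (1+y)^q.
ff : ℕ × ℕ → Col
ff (p , q) u v = ι (falling p u ℕ.* falling q v)

δ-refl : ∀ u v → δ (u , v) u v ≡ ι (u ! ℕ.* v !)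
δ-refl u v = if-yes ((u , v) ≟² (u , v)) refl

δ-≢ : ∀ c u v → c ≢ (u , v) → δ c u v ≡ 0ℚ
δ-≢ c u v = if-no (c ≟² (u , v))

signℕ : ℕ → ℚ
signℕ m = if does (m ℕ.% 2 ℕ.≟ 0) then 1ℚ else - 1ℚ

signℕ-suc : ∀ m → signℕ (suc m) ≡ - signℕ m
signℕ-suc zero          = refl
signℕ-suc (suc zero)    = refl
signℕ-suc (suc (suc m)) = signℕ-suc m

signℕ-≢0 : ∀ m → signℕ m ≢ 0ℚ
signℕ-≢0 zero          = λ ()
signℕ-≢0 (suc zero)    = λ ()
signℕ-≢0 (suc (suc m)) = signℕ-≢0 m

sign : ∀ {n} → Fin n → ℚ
sign j = signℕ (toℕ j)

-- The determinant whose entry in row a and column b is `g b` at the exponents of variable a. The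
-- expansion along the first row matches that of `det`.
D : ∀ {n} → (Fin n → Col) → Vec ℕ n → Vec ℕ n → ℚ
D g []       []       = 1ℚ
D g (u ∷ us) (v ∷ vs) = sum λ j → sign j * (g j u v * D (g ∘ punchIn j) us vs)

D-cong : ∀ {n} {g g′ : Fin n → Col} → (∀ j → g j ≗₂ g′ j) → ∀ us vs → D g us vs ≡ D g′ us vs
D-cong g≗g′ []       []       = refl
D-cong g≗g′ (u ∷ us) (v ∷ vs) = sum-cong-≗ λ j →
  cong₂ (λ y z → sign j * (y * z)) (g≗g′ j u v) (D-cong (λ i → g≗g′ (punchIn j i)) us vs)

-- Linearity in column `k`. In the term `j = k` the entry splits and the minor omits column `k`; in
-- every other term the minor splits by induction.
D-sum : ∀ {n m} (k : Fin n) (g : Fin n → Col) (q : Fin m → ℚ) (G : Fin m → Fin n → Col) →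
        (∀ i j → j ≢ k → G i j ≗₂ g j) → (∀ u v → g k u v ≡ sum λ i → q i * G i k u v) →
        ∀ us vs → D g us vs ≡ sum λ i → q i * D (G i) us vs
D-sum {suc n} {m} k g q G same eq (u ∷ us) (v ∷ vs) = begin
  sum (λ j → sign j * (g j u v * D (g ∘ punchIn j) us vs))
    ≡⟨ sum-cong-≗ (λ j → col j (j Fin.≟ k)) ⟩
  sum (λ j → sum λ i → q i * (sign j * (G i j u v * D (G i ∘ punchIn j) us vs)))
    ≡⟨ ∑-comm (λ j i → q i * (sign j * (G i j u v * D (G i ∘ punchIn j) us vs))) ⟩
  sum (λ i → sum λ j → q i * (sign j * (G i j u v * D (G i ∘ punchIn j) us vs)))
    ≡⟨ sum-cong-≗ (λ i → *-distribˡ-sum (q i) (λ j → sign j * (G i j u v * D (G i ∘ punchIn j) us vs))) ⟨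
  sum (λ i → q i * D (G i) (u ∷ us) (v ∷ vs)) ∎
  where
  open ℚ-Solver
  col : ∀ j → Dec (j ≡ k) → sign j * (g j u v * D (g ∘ punchIn j) us vs)
                          ≡ sum λ i → q i * (sign j * (G i j u v * D (G i ∘ punchIn j) us vs))
  col j (yes refl) = begin
    sign j * (g j u v * d) ≡⟨ cong (λ z → sign j * (z * d)) (eq u v) ⟩
    sign j * ((sum λ i → q i * G i j u v) * d) ≡⟨ solve 3 (λ s x d → s :* (x :* d) := x :* (s :* d)) refl (sign j) (sum λ i → q i * G i j u v) d ⟩
    (sum λ i → q i * G i j u v) * (sign j * d) ≡⟨ *-distribʳ-sum (sign j * d) (λ i → q i * G i j u v) ⟩
    (sum λ i → q i * G i j u v * (sign j * d)) ≡⟨ sum-cong-≗ (λ i → solve 4 (λ q x s d → q :* x :* (s :* d) := q :* (s :* (x :* d))) refl (q i) (G i j u v) (sign j) d) ⟩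
    (sum λ i → q i * (sign j * (G i j u v * d))) ≡⟨ sum-cong-≗ (λ i → cong (λ z → q i * (sign j * (G i j u v * z))) (D-cong (λ l → same i (punchIn j l) (Fin.punchInᵢ≢i j l)) us vs)) ⟨
    (sum λ i → q i * (sign j * (G i j u v * D (G i ∘ punchIn j) us vs))) ∎
    where d = D (g ∘ punchIn j) us vs
  col j (no j≢k) = begin
    sign j * (g j u v * D (g ∘ punchIn j) us vs) ≡⟨ cong (λ z → sign j * (g j u v * z)) (D-sum k′ (g ∘ punchIn j) q (λ i → G i ∘ punchIn j) same′ eq′ us vs) ⟩
    sign j * (g j u v * sum λ i → q i * d i) ≡⟨ ℚ.*-assoc (sign j) (g j u v) _ ⟨
    sign j * g j u v * (sum λ i → q i * d i) ≡⟨ *-distribˡ-sum (sign j * g j u v) (λ i → q i * d i) ⟩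
    (sum λ i → sign j * g j u v * (q i * d i)) ≡⟨ sum-cong-≗ (λ i → solve 4 (λ s x q d → s :* x :* (q :* d) := q :* (s :* (x :* d))) refl (sign j) (g j u v) (q i) (d i)) ⟩
    (sum λ i → q i * (sign j * (g j u v * d i))) ≡⟨ sum-cong-≗ (λ i → cong (λ z → q i * (sign j * (z * d i))) (same i j j≢k u v)) ⟨
    (sum λ i → q i * (sign j * (G i j u v * d i)))     ∎
    where
    k′ = punchOut j≢k
    d : Fin m → ℚ
    d i = D (G i ∘ punchIn j) us vs
    k≡ : punchIn j k′ ≡ k
    k≡ = Fin.punchIn-punchOut j≢k
    same′ : ∀ i l → l ≢ k′ → G i (punchIn j l) ≗₂ g (punchIn j l)
    same′ i l l≢ = same i (punchIn j l) λ e → l≢ (Fin.punchIn-injective j l k′ (trans e (sym k≡)))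
    eq′ : ∀ u v → g (punchIn j k′) u v ≡ sum λ i → q i * G i (punchIn j k′) u v
    eq′ u v = subst (λ l → g l u v ≡ sum λ i → q i * G i l u v) (sym k≡) (eq u v)

D-+ : ∀ {n} (k : Fin n) (g g₁ g₂ : Fin n → Col) →
      (∀ j → j ≢ k → g₁ j ≗₂ g j) → (∀ j → j ≢ k → g₂ j ≗₂ g j) →
      (∀ u v → g k u v ≡ g₁ k u v + g₂ k u v) → ∀ us vs → D g us vs ≡ D g₁ us vs + D g₂ us vs
D-+ {n} k g g₁ g₂ same₁ same₂ eq us vs = begin
  D g us vs ≡⟨ D-sum k g (λ _ → 1ℚ) G same eq′ us vs ⟩
  sum (λ i → 1ℚ * D (G i) us vs)                    ≡⟨ two (λ i → D (G i) us vs) ⟩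
  D g₁ us vs + D g₂ us vs                           ∎
  where
  G : Fin 2 → Fin n → Col
  G zero    = g₁
  G (suc _) = g₂
  same : ∀ i j → j ≢ k → G i j ≗₂ g j
  same zero    = same₁
  same (suc _) = same₂
  opaque
    unfolding sum
    two : ∀ (f : Fin 2 → ℚ) → sum (λ i → 1ℚ * f i) ≡ f zero + f (suc zero)
    two f = cong₂ _+_ (ℚ.*-identityˡ (f zero)) (trans (ℚ.+-identityʳ (1ℚ * f (suc zero))) (ℚ.*-identityˡ (f (suc zero))))
  eq′ : ∀ u v → g k u v ≡ sum λ i → 1ℚ * G i k u v
  eq′ u v = trans (eq u v) (sym (two λ i → G i k u v))

adjacent-punchIn : ∀ {n} (l : Fin (suc (suc n))) (k : Fin (suc n)) → l ≢ inject₁ k → l ≢ suc k →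
                   ∃ λ (k′ : Fin n) → punchIn l (inject₁ k′) ≡ inject₁ k × punchIn l (suc k′) ≡ suc k
adjacent-punchIn zero                  zero    l≢ _  = contradiction refl l≢
adjacent-punchIn zero                  (suc k) _  _  = k , refl , refl
adjacent-punchIn (suc zero)        zero    _  l≢ = contradiction refl l≢
adjacent-punchIn {suc n} (suc (suc l)) zero _ _  = zero , refl , refl
adjacent-punchIn {suc n} (suc l)       (suc k) l≢₁ l≢₂
  with adjacent-punchIn l k (l≢₁ ∘ cong suc) (l≢₂ ∘ cong suc)
... | k′ , eq₁ , eq₂ = suc k′ , cong suc eq₁ , cong suc eq₂

punchIn-adjacent : ∀ {n} (k : Fin n) (b : Fin n) →
  punchIn (inject₁ k) b ≡ punchIn (suc k) b ⊎
  (punchIn (inject₁ k) b ≡ suc k × punchIn (suc k) b ≡ inject₁ k)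
punchIn-adjacent zero    zero    = inj₂ (refl , refl)
punchIn-adjacent zero    (suc b) = inj₁ refl
punchIn-adjacent (suc k) zero    = inj₁ refl
punchIn-adjacent (suc k) (suc b) with punchIn-adjacent k b
... | inj₁ eq        = inj₁ (cong suc eq)
... | inj₂ (e₁ , e₂) = inj₂ (cong suc e₁ , cong suc e₂)

inject₁≢suc : ∀ {n} (k : Fin n) → inject₁ k ≢ suc k
inject₁≢suc k eq = ℕ.1+n≢n (trans (cong toℕ (sym eq)) (Fin.toℕ-inject₁ k))

-- The terms of the two equal columns have equal minors and opposite signs; every other minor still
-- contains both columns, again adjacent.
D-adjacent : ∀ {n} (k : Fin n) (g : Fin (suc n) → Col) → g (inject₁ k) ≗₂ g (suc k) →
             ∀ us vs → D g us vs ≡ 0ℚ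
D-adjacent {n} k g eq (u ∷ us) (v ∷ vs) = begin
  sum term ≡⟨ sum-two (inject₁ k) (suc k) (inject₁≢suc k) term others ⟩
  term (inject₁ k) + term (suc k) ≡⟨ cong₂ (λ s y → s * (y * d) + term (suc k)) (cong signℕ (Fin.toℕ-inject₁ k)) (eq u v) ⟩
  signℕ (toℕ k) * (g (suc k) u v * d) + term (suc k) ≡⟨ cong₂ (λ s z → signℕ (toℕ k) * (g (suc k) u v * d) + s * (g (suc k) u v * z)) (signℕ-suc (toℕ k)) (sym same) ⟩
  signℕ (toℕ k) * (g (suc k) u v * d) + - signℕ (toℕ k) * (g (suc k) u v * d)
                                            ≡⟨ solve 2 (λ s x → s :* x :+ :- s :* x := con 0ℚ) refl (signℕ (toℕ k)) (g (suc k) u v * d) ⟩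
  0ℚ                                        ∎
  where
  open ℚ-Solver
  term : Fin (suc n) → ℚ
  term j = sign j * (g j u v * D (g ∘ punchIn j) us vs)
  d = D (g ∘ punchIn (inject₁ k)) us vs
  same : d ≡ D (g ∘ punchIn (suc k)) us vs
  same = D-cong col us vs
    where
    col : ∀ b → g (punchIn (inject₁ k) b) ≗₂ g (punchIn (suc k) b)
    col b u v with punchIn-adjacent k b
    ... | inj₁ e         = cong (λ l → g l u v) e
    ... | inj₂ (e₁ , e₂) = trans (cong (λ l → g l u v) e₁) (trans (sym (eq u v)) (cong (λ l → g l u v) (sym e₂)))
  minor≡0 : ∀ {n} (k : Fin n) (g : Fin (suc n) → Col) → g (inject₁ k) ≗₂ g (suc k) →
            ∀ l → l ≢ inject₁ k → l ≢ suc k → ∀ us vs → D (g ∘ punchIn l) us vs ≡ 0ℚ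
  minor≡0 {suc n} k g eq l l≢₁ l≢₂ us vs with adjacent-punchIn l k l≢₁ l≢₂
  ... | k′ , e₁ , e₂ = D-adjacent k′ (g ∘ punchIn l) (λ u v → trans (cong (λ l → g l u v) e₁) (trans (eq u v) (cong (λ l → g l u v) (sym e₂)))) us vs
  others : ∀ l → l ≢ inject₁ k → l ≢ suc k → term l ≡ 0ℚ
  others l l≢₁ l≢₂ = begin
    sign l * (g l u v * D (g ∘ punchIn l) us vs) ≡⟨ cong (λ z → sign l * (g l u v * z)) (minor≡0 k g eq l l≢₁ l≢₂ us vs) ⟩
    sign l * (g l u v * 0ℚ) ≡⟨ cong (sign l *_) (ℚ.*-zeroʳ (g l u v)) ⟩
    sign l * 0ℚ                                  ≡⟨ ℚ.*-zeroʳ (sign l) ⟩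
    0ℚ                                           ∎

-- Polarisation: with the sum of the two columns in both places the determinant vanishes; it expands
-- into four terms, and the two with a repeated column vanish as well.
D-swap : ∀ {n} (k : Fin n) (g g′ : Fin (suc n) → Col) →
         g′ (inject₁ k) ≗₂ g (suc k) → g′ (suc k) ≗₂ g (inject₁ k) →
         (∀ j → j ≢ inject₁ k → j ≢ suc k → g′ j ≗₂ g j) →
         ∀ us vs → D g′ us vs ≡ - D g us vs
D-swap {n} k g g′ e₁ e₂ rest us vs = begin
  D g′ us vs             ≡⟨ D-cong (λ j → swapped j (j Fin.≟ i₀) (j Fin.≟ i₁)) us vs ⟩
  D (F B A) us vs ≡⟨ solve 2 (λ x y → y := :- x :+ (x :+ y)) refl (D (F A B) us vs) (D (F B A) us vs) ⟩
  - D (F A B) us vs + (D (F A B) us vs + D (F B A) us vs)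
                         ≡⟨ cong (- D (F A B) us vs +_) cancel ⟩
  - D (F A B) us vs + 0ℚ ≡⟨ ℚ.+-identityʳ _ ⟩
  - D (F A B) us vs ≡⟨ cong -_ (D-cong (λ j → original j (j Fin.≟ i₀) (j Fin.≟ i₁)) us vs) ⟩
  - D g us vs            ∎
  where
  open ℚ-Solver
  i₀ = inject₁ k
  i₁ = suc k
  A = g i₀
  B = g i₁
  C : Col
  C u v = A u v + B u v
  F : Col → Col → Fin (suc n) → Col
  F a b = replace (replace g i₁ b) i₀ a
  i₁≢i₀ : i₁ ≢ i₀
  i₁≢i₀ = inject₁≢suc k ∘ sym
  F₀ : ∀ a b → F a b i₀ ≡ a
  F₀ a b = replace-p (replace g i₁ b) i₀ a
  F₁ : ∀ a b → F a b i₁ ≡ b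
  F₁ a b = trans (replace-≢ (replace g i₁ b) i₀ a i₁≢i₀) (replace-p g i₁ b)
  F₂ : ∀ a b {j} → j ≢ i₀ → j ≢ i₁ → F a b j ≡ g j
  F₂ a b j≢₀ j≢₁ = trans (replace-≢ (replace g i₁ b) i₀ a j≢₀) (replace-≢ g i₁ b j≢₁)
  swapped : ∀ j → Dec (j ≡ i₀) → Dec (j ≡ i₁) → g′ j ≗₂ F B A j
  swapped j (yes refl) _          u v = trans (e₁ u v) (≡⇒≗₂ (sym (F₀ B A)) u v)
  swapped j (no _)     (yes refl) u v = trans (e₂ u v) (≡⇒≗₂ (sym (F₁ B A)) u v)
  swapped j (no j≢₀)   (no j≢₁)   u v = trans (rest j j≢₀ j≢₁ u v) (≡⇒≗₂ (sym (F₂ B A j≢₀ j≢₁)) u v)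
  original : ∀ j → Dec (j ≡ i₀) → Dec (j ≡ i₁) → F A B j ≗₂ g j
  original j (yes refl) _          = ≡⇒≗₂ (F₀ A B)
  original j (no _)     (yes refl) = ≡⇒≗₂ (F₁ A B)
  original j (no j≢₀)   (no j≢₁)   = ≡⇒≗₂ (F₂ A B j≢₀ j≢₁)
  diag : ∀ a → D (F a a) us vs ≡ 0ℚ
  diag a = D-adjacent k (F a a) (≡⇒≗₂ (trans (F₀ a a) (sym (F₁ a a)))) us vs
  agree₀ : ∀ a a′ b j → j ≢ i₀ → F a b j ≗₂ F a′ b j
  agree₀ a a′ b j j≢₀ = ≡⇒≗₂ (trans (replace-≢ (replace g i₁ b) i₀ a j≢₀) (sym (replace-≢ (replace g i₁ b) i₀ a′ j≢₀)))
  agree₁ : ∀ a b b′ j → j ≢ i₁ → F a b j ≗₂ F a b′ j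
  agree₁ a b b′ j j≢₁ with j Fin.≟ i₀
  ... | yes refl = λ u v → refl
  ... | no  j≢₀  = ≡⇒≗₂ (trans (replace-≢ g i₁ b j≢₁) (sym (replace-≢ g i₁ b′ j≢₁)))
  cols : ∀ {x y z : Col} → x ≡ C → y ≡ A → z ≡ B → ∀ u v → x u v ≡ y u v + z u v
  cols refl refl refl u v = refl
  split₀ : ∀ b → D (F C b) us vs ≡ D (F A b) us vs + D (F B b) us vs
  split₀ b = D-+ i₀ (F C b) (F A b) (F B b) (agree₀ A C b) (agree₀ B C b) (cols (F₀ C b) (F₀ A b) (F₀ B b)) us vs
  split₁ : ∀ a → D (F a C) us vs ≡ D (F a A) us vs + D (F a B) us vs
  split₁ a = D-+ i₁ (F a C) (F a A) (F a B) (agree₁ a A C) (agree₁ a B C) (cols (F₁ a C) (F₁ a A) (F₁ a B)) us vs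
  cancel : D (F A B) us vs + D (F B A) us vs ≡ 0ℚ
  cancel = begin
    D (F A B) us vs + D (F B A) us vs
      ≡⟨ cong₂ _+_ (ℚ.+-identityˡ (D (F A B) us vs)) (ℚ.+-identityʳ (D (F B A) us vs)) ⟨
    (0ℚ + D (F A B) us vs) + (D (F B A) us vs + 0ℚ)
      ≡⟨ cong₂ (λ x y → (x + D (F A B) us vs) + (D (F B A) us vs + y)) (diag A) (diag B) ⟨
    (D (F A A) us vs + D (F A B) us vs) + (D (F B A) us vs + D (F B B) us vs)
      ≡⟨ cong₂ _+_ (split₁ A) (split₁ B) ⟨
    D (F A C) us vs + D (F B C) us vs
      ≡⟨ split₀ C ⟨
    D (F C C) us vs
      ≡⟨ diag C ⟩
    0ℚ ∎

-- Adjacent swaps move column `j` to the left until it stands next to column `i`; `d` bounds the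
-- position of `j`, so that the recursion is structural.
D-equal-< : ∀ d {n} (i j : Fin n) → toℕ j ≤ d → toℕ i < toℕ j → (g : Fin n → Col) → g i ≗₂ g j →
            ∀ us vs → D g us vs ≡ 0ℚ
D-equal-< (suc d) {suc n} i (suc k) (s≤s k≤d) (s≤s i≤k) g eq us vs with i Fin.≟ inject₁ k
... | yes refl = D-adjacent k g eq us vs
... | no i≢k   = begin
  D g us vs ≡⟨ D-swap k g′ g (λ u v → sym (col₁ u v)) (λ u v → sym (col₀ u v)) others us vs ⟩
  - D g′ us vs ≡⟨ cong -_ (D-equal-< d i i₀ (ℕ.≤-trans (ℕ.≤-reflexive (Fin.toℕ-inject₁ k)) k≤d) i<i₀ g′ eq′ us vs) ⟩
  0ℚ                ∎
  where
  i₀ = inject₁ k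
  i₁ = suc k
  g′ = replace (replace g i₁ (g i₀)) i₀ (g i₁)
  col₀ : g′ i₀ ≗₂ g i₁
  col₀ = ≡⇒≗₂ (replace-p (replace g i₁ (g i₀)) i₀ (g i₁))
  col₁ : g′ i₁ ≗₂ g i₀
  col₁ = ≡⇒≗₂ (trans (replace-≢ (replace g i₁ (g i₀)) i₀ (g i₁) (inject₁≢suc k ∘ sym)) (replace-p g i₁ (g i₀)))
  others : ∀ j → j ≢ i₀ → j ≢ i₁ → g j ≗₂ g′ j
  others j j≢₀ j≢₁ = ≡⇒≗₂ (sym (trans (replace-≢ (replace g i₁ (g i₀)) i₀ (g i₁) j≢₀) (replace-≢ g i₁ (g i₀) j≢₁)))
  i<i₀ : toℕ i < toℕ i₀
  i<i₀ = ℕ.≤∧≢⇒< (ℕ.≤-trans i≤k (ℕ.≤-reflexive (sym (Fin.toℕ-inject₁ k)))) (i≢k ∘ Fin.toℕ-injective)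
  i≢i₁ : i ≢ i₁
  i≢i₁ refl = ℕ.1+n≰n i≤k
  eq′ : g′ i ≗₂ g′ i₀
  eq′ u v = trans (sym (others i i≢k i≢i₁ u v)) (trans (eq u v) (sym (col₀ u v)))

D-equal : ∀ {n} (i j : Fin n) → i ≢ j → (g : Fin n → Col) → g i ≗₂ g j → ∀ us vs → D g us vs ≡ 0ℚ
D-equal i j i≢j g eq us vs with ℕ.<-cmp (toℕ i) (toℕ j)
... | tri< i<j _ _ = D-equal-< _ i j ℕ.≤-refl i<j g eq us vs
... | tri≈ _ i≡j _ = contradiction (Fin.toℕ-injective i≡j) i≢j
... | tri> _ _ j<i = D-equal-< _ j i ℕ.≤-refl j<i g (λ u v → sym (eq u v)) us vs

ι-!*!≢0 : ∀ u v → ι (u ! ℕ.* v !) ≢ 0ℚ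
ι-!*!≢0 u v = ι-≢0 (u ! ℕ.* v !) {{ℕ.m*n≢0 (u !) (v !) {{u !≢0}} {{v !≢0}}}}
  where open import Data.Nat.Properties using (_!≢0)

-- `order` makes the numbering a linear extension of the componentwise order. The triangularity of
-- the column operations for translation invariance, and later that of the lifted family, rest on
-- it.
record IsDiagram {n} (c : Cells n) : Set where
  field
    down  : ∀ b u v → u ≤ proj₁ (c b) → v ≤ proj₂ (c b) → ∃ λ b′ → c b′ ≡ (u , v)
    order : ∀ b b′ → proj₁ (c b′) ≤ proj₁ (c b) → proj₂ (c b′) ≤ proj₂ (c b) → toℕ b′ ≤ toℕ b

  c-injective : ∀ {b b′} → c b ≡ c b′ → b ≡ b′
  c-injective {b} {b′} eq = Fin.toℕ-injective (ℕ.≤-antisym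
    (order b′ b (ℕ.≤-reflexive (cong proj₁ eq)) (ℕ.≤-reflexive (cong proj₂ eq)))
    (order b b′ (ℕ.≤-reflexive (cong proj₁ (sym eq))) (ℕ.≤-reflexive (cong proj₂ (sym eq)))))

-- Translation invariance of Δ: the two determinants are the coefficients of Δ(x , y) and of Δ(x+1 , y+1),
-- and the second arises from the first by unitriangular column operations.
D-δ≡D-ff : ∀ {n} (c : Cells n) → IsDiagram c → ∀ us vs → D (δ ∘ c) us vs ≡ D (ff ∘ c) us vs
D-δ≡D-ff {n} c diagram us vs = begin
  D (δ ∘ c) us vs ≡⟨ D-cong (λ b u v → sym (≡⇒≗₂ (if-yes {A = Col} (toℕ b ℕ.<? n) (Fin.toℕ<n b)) u v)) us vs ⟩
  D (Z n) us vs     ≡⟨ chain n ℕ.≤-refl ⟩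
  D (ff ∘ c) us vs  ∎
  where
  open IsDiagram diagram
  p q : Fin n → ℕ
  p b = proj₁ (c b)
  q b = proj₂ (c b)
  norm : Fin n → ℚ
  norm b = proj₁ (recip (ι (p b ! ℕ.* q b !)) (ι-!*!≢0 (p b) (q b)))
  -- `U b′ b` is the coefficient of the monomial of cell `b′` in (1+x)^p (1+y)^q for the cell (p ,
  -- q) numbered `b`, a product of two binomial coefficients; `norm` undoes the factorial scaling.
  U : Fin n → Fin n → ℚ
  U b′ b = ff (c b) (p b′) (q b′) * norm b′
  ff≢0⇒≤ : ∀ c u v → ff c u v ≢ 0ℚ → u ≤ proj₁ c × v ≤ proj₂ c
  ff≢0⇒≤ (p , q) u v ff≢0 with u ℕ.≤? p | v ℕ.≤? q
  ... | yes u≤p | yes v≤q = u≤p , v≤q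
  ... | no  u≰p | _       = contradiction (trans (cong (λ z → ι (z ℕ.* falling q v)) (falling-> (ℕ.≰⇒> u≰p))) ι-0) ff≢0
  ... | yes _   | no v≰q  = contradiction (trans (cong ι (trans (cong (falling p u ℕ.*_) (falling-> (ℕ.≰⇒> v≰q))) (ℕ.*-zeroʳ (falling p u)))) ι-0) ff≢0
  U-diag : ∀ b → U b b ≡ 1ℚ
  U-diag b = begin
    ι (falling (p b) (p b) ℕ.* falling (q b) (q b)) * norm b ≡⟨ cong₂ (λ y z → ι (y ℕ.* z) * norm b) (falling-! (p b)) (falling-! (q b)) ⟩
    ι (p b ! ℕ.* q b !) * norm b                              ≡⟨ ℚ.*-comm _ (norm b) ⟩
    norm b * ι (p b ! ℕ.* q b !) ≡⟨ proj₂ (recip (ι (p b ! ℕ.* q b !)) (ι-!*!≢0 (p b) (q b))) ⟩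
    1ℚ                                                        ∎
  U-> : ∀ b b′ → toℕ b < toℕ b′ → U b′ b ≡ 0ℚ
  U-> b b′ b<b′ = *-≡0ˡ (norm b′) (¬⇒≡0 λ ff≢0 → let (≤₁ , ≤₂) = ff≢0⇒≤ (c b) (p b′) (q b′) ff≢0 in ℕ.<⇒≱ b<b′ (order b b′ ≤₁ ≤₂))
  ff≡Uδ : ∀ b u v → ff (c b) u v ≡ sum λ b′ → U b′ b * δ (c b′) u v
  ff≡Uδ b u v with Fin.any? (λ b′ → c b′ ≟² (u , v))
  ... | yes (b₀ , refl) = begin
    ff (c b) u v                             ≡⟨ ℚ.*-identityʳ _ ⟨
    ff (c b) u v * 1ℚ ≡⟨ cong (ff (c b) u v *_) (proj₂ (recip (ι (u ! ℕ.* v !)) (ι-!*!≢0 u v))) ⟨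
    ff (c b) u v * (norm b₀ * ι (u ! ℕ.* v !)) ≡⟨ ℚ.*-assoc (ff (c b) u v) (norm b₀) _ ⟨
    U b₀ b * ι (u ! ℕ.* v !)                 ≡⟨ cong (U b₀ b *_) (δ-refl u v) ⟨
    U b₀ b * δ (c b₀) u v ≡⟨ sum-single b₀ (λ b′ → U b′ b * δ (c b′) u v) (λ b′ b′≢ → *-≡0ʳ (U b′ b) (δ-≢ (c b′) u v (b′≢ ∘ c-injective))) ⟨
    (sum λ b′ → U b′ b * δ (c b′) u v)       ∎
  ... | no ∄b₀ = begin
    ff (c b) u v ≡⟨ ¬⇒≡0 (λ ff≢0 → let (≤₁ , ≤₂) = ff≢0⇒≤ (c b) u v ff≢0 in ∄b₀ (down b u v ≤₁ ≤₂)) ⟩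
    0ℚ ≡⟨ sum-zero _ (λ b′ → *-≡0ʳ (U b′ b) (δ-≢ (c b′) u v (λ e → ∄b₀ (b′ , e)))) ⟨
    (sum λ b′ → U b′ b * δ (c b′) u v)       ∎
  -- A hybrid: the columns before `t` are monomials already, the others are still products of powers
  -- of 1+x and 1+y.
  Z : ℕ → Fin n → Col
  Z t b = if does (toℕ b ℕ.<? t) then δ (c b) else ff (c b)
  Z-< : ∀ {t b} → toℕ b < t → Z t b ≡ δ (c b)
  Z-< {t} {b} = if-yes (toℕ b ℕ.<? t)
  Z-≥ : ∀ {t b} → ¬ toℕ b < t → Z t b ≡ ff (c b)
  Z-≥ {t} {b} = if-no (toℕ b ℕ.<? t)
  -- Column `k` is expanded by `ff≡Uδ`. Terms with `b′` before `k` repeat a monomial column, those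
  -- after `k` have coefficient 0, and the term `b′ = k` has coefficient 1.
  step : ∀ k → D (Z (suc (toℕ k))) us vs ≡ D (Z (toℕ k)) us vs
  step k = sym (begin
    D (Z t) us vs ≡⟨ D-sum k (Z t) (λ b′ → U b′ k) G (λ b′ j j≢k → ≡⇒≗₂ (replace-≢ (Z t) k (δ (c b′)) j≢k)) expand us vs ⟩
    (sum λ b′ → U b′ k * D (G b′) us vs) ≡⟨ sum-single k (λ b′ → U b′ k * D (G b′) us vs) (λ b′ b′≢k → off b′ b′≢k (ℕ.<-cmp (toℕ b′) t)) ⟩
    U k k * D (G k) us vs                      ≡⟨ cong (_* D (G k) us vs) (U-diag k) ⟩
    1ℚ * D (G k) us vs                         ≡⟨ ℚ.*-identityˡ _ ⟩
    D (G k) us vs ≡⟨ D-cong (λ j → next j (j Fin.≟ k)) us vs ⟩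
    D (Z (suc t)) us vs                        ∎)
    where
    t = toℕ k
    G : Fin n → Fin n → Col
    G b′ = replace (Z t) k (δ (c b′))
    expand : ∀ u v → Z t k u v ≡ sum λ b′ → U b′ k * G b′ k u v
    expand u v = begin
      Z t k u v                          ≡⟨ ≡⇒≗₂ (Z-≥ {t} {k} (ℕ.<-irrefl refl)) u v ⟩
      ff (c k) u v                       ≡⟨ ff≡Uδ k u v ⟩
      (sum λ b′ → U b′ k * δ (c b′) u v) ≡⟨ sum-cong-≗ (λ b′ → cong (U b′ k *_) (≡⇒≗₂ (replace-p (Z t) k (δ (c b′))) u v)) ⟨
      (sum λ b′ → U b′ k * G b′ k u v)   ∎
    off : ∀ b′ → b′ ≢ k → Tri (toℕ b′ < t) (toℕ b′ ≡ t) (t < toℕ b′) → U b′ k * D (G b′) us vs ≡ 0ℚ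
    off b′ b′≢k (tri< b′<t _ _) = *-≡0ʳ (U b′ k) (D-equal b′ k b′≢k (G b′) same us vs)
      where
      same : G b′ b′ ≗₂ G b′ k
      same = ≡⇒≗₂ (trans (replace-≢ (Z t) k (δ (c b′)) b′≢k) (trans (Z-< b′<t) (sym (replace-p (Z t) k (δ (c b′))))))
    off b′ b′≢k (tri≈ _ b′≡t _) = contradiction (Fin.toℕ-injective b′≡t) b′≢k
    off b′ b′≢k (tri> _ _ t<b′) = *-≡0ˡ (D (G b′) us vs) (U-> k b′ t<b′)
    next : ∀ j → Dec (j ≡ k) → G k j ≗₂ Z (suc t) j
    next j (yes refl) = ≡⇒≗₂ (trans (replace-p (Z t) k (δ (c k))) (sym (Z-< {suc t} {k} ℕ.≤-refl)))
    next j (no j≢k)   = ≡⇒≗₂ (trans (replace-≢ (Z t) k (δ (c k)) j≢k) (by-cases (toℕ j ℕ.<? t)))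
      where
      by-cases : Dec (toℕ j < t) → Z t j ≡ Z (suc t) j
      by-cases (yes j<t) = trans (Z-< j<t) (sym (Z-< (ℕ.m<n⇒m<1+n j<t)))
      by-cases (no j≮t)  = trans (Z-≥ j≮t) (sym (Z-≥ λ j<1+t → j≮t (ℕ.≤∧≢⇒< (ℕ.≤-pred j<1+t) (j≢k ∘ Fin.toℕ-injective))))
  chain : ∀ t → t ≤ n → D (Z t) us vs ≡ D (ff ∘ c) us vs
  chain zero    _   = D-cong (λ b → ≡⇒≗₂ (Z-≥ {0} {b} (λ ()))) us vs
  chain (suc t) t<n = trans (subst (λ t → D (Z (suc t)) us vs ≡ D (Z t) us vs) (Fin.toℕ-fromℕ< t<n) (step (Fin.fromℕ< t<n))) (chain t (ℕ.<⇒≤ t<n))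

-- Exponents of monomials, homogeneity and eigenfunctions

module ℕ+ = Algebra.Properties.CommutativeSemigroup ℕ.+-commutativeSemigroup
module ℕ* = Algebra.Properties.CommutativeSemigroup ℕ.*-commutativeSemigroup
module ℕ∑ = Algebra.Properties.CommutativeMonoid.Sum ℕ.+-0-commutativeMonoid

φ : ∀ {n} → Cells n → Mono n → ℚ
φ c (us , vs) = D (δ ∘ c) us vs

infixl 6 _⊕_
_⊕_ : ∀ {n} → Mono n → Mono n → Mono n
(us , vs) ⊕ (us′ , vs′) = Vec.zipWith ℕ._+_ us us′ , Vec.zipWith ℕ._+_ vs vs′

inc : ∀ {n} → Fin n → Vec ℕ n → Vec ℕ n
inc a us = Vec.updateAt us a suc

incx incy : ∀ {n} → Fin n → Mono n → Mono n
incx a (us , vs) = inc a us , vs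
incy a (us , vs) = us , inc a vs

𝟘 : ∀ {n} → Mono n
𝟘 {n} = Vec.replicate n 0 , Vec.replicate n 0

degx degy deg : ∀ {n} → Mono n → ℕ
degx m = degV (proj₁ m)
degy m = degV (proj₂ m)
deg m = degx m ℕ.+ degy m

-- The scaled coefficients of the derivative of Δ of exponent `m`.
shift : ∀ {n} → Cells n → Mono n → Mono n → ℚ
shift c m m′ = φ c (m ⊕ m′)

vec-ind : ∀ {n} (P : Vec ℕ n → Set) → P (Vec.replicate n 0) → (∀ a us → P us → P (inc a us)) → ∀ us → P us
vec-ind P z step []       = z
vec-ind P z step (u ∷ us) = iterate u
  where
  iterate : ∀ u → P (u ∷ us)
  iterate zero    = vec-ind (λ us → P (0 ∷ us)) z (λ a us → step (suc a) (0 ∷ us)) us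
  iterate (suc u) = step zero (u ∷ us) (iterate u)

mono-ind : ∀ {n} (P : Mono n → Set) → P 𝟘 → (∀ a m → P m → P (incx a m)) → (∀ a m → P m → P (incy a m)) →
           ∀ m → P m
mono-ind P z stepx stepy (us , vs) =
  vec-ind (λ us → P (us , vs))
    (vec-ind (λ vs → P (Vec.replicate _ 0 , vs)) z (λ a vs → stepy a (Vec.replicate _ 0 , vs)) vs)
    (λ a us → stepx a (us , vs)) us

degV-inc : ∀ {n} (a : Fin n) us → degV (inc a us) ≡ suc (degV us)
degV-inc zero    (u ∷ us) = refl
degV-inc (suc a) (u ∷ us) = trans (cong (u ℕ.+_) (degV-inc a us)) (ℕ.+-suc u (degV us))

deg-incx : ∀ {n} (a : Fin n) m → deg (incx a m) ≡ suc (deg m)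
deg-incx a (us , vs) = cong (ℕ._+ degV vs) (degV-inc a us)

deg-incy : ∀ {n} (a : Fin n) m → deg (incy a m) ≡ suc (deg m)
deg-incy a (us , vs) = trans (cong (degV us ℕ.+_) (degV-inc a vs)) (ℕ.+-suc (degV us) (degV vs))

degV-zipWith : ∀ {n} (us vs : Vec ℕ n) → degV (Vec.zipWith ℕ._+_ us vs) ≡ degV us ℕ.+ degV vs
degV-zipWith []       []       = refl
degV-zipWith (u ∷ us) (v ∷ vs) = trans (cong (u ℕ.+ v ℕ.+_) (degV-zipWith us vs)) (ℕ+.interchange u v (degV us) (degV vs))

degx-⊕ : ∀ {n} (m m′ : Mono n) → degx (m ⊕ m′) ≡ degx m ℕ.+ degx m′
degx-⊕ (us , _) (us′ , _) = degV-zipWith us us′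

degy-⊕ : ∀ {n} (m m′ : Mono n) → degy (m ⊕ m′) ≡ degy m ℕ.+ degy m′
degy-⊕ (_ , vs) (_ , vs′) = degV-zipWith vs vs′

deg-⊕ : ∀ {n} (m m′ : Mono n) → deg (m ⊕ m′) ≡ deg m ℕ.+ deg m′
deg-⊕ m m′ = trans (cong₂ ℕ._+_ (degx-⊕ m m′) (degy-⊕ m m′)) (ℕ+.interchange (degx m) (degx m′) (degy m) (degy m′))

zipWith-inc : ∀ {n} (a : Fin n) us vs → Vec.zipWith ℕ._+_ (inc a us) vs ≡ Vec.zipWith ℕ._+_ us (inc a vs)
zipWith-inc zero    (u ∷ us) (v ∷ vs) = cong (_∷ Vec.zipWith ℕ._+_ us vs) (sym (ℕ.+-suc u v))
zipWith-inc (suc a) (u ∷ us) (v ∷ vs) = cong (u ℕ.+ v ∷_) (zipWith-inc a us vs)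

incx-⊕ : ∀ {n} (a : Fin n) m m′ → incx a m ⊕ m′ ≡ m ⊕ incx a m′
incx-⊕ a (us , vs) (us′ , vs′) = cong (_, _) (zipWith-inc a us us′)

incy-⊕ : ∀ {n} (a : Fin n) m m′ → incy a m ⊕ m′ ≡ m ⊕ incy a m′
incy-⊕ a (us , vs) (us′ , vs′) = cong (_ ,_) (zipWith-inc a vs vs′)

𝟘-⊕ : ∀ {n} (m : Mono n) → 𝟘 ⊕ m ≡ m
𝟘-⊕ (us , vs) = cong₂ _,_ (Vec.zipWith-identityˡ ℕ.+-identityˡ us) (Vec.zipWith-identityˡ ℕ.+-identityˡ vs)

totx toty : ∀ {n} → Cells n → ℕ
totx c = ℕ∑.sum (proj₁ ∘ c)
toty c = ℕ∑.sum (proj₂ ∘ c)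

*≢0ˡ : ∀ p q → p * q ≢ 0ℚ → p ≢ 0ℚ
*≢0ˡ p q pq≢0 = pq≢0 ∘ *-≡0ˡ q

*≢0ʳ : ∀ p q → p * q ≢ 0ℚ → q ≢ 0ℚ
*≢0ʳ p q pq≢0 = pq≢0 ∘ *-≡0ʳ p

sum-≢0 : ∀ {n} (f : Fin n → ℚ) → sum f ≢ 0ℚ → ∃ λ i → f i ≢ 0ℚ
sum-≢0 f ≢0 with any-≢0 f
... | inj₁ ∃i  = ∃i
... | inj₂ f≡0 = contradiction (sum-zero f f≡0) ≢0

δ-≢0 : ∀ c u v → δ c u v ≢ 0ℚ → c ≡ (u , v)
δ-≢0 c u v δ≢0 = decidable-stable (c ≟² (u , v)) λ c≢ → δ≢0 (δ-≢ c u v c≢)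

-- A nonzero term of the full expansion assigns every cell to exactly one row, and the exponents of
-- a row are the coordinates of its cell.
φ-bihomogeneous : ∀ {n} (c : Cells n) m → φ c m ≢ 0ℚ → degx m ≡ totx c × degy m ≡ toty c
φ-bihomogeneous c ([] , [])         _  = refl , refl
φ-bihomogeneous c (u ∷ us , v ∷ vs) ≢0 with sum-≢0 _ ≢0
... | j , ≢0′ with δ-≢0 (c j) u v (*≢0ˡ _ _ (*≢0ʳ (sign j) _ ≢0′))
                 | φ-bihomogeneous (c ∘ punchIn j) (us , vs) (*≢0ʳ (δ (c j) u v) _ (*≢0ʳ (sign j) _ ≢0′))
... | cⱼ≡ | degx≡ , degy≡ =
  trans (cong₂ ℕ._+_ (cong proj₁ (sym cⱼ≡)) degx≡) (sym (ℕ∑.sum-remove {i = j} (proj₁ ∘ c))) ,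
  trans (cong₂ ℕ._+_ (cong proj₂ (sym cⱼ≡)) degy≡) (sym (ℕ∑.sum-remove {i = j} (proj₂ ∘ c)))

φ-homogeneous : ∀ {n} (c : Cells n) m → deg m ≢ totx c ℕ.+ toty c → φ c m ≡ 0ℚ
φ-homogeneous c m deg≢ = ¬⇒≡0 λ ≢0 → let (x , y) = φ-bihomogeneous c m ≢0 in deg≢ (cong₂ ℕ._+_ x y)

-- `FF ρ` gives the scaled coefficients of the product over a of (1+x_a)^p (1+y_a)^q, where `ρ`
-- lists the exponents p and q. `ev ρ m` is the eigenvalue of this product under the operators
-- (1+x_a)∂ and (1+y_a)∂ with multiplicities `m`.
FF ev : ∀ {n} → Mono n → Mono n → ℚ
FF ([] , [])         ([] , [])         = 1ℚ
FF (p ∷ ps , q ∷ qs) (u ∷ us , v ∷ vs) = ff (p , q) u v * FF (ps , qs) (us , vs)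
ev ([] , [])         ([] , [])         = 1ℚ
ev (p ∷ ps , q ∷ qs) (u ∷ us , v ∷ vs) = ι (p ℕ.^ u ℕ.* q ℕ.^ v) * ev (ps , qs) (us , vs)

-- The eigenvalue equation of (1+x_a)∂: `incx` is the derivation, and x_a∂ multiplies a scaled
-- coefficient by the exponent of x_a.
FF-incx : ∀ {n} (a : Fin n) ρ m → ι (lookup (proj₁ ρ) a) * FF ρ m ≡ FF ρ (incx a m) + ι (lookup (proj₁ m) a) * FF ρ m
FF-incx zero (p ∷ ps , q ∷ qs) (u ∷ us , v ∷ vs) = begin
  ι p * (ι (fp ℕ.* fq) * F)                         ≡⟨ ℚ.*-assoc (ι p) _ F ⟨
  ι p * ι (fp ℕ.* fq) * F                           ≡⟨ cong (_* F) (ι-* p (fp ℕ.* fq)) ⟨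
  ι (p ℕ.* (fp ℕ.* fq)) * F                         ≡⟨ cong (λ z → ι z * F) rec ⟩
  ι (falling p (suc u) ℕ.* fq ℕ.+ u ℕ.* (fp ℕ.* fq)) * F ≡⟨ cong (_* F) (trans (ι-+ _ (u ℕ.* (fp ℕ.* fq))) (cong (ι (falling p (suc u) ℕ.* fq) +_) (ι-* u (fp ℕ.* fq)))) ⟩
  (ι (falling p (suc u) ℕ.* fq) + ι u * ι (fp ℕ.* fq)) * F ≡⟨ solve 4 (λ a b c F → (a :+ b :* c) :* F := a :* F :+ b :* (c :* F)) refl (ι (falling p (suc u) ℕ.* fq)) (ι u) (ι (fp ℕ.* fq)) F ⟩
  ι (falling p (suc u) ℕ.* fq) * F + ι u * (ι (fp ℕ.* fq) * F) ∎
  where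
  open ℚ-Solver
  fp = falling p u
  fq = falling q v
  F = FF (ps , qs) (us , vs)
  rec : p ℕ.* (fp ℕ.* fq) ≡ falling p (suc u) ℕ.* fq ℕ.+ u ℕ.* (fp ℕ.* fq)
  rec = trans (sym (ℕ.*-assoc p fp fq)) (trans (cong (ℕ._* fq) (falling-rec p u))
          (trans (ℕ.*-distribʳ-+ fq (falling p (suc u)) (u ℕ.* fp)) (cong (falling p (suc u) ℕ.* fq ℕ.+_) (ℕ.*-assoc u fp fq))))
FF-incx (suc a) (p ∷ ps , q ∷ qs) (u ∷ us , v ∷ vs) = begin
  x * (e * F) ≡⟨ solve 3 (λ x e F → x :* (e :* F) := e :* (x :* F)) refl x e F ⟩
  e * (x * F)                  ≡⟨ cong (e *_) (FF-incx a (ps , qs) (us , vs)) ⟩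
  e * (F′ + y * F) ≡⟨ solve 4 (λ e F′ y F → e :* (F′ :+ y :* F) := e :* F′ :+ y :* (e :* F)) refl e F′ y F ⟩
  e * F′ + y * (e * F)         ∎
  where
  open ℚ-Solver
  x = ι (lookup ps a)
  y = ι (lookup us a)
  e = ff (p , q) u v
  F = FF (ps , qs) (us , vs)
  F′ = FF (ps , qs) (inc a us , vs)

swapxy : ∀ {n} → Mono n → Mono n
swapxy (us , vs) = vs , us

FF-swap : ∀ {n} (ρ m : Mono n) → FF (swapxy ρ) (swapxy m) ≡ FF ρ m
FF-swap ([] , [])         ([] , [])         = refl
FF-swap (p ∷ ps , q ∷ qs) (u ∷ us , v ∷ vs) = cong₂ _*_ (cong ι (ℕ.*-comm (falling q v) (falling p u))) (FF-swap (ps , qs) (us , vs))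

FF-incy : ∀ {n} (a : Fin n) ρ m → ι (lookup (proj₂ ρ) a) * FF ρ m ≡ FF ρ (incy a m) + ι (lookup (proj₂ m) a) * FF ρ m
FF-incy a ρ m = begin
  ι (lookup (proj₂ ρ) a) * FF ρ m ≡⟨ cong (ι (lookup (proj₂ ρ) a) *_) (FF-swap ρ m) ⟨
  ι (lookup (proj₂ ρ) a) * FF (swapxy ρ) (swapxy m) ≡⟨ FF-incx a (swapxy ρ) (swapxy m) ⟩
  FF (swapxy ρ) (swapxy (incy a m)) + ι (lookup (proj₂ m) a) * FF (swapxy ρ) (swapxy m)
                                                         ≡⟨ cong₂ (λ y z → y + ι (lookup (proj₂ m) a) * z) (FF-swap ρ (incy a m)) (FF-swap ρ m) ⟩
  FF ρ (incy a m) + ι (lookup (proj₂ m) a) * FF ρ m      ∎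

ev-𝟘 : ∀ {n} (ρ : Mono n) → ev ρ 𝟘 ≡ 1ℚ
ev-𝟘 ([] , [])         = refl
ev-𝟘 (p ∷ ps , q ∷ qs) = trans (cong₂ _*_ ι-1 (ev-𝟘 (ps , qs))) (ℚ.*-identityˡ 1ℚ)

ev-incx : ∀ {n} (a : Fin n) ρ m → ev ρ (incx a m) ≡ ι (lookup (proj₁ ρ) a) * ev ρ m
ev-incx zero (p ∷ ps , q ∷ qs) (u ∷ us , v ∷ vs) =
  trans (cong (_* ev (ps , qs) (us , vs)) (trans (cong ι (ℕ.*-assoc p (p ℕ.^ u) (q ℕ.^ v))) (ι-* p (p ℕ.^ u ℕ.* q ℕ.^ v))))
        (ℚ.*-assoc (ι p) (ι (p ℕ.^ u ℕ.* q ℕ.^ v)) (ev (ps , qs) (us , vs)))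
ev-incx (suc a) (p ∷ ps , q ∷ qs) (u ∷ us , v ∷ vs) =
  trans (cong (e *_) (ev-incx a (ps , qs) (us , vs)))
        (solve 3 (λ x e F → e :* (x :* F) := x :* (e :* F)) refl (ι (lookup ps a)) e (ev (ps , qs) (us , vs)))
  where
  open ℚ-Solver
  e = ι (p ℕ.^ u ℕ.* q ℕ.^ v)

ev-swap : ∀ {n} (ρ m : Mono n) → ev (swapxy ρ) (swapxy m) ≡ ev ρ m
ev-swap ([] , [])         ([] , [])         = refl
ev-swap (p ∷ ps , q ∷ qs) (u ∷ us , v ∷ vs) = cong₂ _*_ (cong ι (ℕ.*-comm (q ℕ.^ v) (p ℕ.^ u))) (ev-swap (ps , qs) (us , vs))

ev-incy : ∀ {n} (a : Fin n) ρ m → ev ρ (incy a m) ≡ ι (lookup (proj₂ ρ) a) * ev ρ m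
ev-incy a ρ m = begin
  ev ρ (incy a m)                                   ≡⟨ ev-swap ρ (incy a m) ⟨
  ev (swapxy ρ) (incx a (swapxy m))                 ≡⟨ ev-incx a (swapxy ρ) (swapxy m) ⟩
  ι (lookup (proj₂ ρ) a) * ev (swapxy ρ) (swapxy m) ≡⟨ cong (ι (lookup (proj₂ ρ) a) *_) (ev-swap ρ m) ⟩
  ι (lookup (proj₂ ρ) a) * ev ρ m                   ∎

-- One summand for each bijection between rows and cells. This number becomes the bound on the
-- dimension, because a relation between the operators need only hold on their n! eigenvalues.
expand : ∀ {n} (c : Cells n) →
         Σ (Fin (n !) → ℚ) λ s → Σ (Fin (n !) → Mono n) λ ρ →
         ∀ us vs → D (ff ∘ c) us vs ≡ sum λ t → s t * FF (ρ t) (us , vs)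
expand {zero}  c = (λ _ → 1ℚ) , (λ _ → [] , []) , λ { [] [] → one }
  where
  opaque
    unfolding sum
    one : 1ℚ ≡ sum {1} λ t → 1ℚ * 1ℚ
    one = refl
expand {suc n} c = s , ρ , eq
  where
  ih : ∀ j → _
  ih j = expand (c ∘ punchIn j)
  s′ : Fin (suc n) × Fin (n !) → ℚ
  s′ (j , t) = sign j * proj₁ (ih j) t
  ρ′ : Fin (suc n) × Fin (n !) → Mono (suc n)
  ρ′ (j , t) = let (ps , qs) = proj₁ (proj₂ (ih j)) t in proj₁ (c j) ∷ ps , proj₂ (c j) ∷ qs
  s : Fin (suc n !) → ℚ
  s = s′ ∘ remQuot (n !)
  ρ : Fin (suc n !) → Mono (suc n)
  ρ = ρ′ ∘ remQuot (n !)
  eq : ∀ us vs → D (ff ∘ c) us vs ≡ sum λ t → s t * FF (ρ t) (us , vs)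
  eq (u ∷ us) (v ∷ vs) = sym (begin
    sum (λ i → s i * FF (ρ i) m)
      ≡⟨ sum-combine (suc n) {n !} (λ i → s i * FF (ρ i) m) ⟩
    sum (λ j → sum λ t → s (combine j t) * FF (ρ (combine j t)) m)
      ≡⟨ sum-cong-≗ (λ j → sum-cong-≗ λ t → cong (λ z → s′ z * FF (ρ′ z) m) (Fin.remQuot-combine j t)) ⟩
    sum (λ j → sum λ t → sign j * proj₁ (ih j) t * (ff (c j) u v * FF (proj₁ (proj₂ (ih j)) t) (us , vs)))
      ≡⟨ sum-cong-≗ inner ⟩
    sum (λ j → sign j * (ff (c j) u v * D (ff ∘ c ∘ punchIn j) us vs)) ∎)
    where
    open ℚ-Solver
    m = (u ∷ us , v ∷ vs)
    inner : ∀ j → sum (λ t → sign j * proj₁ (ih j) t * (ff (c j) u v * FF (proj₁ (proj₂ (ih j)) t) (us , vs)))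
                ≡ sign j * (ff (c j) u v * D (ff ∘ c ∘ punchIn j) us vs)
    inner j = begin
      sum (λ t → sign j * sⱼ t * (f * Fⱼ t)) ≡⟨ sum-cong-≗ (λ t → solve 4 (λ a b c d → a :* b :* (c :* d) := a :* c :* (b :* d)) refl (sign j) (sⱼ t) f (Fⱼ t)) ⟩
      sum (λ t → sign j * f * (sⱼ t * Fⱼ t)) ≡⟨ *-distribˡ-sum (sign j * f) (λ t → sⱼ t * Fⱼ t) ⟨
      sign j * f * sum (λ t → sⱼ t * Fⱼ t)        ≡⟨ ℚ.*-assoc (sign j) f _ ⟩
      sign j * (f * sum (λ t → sⱼ t * Fⱼ t)) ≡⟨ cong (λ z → sign j * (f * z)) (proj₂ (proj₂ (ih j)) us vs) ⟨
      sign j * (f * D (ff ∘ c ∘ punchIn j) us vs) ∎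
      where
      f = ff (c j) u v
      sⱼ : Fin (n !) → ℚ
      sⱼ = proj₁ (ih j)
      Fⱼ : Fin (n !) → ℚ
      Fⱼ t = FF (proj₁ (proj₂ (ih j)) t) (us , vs)

-- The upper bound for the dimension

max-≢0 : ∀ {n} (c : Fin n → ℚ) (d : Fin n → ℕ) → (∃ λ i → c i ≢ 0ℚ) →
         ∃ λ i → c i ≢ 0ℚ × (∀ j → c j ≢ 0ℚ → d j ≤ d i)
max-≢0 {suc n} c d (i , cᵢ≢0) with any-≢0 (c ∘ suc)
... | inj₂ c≡0 = zero , c₀≢0 i cᵢ≢0 , λ { zero _ → ℕ.≤-refl ; (suc j) cⱼ≢0 → contradiction (c≡0 j) cⱼ≢0 }
  where
  c₀≢0 : ∀ i → c i ≢ 0ℚ → c zero ≢ 0ℚ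
  c₀≢0 zero    c₀≢0 = c₀≢0
  c₀≢0 (suc i) cᵢ≢0 = contradiction (c≡0 i) cᵢ≢0
... | inj₁ ∃i with max-≢0 (c ∘ suc) (d ∘ suc) ∃i
...   | k , cₖ≢0 , max with c zero ℚ.≟ 0ℚ | d zero ℕ.≤? d (suc k)
...     | yes c₀≡0 | _      = suc k , cₖ≢0 , λ { zero c₀≢0 → contradiction c₀≡0 c₀≢0 ; (suc j) → max j }
...     | no _     | yes d≤ = suc k , cₖ≢0 , λ { zero _ → d≤ ; (suc j) → max j }
...     | no c₀≢0  | no d≰  = zero , c₀≢0 , λ { zero _ → ℕ.≤-refl ; (suc j) cⱼ≢0 → ℕ.≤-trans (max j cⱼ≢0) (ℕ.<⇒≤ (ℕ.≰⇒> d≰)) }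

-- ψ m is the result of applying to φ the operators (1 + x)∂ with multiplicities m.
module UpperBound {n} (c : Cells n)
  (s : Fin (n !) → ℚ) (ρ : Fin (n !) → Mono n)
  (φ≡FF : ∀ m → φ c m ≡ sum λ t → s t * FF (ρ t) m) where

  top : ℕ
  top = totx c ℕ.+ toty c

  ψ : Mono n → Mono n → ℚ
  ψ m m′ = sum λ t → ev (ρ t) m * (s t * FF (ρ t) m′)

  ψ-step : ∀ (e e′ : Fin (n !) → ℚ) (x : Fin (n !) → ℚ) (F F′ : Fin (n !) → ℚ) y →
           (∀ t → e′ t ≡ x t * e t) → (∀ t → x t * F t ≡ F′ t + y * F t) →
           sum (λ t → e′ t * (s t * F t)) ≡ sum (λ t → e t * (s t * F′ t)) + y * sum (λ t → e t * (s t * F t))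
  ψ-step e e′ x F F′ y e′≡ xF≡ = begin
    sum (λ t → e′ t * (s t * F t))                                  ≡⟨ sum-cong-≗ term ⟩
    sum (λ t → e t * (s t * F′ t) + y * (e t * (s t * F t))) ≡⟨ ∑-distrib-+ (λ t → e t * (s t * F′ t)) (λ t → y * (e t * (s t * F t))) ⟩
    sum (λ t → e t * (s t * F′ t)) + sum (λ t → y * (e t * (s t * F t))) ≡⟨ cong (sum (λ t → e t * (s t * F′ t)) +_) (*-distribˡ-sum y (λ t → e t * (s t * F t))) ⟨
    sum (λ t → e t * (s t * F′ t)) + y * sum (λ t → e t * (s t * F t)) ∎
    where
    open ℚ-Solver
    term : ∀ t → e′ t * (s t * F t) ≡ e t * (s t * F′ t) + y * (e t * (s t * F t))
    term t = begin
      e′ t * (s t * F t)                    ≡⟨ cong (_* (s t * F t)) (e′≡ t) ⟩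
      x t * e t * (s t * F t) ≡⟨ solve 4 (λ x e s F → x :* e :* (s :* F) := e :* (s :* (x :* F))) refl (x t) (e t) (s t) (F t) ⟩
      e t * (s t * (x t * F t))             ≡⟨ cong (λ z → e t * (s t * z)) (xF≡ t) ⟩
      e t * (s t * (F′ t + y * F t)) ≡⟨ solve 5 (λ e s F′ y F → e :* (s :* (F′ :+ y :* F)) := e :* (s :* F′) :+ y :* (e :* (s :* F))) refl (e t) (s t) (F′ t) y (F t) ⟩
      e t * (s t * F′ t) + y * (e t * (s t * F t)) ∎

  ψ-incx : ∀ a m m′ → ψ (incx a m) m′ ≡ ψ m (incx a m′) + ι (lookup (proj₁ m′) a) * ψ m m′
  ψ-incx a m m′ = ψ-step _ _ (λ t → ι (lookup (proj₁ (ρ t)) a)) _ _ (ι (lookup (proj₁ m′) a)) (λ t → ev-incx a (ρ t) m) (λ t → FF-incx a (ρ t) m′)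

  ψ-incy : ∀ a m m′ → ψ (incy a m) m′ ≡ ψ m (incy a m′) + ι (lookup (proj₂ m′) a) * ψ m m′
  ψ-incy a m m′ = ψ-step _ _ (λ t → ι (lookup (proj₂ (ρ t)) a)) _ _ (ι (lookup (proj₂ m′) a)) (λ t → ev-incy a (ρ t) m) (λ t → FF-incy a (ρ t) m′)

  -- Each further operator (1+x)∂ contributes, through its part x∂, a multiple of `ψ m m′` with
  -- `deg m + deg m′` below `top`; by induction this is a coefficient of Δ in a wrong degree, hence
  -- 0.
  ψ≡φ : ∀ m m′ → deg m ℕ.+ deg m′ ≤ top → ψ m m′ ≡ φ c (m ⊕ m′)
  ψ≡φ = mono-ind (λ m → ∀ m′ → deg m ℕ.+ deg m′ ≤ top → ψ m m′ ≡ φ c (m ⊕ m′)) start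
          (λ a m ih m′ le → step (incx a) m ih m′ (ι (lookup (proj₁ m′) a)) (ψ-incx a m m′) (deg-incx a m) (deg-incx a m′) (incx-⊕ a m m′) le)
          (λ a m ih m′ le → step (incy a) m ih m′ (ι (lookup (proj₂ m′) a)) (ψ-incy a m m′) (deg-incy a m) (deg-incy a m′) (incy-⊕ a m m′) le)
    where
    start : ∀ m′ → deg {n} 𝟘 ℕ.+ deg m′ ≤ top → ψ 𝟘 m′ ≡ φ c (𝟘 ⊕ m′)
    start m′ _ = begin
      ψ 𝟘 m′ ≡⟨ sum-cong-≗ (λ t → trans (cong (_* (s t * FF (ρ t) m′)) (ev-𝟘 (ρ t))) (ℚ.*-identityˡ _)) ⟩
      sum (λ t → s t * FF (ρ t) m′)     ≡⟨ φ≡FF m′ ⟨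
      φ c m′                            ≡⟨ cong (φ c) (𝟘-⊕ m′) ⟨
      φ c (𝟘 ⊕ m′)                      ∎
    step : ∀ (up : Mono n → Mono n) m → (∀ m′ → deg m ℕ.+ deg m′ ≤ top → ψ m m′ ≡ φ c (m ⊕ m′)) → ∀ m′ y →
           ψ (up m) m′ ≡ ψ m (up m′) + y * ψ m m′ → deg (up m) ≡ suc (deg m) → deg (up m′) ≡ suc (deg m′) →
           up m ⊕ m′ ≡ m ⊕ up m′ → deg (up m) ℕ.+ deg m′ ≤ top → ψ (up m) m′ ≡ φ c (up m ⊕ m′)
    step up m ih m′ y ψ-up deg-up deg-up′ up-⊕ le = begin
      ψ (up m) m′                           ≡⟨ ψ-up ⟩
      ψ m (up m′) + y * ψ m m′ ≡⟨ cong₂ (λ a b → a + y * b) (ih (up m′) le₁) (ih m′ (ℕ.<⇒≤ lt)) ⟩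
      φ c (m ⊕ up m′) + y * φ c (m ⊕ m′) ≡⟨ cong₂ (λ a b → φ c a + y * b) (sym up-⊕) (φ-homogeneous c (m ⊕ m′) λ e → ℕ.<-irrefl (trans (sym (deg-⊕ m m′)) e) lt) ⟩
      φ c (up m ⊕ m′) + y * 0ℚ              ≡⟨ cong (φ c (up m ⊕ m′) +_) (ℚ.*-zeroʳ y) ⟩
      φ c (up m ⊕ m′) + 0ℚ                  ≡⟨ ℚ.+-identityʳ _ ⟩
      φ c (up m ⊕ m′)                       ∎
      where
      lt : deg m ℕ.+ deg m′ < top
      lt = ℕ.≤-trans (ℕ.≤-reflexive (cong (ℕ._+ deg m′) (sym deg-up))) le
      le₁ : deg m ℕ.+ deg (up m′) ≤ top
      le₁ = ℕ.≤-trans (ℕ.≤-reflexive (trans (cong (deg m ℕ.+_) deg-up′) (ℕ.+-suc (deg m) (deg m′)))) lt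

  -- The eigenvalue vectors of `suc (n !)` operators lie in a space of dimension n!. In the
  -- resulting relation only the operators of the largest occurring order `d` reach degree `top`
  -- minus `d`, so the relation truncated to these holds between the derivatives.
  shifts-dependent : (g : Fin (suc (n !)) → Mono n) →
    Σ (Fin (suc (n !)) → ℚ) λ a → (∃ λ i → a i ≢ 0ℚ) × (∀ m′ → lc a (λ i m → φ c (g i ⊕ m)) m′ ≡ 0ℚ)
  shifts-dependent g with dependent (n !) (λ i t → ev (ρ t) (g i))
  ... | a , ∃i , vanish with max-≢0 a (deg ∘ g) ∃i
  ... | k , aₖ≢0 , max = a⁺ , (k , subst (_≢ 0ℚ) (sym (if-yes (deg (g k) ℕ.≟ d) refl)) aₖ≢0) , vanish⁺
    where
    d = deg (g k)
    a⁺ : Fin (suc (n !)) → ℚ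
    a⁺ i = if does (deg (g i) ℕ.≟ d) then a i else 0ℚ
    ψ-relation : ∀ m′ → sum (λ i → a i * ψ (g i) m′) ≡ 0ℚ
    ψ-relation m′ = begin
      sum (λ i → a i * ψ (g i) m′) ≡⟨ sum-cong-≗ (λ i → cong (a i *_) (sum-cong-≗ λ t → refl)) ⟩
      sum (λ i → a i * lc (λ t → ev (ρ t) (g i)) (λ t _ → s t * FF (ρ t) m′) m′) ≡⟨ lc-lc a (λ i t → ev (ρ t) (g i)) (λ t _ → s t * FF (ρ t) m′) m′ ⟩
      sum (λ t → (sum λ i → a i * ev (ρ t) (g i)) * (s t * FF (ρ t) m′)) ≡⟨ sum-zero _ (λ t → *-≡0ˡ (s t * FF (ρ t) m′) (vanish t)) ⟩
      0ℚ                                                     ∎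
    vanish⁺ : ∀ m′ → lc a⁺ (λ i m → φ c (g i ⊕ m)) m′ ≡ 0ℚ
    -- In the degree complementary to `d` the discarded operators contribute 0; in every other
    -- degree the retained derivatives vanish by homogeneity.
    vanish⁺ m′ with d ℕ.+ deg m′ ℕ.≟ top
    ... | yes d+≡top = trans (sum-cong-≗ λ i → sym (term i (a i ℚ.≟ 0ℚ) (deg (g i) ℕ.≟ d))) (ψ-relation m′)
      where
      term : ∀ i → Dec (a i ≡ 0ℚ) → (dec : Dec (deg (g i) ≡ d)) → a i * ψ (g i) m′ ≡ (if does dec then a i else 0ℚ) * φ c (g i ⊕ m′)
      term i (yes aᵢ≡0) dec = trans (*-≡0ˡ (ψ (g i) m′) aᵢ≡0)
                                  (sym (*-≡0ˡ (φ c (g i ⊕ m′)) (both dec)))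
        where
        both : (dec : Dec (deg (g i) ≡ d)) → (if does dec then a i else 0ℚ) ≡ 0ℚ
        both (yes _) = aᵢ≡0
        both (no _)  = refl
      term i (no aᵢ≢0) dec = trans (cong (a i *_) (ψ≡φ (g i) m′ (ℕ.≤-trans (ℕ.+-monoˡ-≤ (deg m′) (max i aᵢ≢0)) (ℕ.≤-reflexive d+≡top)))) (both dec)
        where
        both : (dec : Dec (deg (g i) ≡ d)) → a i * φ c (g i ⊕ m′) ≡ (if does dec then a i else 0ℚ) * φ c (g i ⊕ m′)
        both (yes _)   = refl
        both (no deg≢) = trans (*-≡0ʳ (a i) φ≡0) (sym (ℚ.*-zeroˡ (φ c (g i ⊕ m′))))
          where
          φ≡0 : φ c (g i ⊕ m′) ≡ 0ℚ
          φ≡0 = φ-homogeneous c (g i ⊕ m′) λ e → deg≢ (ℕ.+-cancelʳ-≡ (deg m′) (deg (g i)) d (trans (trans (sym (deg-⊕ (g i) m′)) e) (sym d+≡top)))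
    ... | no d+≢top = sum-zero _ λ i → term i (deg (g i) ℕ.≟ d)
      where
      term : ∀ i → (dec : Dec (deg (g i) ≡ d)) → (if does dec then a i else 0ℚ) * φ c (g i ⊕ m′) ≡ 0ℚ
      term i (no _)     = ℚ.*-zeroˡ (φ c (g i ⊕ m′))
      term i (yes deg≡) = *-≡0ʳ (a i) (φ-homogeneous c (g i ⊕ m′) λ e → d+≢top (trans (cong (ℕ._+ deg m′) (sym deg≡)) (trans (sym (deg-⊕ (g i) m′)) e)))

-- Lifting a basis across the corner

infixr 5 _◁_
_◁_ : ∀ {n} → ℕ × ℕ → Mono n → Mono (suc n)
(p , q) ◁ (us , vs) = p ∷ us , q ∷ vs

-- `c≤` is what makes the diagram a rectangle: the corner, which is listed last, dominates every
-- cell.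
module Rectangle {n} (c : Cells (suc n)) (c′ : Cells n) (A B : ℕ) (diagram : IsDiagram c)
  (c-last : c (fromℕ n) ≡ (A , B)) (c-init : ∀ b → c (inject₁ b) ≡ c′ b)
  (c≤ : ∀ b → proj₁ (c b) ≤ A × proj₂ (c b) ≤ B)
  (g : Fin (n !) → Mono n) (g-indep : Indep (shift c′ ∘ g)) where

  open IsDiagram diagram

  p q : Fin (suc n) → ℕ
  p b = proj₁ (c b)
  q b = proj₂ (c b)

  F : Fin (n !) → Mono n → ℚ
  F = shift c′ ∘ g

  -- The sign of the last column in the expansion along the first row, times the factorial scaling
  -- of the exponents A and B of variable 0.
  κ : ℚ
  κ = sign (fromℕ n) * ι (A ! ℕ.* B !)

  κ≢0 : κ ≢ 0ℚ
  κ≢0 κ≡0 = ι-!*!≢0 A B (*-cancel-≡0 (sign (fromℕ n)) (ι (A ! ℕ.* B !)) (signℕ-≢0 (toℕ (fromℕ n))) κ≡0)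

  φ-corner : ∀ m → φ c ((A , B) ◁ m) ≡ κ * φ c′ m
  φ-corner (us , vs) = begin
    sum term ≡⟨ sum-single (fromℕ n) term others ⟩
    sign (fromℕ n) * (δ (c (fromℕ n)) A B * D (δ ∘ c ∘ punchIn (fromℕ n)) us vs)
      ≡⟨ cong₂ (λ x y → sign (fromℕ n) * (x * y)) (trans (cong (λ z → δ z A B) c-last) (δ-refl A B))
           (D-cong (λ b u v → cong (λ z → δ z u v) (trans (cong c (punchIn-last b)) (c-init b))) us vs) ⟩
    sign (fromℕ n) * (ι (A ! ℕ.* B !) * φ c′ (us , vs)) ≡⟨ ℚ.*-assoc (sign (fromℕ n)) _ _ ⟨
    κ * φ c′ (us , vs)                                             ∎
    where
    term : Fin (suc n) → ℚ
    term j = sign j * (δ (c j) A B * D (δ ∘ c ∘ punchIn j) us vs)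
    others : ∀ j → j ≢ fromℕ n → term j ≡ 0ℚ
    others j j≢ = trans (cong (λ z → sign j * (z * D (δ ∘ c ∘ punchIn j) us vs)) (δ-≢ (c j) A B λ e → j≢ (c-injective (trans e (sym c-last)))))
                        (*-≡0ʳ (sign j) (ℚ.*-zeroˡ (D (δ ∘ c ∘ punchIn j) us vs)))

  φ-outside : ∀ u v m → φ c ((u , v) ◁ m) ≢ 0ℚ → u ≤ A × v ≤ B
  φ-outside u v (us , vs) φ≢0 with sum-≢0 _ φ≢0
  ... | j , term≢0 with δ-≢0 (c j) u v (*≢0ˡ (δ (c j) u v) _ (*≢0ʳ (sign j) _ term≢0))
  ... | eq = subst (λ z → proj₁ z ≤ A × proj₂ z ≤ B) eq (c≤ j)

  lift : Fin (suc n) → Fin (n !) → Mono (suc n)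
  lift b f = (A ∸ p b , B ∸ q b) ◁ g f

  L : Fin (suc n) → Fin (n !) → Mono (suc n) → ℚ
  L b f m = φ c (lift b f ⊕ m)

  L-diagonal : ∀ b f m → L b f (c b ◁ m) ≡ κ * F f m
  L-diagonal b f m = trans (cong (λ z → φ c (z ◁ (g f ⊕ m))) (cong₂ _,_ (ℕ.m∸n+n≡m (proj₁ (c≤ b))) (ℕ.m∸n+n≡m (proj₂ (c≤ b))))) (φ-corner (g f ⊕ m))

  -- A nonzero value requires A - p b + p b′ ≤ A and likewise in y. Then cell `b′` lies weakly below
  -- cell `b`, which `order` excludes when `b` comes first.
  L-off-diagonal : ∀ b f b′ m → toℕ b < toℕ b′ → L b f (c b′ ◁ m) ≡ 0ℚ
  L-off-diagonal b f b′ m b<b′ = ¬⇒≡0 λ L≢0 →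
    let (≤A , ≤B) = φ-outside (A ∸ p b ℕ.+ p b′) (B ∸ q b ℕ.+ q b′) (g f ⊕ m) L≢0
    in ℕ.<⇒≱ b<b′ (order b b′
         (ℕ.+-cancelˡ-≤ (A ∸ p b) (p b′) (p b) (ℕ.≤-trans ≤A (ℕ.≤-reflexive (sym (ℕ.m∸n+n≡m (proj₁ (c≤ b)))))))
         (ℕ.+-cancelˡ-≤ (B ∸ q b) (q b′) (q b) (ℕ.≤-trans ≤B (ℕ.≤-reflexive (sym (ℕ.m∸n+n≡m (proj₂ (c≤ b))))))))

  -- Back substitution from the last cell: at `c b` the earlier blocks vanish by `L-off-diagonal`,
  -- the later ones have coefficients already known to be 0, and block `b` is `κ` times the
  -- independent family `F`. The threshold `t` is 0 for independence; in `diagonal-entry` the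
  -- relation is known only from one cell onwards.
  triangular : (d : Fin (suc n) → Fin (n !) → ℚ) (t : ℕ) →
    (∀ b′ → t ≤ toℕ b′ → ∀ m → sum (λ b → lc (d b) (L b) (c b′ ◁ m)) ≡ 0ℚ) →
    ∀ b → t ≤ toℕ b → ∀ f → d b f ≡ 0ℚ
  triangular d t vanish b = go (suc n) b (ℕ.m≤n+m (suc n) (toℕ b))
    where
    go : ∀ k b → suc n ≤ toℕ b ℕ.+ k → t ≤ toℕ b → ∀ f → d b f ≡ 0ℚ
    go zero    b n≤ _   = contradiction (ℕ.≤-trans n≤ (ℕ.≤-reflexive (ℕ.+-identityʳ (toℕ b)))) (ℕ.<⇒≱ (Fin.toℕ<n b))
    go (suc k) b n≤ t≤b = g-indep (d b) λ m → *-cancel-≡0 κ (lc (d b) F m) κ≢0 (begin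
      κ * lc (d b) F m            ≡⟨ *-distribˡ-sum κ (λ f → d b f * F f m) ⟩
      sum (λ f → κ * (d b f * F f m)) ≡⟨ sum-cong-≗ (λ f → solve 3 (λ k d x → k :* (d :* x) := d :* (k :* x)) refl κ (d b f) (F f m)) ⟩
      sum (λ f → d b f * (κ * F f m)) ≡⟨ sum-cong-≗ (λ f → cong (d b f *_) (L-diagonal b f m)) ⟨
      lc (d b) (L b) (c b ◁ m) ≡⟨ sum-single b (λ b″ → lc (d b″) (L b″) (c b ◁ m)) (others m) ⟨
      sum (λ b″ → lc (d b″) (L b″) (c b ◁ m))            ≡⟨ vanish b t≤b m ⟩
      0ℚ                                                 ∎)
      where
      open ℚ-Solver
      others : ∀ m b″ → b″ ≢ b → lc (d b″) (L b″) (c b ◁ m) ≡ 0ℚ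
      others m b″ b″≢b with ℕ.<-cmp (toℕ b″) (toℕ b)
      ... | tri< b″<b _ _ = sum-zero _ λ f → *-≡0ʳ (d b″ f) (L-off-diagonal b″ f b m b″<b)
      ... | tri≈ _ b″≡b _ = contradiction (Fin.toℕ-injective b″≡b) b″≢b
      ... | tri> _ _ b<b″ = sum-zero _ λ f → *-≡0ˡ (L b″ f (c b ◁ m)) (go k b″ n≤′ (ℕ.≤-trans t≤b (ℕ.<⇒≤ b<b″)) f)
        where
        n≤′ : suc n ≤ toℕ b″ ℕ.+ k
        n≤′ = ℕ.≤-trans n≤ (ℕ.≤-trans (ℕ.≤-reflexive (ℕ.+-suc (toℕ b) k)) (ℕ.+-monoˡ-≤ k b<b″))

  lifts : Fin (suc n !) → Mono (suc n)
  lifts i = uncurry lift (remQuot (n !) i)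

  family : Fin (suc n !) → Mono (suc n) → ℚ
  family i m = φ c (lifts i ⊕ m)

  lc-family : ∀ a m → lc a family m ≡ sum λ b → lc (λ f → a (combine b f)) (L b) m
  lc-family a m = trans (sum-combine (suc n) {n !} (λ i → a i * family i m))
    (sum-cong-≗ λ b → sum-cong-≗ λ f → cong (λ z → a (combine b f) * φ c (uncurry lift z ⊕ m)) (Fin.remQuot-combine b f))

  family-indep : Indep family
  family-indep a vanish i = trans (cong a (sym (Fin.combine-remQuot {suc n} (n !) i)))
    (triangular (λ b f → a (combine b f)) 0 (λ b′ _ m → trans (sym (lc-family a (c b′ ◁ m))) (vanish (c b′ ◁ m)))
      (proj₁ (remQuot {suc n} (n !) i)) z≤n (proj₂ (remQuot {suc n} (n !) i)))

  family-span : ∀ m → InSpan family (λ m′ → φ c (m ⊕ m′))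
  family-span m = span (U.shifts-dependent g⁺)
    where
    e = expand c
    φ≡FF : ∀ m → φ c m ≡ sum λ t → proj₁ e t * FF (proj₁ (proj₂ e) t) m
    φ≡FF (us , vs) = trans (D-δ≡D-ff c diagram us vs) (proj₂ (proj₂ e) us vs)
    module U = UpperBound c (proj₁ e) (proj₁ (proj₂ e)) φ≡FF
    -- Adjoining the derivative of exponent `m` to the lifts gives one shift more than can be
    -- independent.
    g⁺ : Fin (suc (suc n !)) → Mono (suc n)
    g⁺ zero    = m
    g⁺ (suc i) = lifts i
    span : Σ (Fin (suc (suc n !)) → ℚ) (λ a → (∃ λ i → a i ≢ 0ℚ) × (∀ m′ → lc a (λ i m → φ c (g⁺ i ⊕ m)) m′ ≡ 0ℚ)) →
           InSpan family (λ m′ → φ c (m ⊕ m′))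
    span (a , ∃i , vanish) = dependence⇒InSpan family (λ m′ → φ c (m ⊕ m′)) family-indep a ∃i
      λ m′ → trans (sym (sum-suc (λ i → a i * φ c (g⁺ i ⊕ m′)))) (vanish m′)

  -- `L b₀ f₀ ∘ T` and the combination of block `b₀` with coefficients `α` agree at every cell from
  -- `b₀` onwards. Their difference has coordinates `d`, which therefore vanish by `triangular` in
  -- the blocks from `b₀` onwards.
  diagonal-entry : (T : Mono (suc n) → Mono (suc n)) (T′ : Mono n → Mono n) → (∀ z m → T (z ◁ m) ≡ z ◁ T′ m) →
    ∀ b₀ f₀ (α : Fin (n !) → ℚ) → (∀ m → F f₀ (T′ m) ≡ lc α F m) →
    (β : Fin (suc n !) → ℚ) → (∀ m → L b₀ f₀ (T m) ≡ lc β family m) → β (combine b₀ f₀) ≡ α f₀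
  diagonal-entry T T′ T◁ b₀ f₀ α α-eq β β-eq = x∙y⁻¹≈ε⇒x≈y ℚ.+-0-group (β (combine b₀ f₀)) (α f₀) (begin
    β (combine b₀ f₀) + - α f₀ ≡⟨ cong (λ z → β (combine b₀ f₀) + - z) (ℚ.*-identityˡ (α f₀)) ⟨
    β (combine b₀ f₀) + - (1ℚ * α f₀) ≡⟨ cong (λ z → β (combine b₀ f₀) + - (z * α f₀)) (kron-refl b₀) ⟨
    d b₀ f₀ ≡⟨ triangular d (toℕ b₀) vanish b₀ ℕ.≤-refl f₀ ⟩
    0ℚ                                          ∎)
    where
    open ℚ-Solver
    d : Fin (suc n) → Fin (n !) → ℚ
    d b f = β (combine b f) + - (kron b₀ b * α f)
    residue : ∀ m → sum (λ b → lc (d b) (L b) m) ≡ L b₀ f₀ (T m) + - lc α (L b₀) m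
    residue m = begin
      sum (λ b → lc (d b) (L b) m)
        ≡⟨ sum-cong-≗ (λ b → trans (lc-+ (λ f → β (combine b f)) (λ f → - (kron b₀ b * α f)) (L b) m)
             (cong (lc (λ f → β (combine b f)) (L b) m +_) (trans (lc-neg (λ f → kron b₀ b * α f) (L b) m) (cong -_ (lc-scale (kron b₀ b) α (L b) m))))) ⟩
      sum (λ b → lc (λ f → β (combine b f)) (L b) m + - (kron b₀ b * lc α (L b) m))
        ≡⟨ ∑-distrib-+ (λ b → lc (λ f → β (combine b f)) (L b) m) (λ b → - (kron b₀ b * lc α (L b) m)) ⟩
      sum (λ b → lc (λ f → β (combine b f)) (L b) m) + sum (λ b → - (kron b₀ b * lc α (L b) m))
        ≡⟨ cong₂ _+_ (trans (sym (lc-family β m)) (sym (β-eq m))) (trans (sum-neg (λ b → kron b₀ b * lc α (L b) m)) (cong -_ (sum-kronˡ b₀ (λ b → lc α (L b) m)))) ⟩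
      L b₀ f₀ (T m) + - lc α (L b₀) m ∎
    agree : ∀ b′ → toℕ b₀ ≤ toℕ b′ → ∀ m → L b₀ f₀ (c b′ ◁ T′ m) ≡ lc α (L b₀) (c b′ ◁ m)
    agree b′ b₀≤b′ m with b₀ Fin.≟ b′
    ... | yes refl = begin
      L b₀ f₀ (c b₀ ◁ T′ m)                            ≡⟨ L-diagonal b₀ f₀ (T′ m) ⟩
      κ * F f₀ (T′ m)                           ≡⟨ cong (κ *_) (α-eq m) ⟩
      κ * lc α F m              ≡⟨ *-distribˡ-sum κ (λ f → α f * F f m) ⟩
      sum (λ f → κ * (α f * F f m)) ≡⟨ sum-cong-≗ (λ f → trans (solve 3 (λ k d x → k :* (d :* x) := d :* (k :* x)) refl κ (α f) (F f m)) (cong (α f *_) (sym (L-diagonal b₀ f m)))) ⟩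
      lc α (L b₀) (c b₀ ◁ m)                           ∎
    ... | no b₀≢b′ = trans (L-off-diagonal b₀ f₀ b′ (T′ m) b₀<b′) (sym (sum-zero _ λ f → *-≡0ʳ (α f) (L-off-diagonal b₀ f b′ m b₀<b′)))
      where
      b₀<b′ : toℕ b₀ < toℕ b′
      b₀<b′ = ℕ.≤∧≢⇒< b₀≤b′ (b₀≢b′ ∘ Fin.toℕ-injective)
    vanish : ∀ b′ → toℕ b₀ ≤ toℕ b′ → ∀ m → sum (λ b → lc (d b) (L b) (c b′ ◁ m)) ≡ 0ℚ
    vanish b′ b₀≤b′ m = begin
      sum (λ b → lc (d b) (L b) (c b′ ◁ m)) ≡⟨ residue (c b′ ◁ m) ⟩
      L b₀ f₀ (T (c b′ ◁ m)) + - lc α (L b₀) (c b′ ◁ m) ≡⟨ cong₂ (λ x y → x + - y) (cong (L b₀ f₀) (T◁ (c b′) m)) (sym (agree b′ b₀≤b′ m)) ⟩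
      L b₀ f₀ (c b′ ◁ T′ m) + - L b₀ f₀ (c b′ ◁ T′ m) ≡⟨ ℚ.+-inverseʳ (L b₀ f₀ (c b′ ◁ T′ m)) ⟩
      0ℚ                                                           ∎

-- Polynomials

module ℕ∏ = Algebra.Properties.CommutativeMonoid.Sum ℕ.*-1-commutativeMonoid

_≟M_ : ∀ {n} (m m′ : Mono n) → Dec (m ≡ m′)
_≟M_ = Product.≡-dec (Vec.≡-dec ℕ._≟_) (Vec.≡-dec ℕ._≟_)

[_∶_]_ : ∀ {n} → Mono n → Mono n → ℚ → ℚ
[ m ∶ m′ ] q = if monoEq m m′ then q else 0ℚ

monoEq-refl : ∀ {n} (m : Mono n) → monoEq m m ≡ true
monoEq-refl (us , vs) rewrite dec-true (Vec.≡-dec ℕ._≟_ us us) refl | dec-true (Vec.≡-dec ℕ._≟_ vs vs) refl = refl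

monoEq-≢ : ∀ {n} {m m′ : Mono n} → m ≢ m′ → monoEq m m′ ≡ false
monoEq-≢ {m = us , vs} {us′ , vs′} m≢m′ with Vec.≡-dec ℕ._≟_ us us′ | Vec.≡-dec ℕ._≟_ vs vs′
... | yes refl | yes refl = contradiction refl m≢m′
... | yes _    | no _     = refl
... | no _     | _        = refl

[]-≡ : ∀ {n} {m m′ : Mono n} q → m ≡ m′ → [ m ∶ m′ ] q ≡ q
[]-≡ {m = m} q refl = cong (λ b → if b then q else 0ℚ) (monoEq-refl m)

[]-≢ : ∀ {n} {m m′ : Mono n} q → m ≢ m′ → [ m ∶ m′ ] q ≡ 0ℚ
[]-≢ q m≢m′ = cong (λ b → if b then q else 0ℚ) (monoEq-≢ m≢m′)

coeff-++ : ∀ {n} (P Q : Poly n) m → coeff (P ++ Q) m ≡ coeff P m + coeff Q m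
coeff-++ []            Q m = sym (ℚ.+-identityˡ (coeff Q m))
coeff-++ ((q , x) ∷ P) Q m = trans (cong ([ x ∶ m ] q +_) (coeff-++ P Q m)) (sym (ℚ.+-assoc ([ x ∶ m ] q) (coeff P m) (coeff Q m)))

-- Additivity reduces an operation on terms to its effect on a single term.
coeff-map : ∀ {n k} (F : ℚ × Mono n → ℚ × Mono k) r m m′ →
            (∀ q x → [ proj₂ (F (q , x)) ∶ m′ ] proj₁ (F (q , x)) ≡ r * [ x ∶ m ] q) →
            ∀ P → coeff (List.map F P) m′ ≡ r * coeff P m
coeff-map F r m m′ term []            = sym (ℚ.*-zeroʳ r)
coeff-map F r m m′ term ((q , x) ∷ P) = trans (cong₂ _+_ (term q x) (coeff-map F r m m′ term P)) (sym (ℚ.*-distribˡ-+ r ([ x ∶ m ] q) (coeff P m)))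

[]-* : ∀ {n} r q (x m : Mono n) → [ x ∶ m ] (r * q) ≡ r * [ x ∶ m ] q
[]-* r q x m with monoEq x m
... | true  = refl
... | false = sym (ℚ.*-zeroʳ r)

coeff-scaleP : ∀ {n} r (P : Poly n) m → coeff (scaleP r P) m ≡ r * coeff P m
coeff-scaleP r P m = coeff-map (λ t → r * proj₁ t , proj₂ t) r m m (λ q x → []-* r q x m) P

opaque
  unfolding sum
  coeff-sumP : ∀ {n} d (F : Fin d → Poly n) m → coeff (sumP (List.map F (allFin d))) m ≡ sum λ i → coeff (F i) m
  coeff-sumP d F m = trans (cong (λ Fs → coeff (sumP Fs) m) (List.map-tabulate id F)) (go d F)
    where
    go : ∀ d (F : Fin d → Poly _) → coeff (sumP (List.tabulate F)) m ≡ sum λ i → coeff (F i) m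
    go zero    F = refl
    go (suc d) F = trans (coeff-++ (F zero) _ m) (cong (coeff (F zero) m +_) (go d (F ∘ suc)))

coeff-comb : ∀ {n d} (a : Fin d → ℚ) (b : Fin d → Poly n) m → coeff (comb a b) m ≡ lc a (coeff ∘ b) m
coeff-comb {d = d} a b m = trans (coeff-sumP d (λ i → scaleP (a i) (b i)) m) (sum-cong-≗ λ i → coeff-scaleP (a i) (b i) m)

fac : ∀ {n} → Vec ℕ n → ℕ
fac []       = 1
fac (u ∷ us) = u ! ℕ.* fac us

fac-≢0 : ∀ {n} (us : Vec ℕ n) → ℕ.NonZero (fac us)
fac-≢0 []       = _
fac-≢0 (u ∷ us) = ℕ.m*n≢0 (u !) (fac us) {{u ℕ.!≢0}} {{fac-≢0 us}}

facM : ∀ {n} → Mono n → ℚ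
facM (us , vs) = ι (fac us ℕ.* fac vs)

facM-≢0 : ∀ {n} (m : Mono n) → facM m ≢ 0ℚ
facM-≢0 (us , vs) = ι-≢0 _ {{ℕ.m*n≢0 (fac us) (fac vs) {{fac-≢0 us}} {{fac-≢0 vs}}}}

-- Coefficients scaled by factorials, so that derivations become shifts.
nf : ∀ {n} → Poly n → Mono n → ℚ
nf P m = facM m * coeff P m

nf-comb : ∀ {n d} (a : Fin d → ℚ) (b : Fin d → Poly n) m → nf (comb a b) m ≡ lc a (nf ∘ b) m
nf-comb a b m = begin
  facM m * coeff (comb a b) m                ≡⟨ cong (facM m *_) (coeff-comb a b m) ⟩
  facM m * lc a (coeff ∘ b) m ≡⟨ *-distribˡ-sum (facM m) (λ i → a i * coeff (b i) m) ⟩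
  sum (λ i → facM m * (a i * coeff (b i) m)) ≡⟨ sum-cong-≗ (λ i → solve 3 (λ f a x → f :* (a :* x) := a :* (f :* x)) refl (facM m) (a i) (coeff (b i) m)) ⟩
  lc a (nf ∘ b) m                            ∎
  where open ℚ-Solver

nf-cong : ∀ {n} {P Q : Poly n} → P ≈P Q → nf P ≗ nf Q
nf-cong P≈Q m = cong (facM m *_) (P≈Q m)

nf-≈comb : ∀ {n d} (P : Poly n) (a : Fin d → ℚ) (b : Fin d → Poly n) → P ≈P comb a b → ∀ m → nf P m ≡ lc a (nf ∘ b) m
nf-≈comb P a b P≈ m = trans (nf-cong {P = P} {comb a b} P≈ m) (nf-comb a b m)

nf-injective : ∀ {n} {P Q : Poly n} → nf P ≗ nf Q → P ≈P Q
nf-injective {P = P} {Q} eq m = *-cancelˡ-≡ (facM m) (coeff P m) (coeff Q m) (facM-≢0 m) (eq m)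

fac-inc : ∀ {n} (a : Fin n) us → fac (inc a us) ≡ suc (lookup us a) ℕ.* fac us
fac-inc zero    (u ∷ us) = ℕ.*-assoc (suc u) (u !) (fac us)
fac-inc (suc a) (u ∷ us) = trans (cong (u ! ℕ.*_) (fac-inc a us)) (ℕ*.x∙yz≈y∙xz (u !) (suc (lookup us a)) (fac us))

pred-inc : ∀ {n} (a : Fin n) us → Vec.updateAt (inc a us) a ℕ.pred ≡ us
pred-inc zero    (u ∷ us) = refl
pred-inc (suc a) (u ∷ us) = cong (u ∷_) (pred-inc a us)

inc-pred : ∀ {n} (a : Fin n) us → lookup us a ≢ 0 → inc a (Vec.updateAt us a ℕ.pred) ≡ us
inc-pred zero    (zero ∷ us)  u≢0 = contradiction refl u≢0
inc-pred zero    (suc u ∷ us) u≢0 = refl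
inc-pred (suc a) (u ∷ us)     u≢0 = cong (u ∷_) (inc-pred a us u≢0)

-- Lowering an exponent by `ℕ.pred` can hit `m` from a monomial other than `m⁺` only by truncation
-- at exponent 0; the factor `e` produced by the derivation is then 0.
∂-term : ∀ {n} (x m m⁺ x⁻ : Mono n) (e k : ℕ) q → (x ≡ m⁺ → x⁻ ≡ m × e ≡ k) → (x ≢ m⁺ → x⁻ ≡ m → e ≡ 0) →
         [ x⁻ ∶ m ] (q * qℕ e) ≡ qℕ k * [ x ∶ m⁺ ] q
∂-term x m m⁺ x⁻ e k q same other with x ≟M m⁺ | x⁻ ≟M m
... | yes x≡m⁺ | _ = begin
  [ x⁻ ∶ m ] (q * qℕ e)   ≡⟨ []-≡ (q * qℕ e) (proj₁ (same x≡m⁺)) ⟩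
  q * qℕ e                ≡⟨ ℚ.*-comm q (qℕ e) ⟩
  qℕ e * q ≡⟨ cong₂ (λ z w → qℕ z * w) (proj₂ (same x≡m⁺)) (sym ([]-≡ q x≡m⁺)) ⟩
  qℕ k * [ x ∶ m⁺ ] q     ∎
... | no x≢m⁺ | yes x⁻≡m = begin
  [ x⁻ ∶ m ] (q * qℕ e)   ≡⟨ []-≡ (q * qℕ e) x⁻≡m ⟩
  q * qℕ e                ≡⟨ cong (λ z → q * qℕ z) (other x≢m⁺ x⁻≡m) ⟩
  q * 0ℚ                  ≡⟨ ℚ.*-zeroʳ q ⟩
  0ℚ                      ≡⟨ ℚ.*-zeroʳ (qℕ k) ⟨
  qℕ k * 0ℚ               ≡⟨ cong (qℕ k *_) ([]-≢ q x≢m⁺) ⟨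
  qℕ k * [ x ∶ m⁺ ] q     ∎
... | no x≢m⁺ | no x⁻≢m = begin
  [ x⁻ ∶ m ] (q * qℕ e)   ≡⟨ []-≢ (q * qℕ e) x⁻≢m ⟩
  0ℚ                      ≡⟨ ℚ.*-zeroʳ (qℕ k) ⟨
  qℕ k * 0ℚ               ≡⟨ cong (qℕ k *_) ([]-≢ q x≢m⁺) ⟨
  qℕ k * [ x ∶ m⁺ ] q     ∎

coeff-∂x : ∀ {n} (a : Fin n) P m → coeff (∂x a P) m ≡ qℕ (suc (lookup (proj₁ m) a)) * coeff P (incx a m)
coeff-∂x a P m@(us , vs) = coeff-map _ (qℕ (suc (lookup us a))) (incx a m) m term P
  where
  term : ∀ q x → [ Vec.updateAt (proj₁ x) a ℕ.pred , proj₂ x ∶ m ] (q * qℕ (lookup (proj₁ x) a)) ≡ qℕ (suc (lookup us a)) * [ x ∶ incx a m ] q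
  term q x@(xs , ys) = ∂-term x m (incx a m) (Vec.updateAt xs a ℕ.pred , ys) (lookup xs a) (suc (lookup us a)) q
    (λ { refl → cong (_, vs) (pred-inc a us) , Vec.lookup∘updateAt a us })
    (λ x≢ eq → decidable-stable (lookup xs a ℕ.≟ 0) λ ≢0 → x≢ (trans (cong (_, ys) (sym (inc-pred a xs ≢0))) (cong (incx a) eq)))

coeff-∂y : ∀ {n} (a : Fin n) P m → coeff (∂y a P) m ≡ qℕ (suc (lookup (proj₂ m) a)) * coeff P (incy a m)
coeff-∂y a P m@(us , vs) = coeff-map _ (qℕ (suc (lookup vs a))) (incy a m) m term P
  where
  term : ∀ q x → [ proj₁ x , Vec.updateAt (proj₂ x) a ℕ.pred ∶ m ] (q * qℕ (lookup (proj₂ x) a)) ≡ qℕ (suc (lookup vs a)) * [ x ∶ incy a m ] q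
  term q x@(xs , ys) = ∂-term x m (incy a m) (xs , Vec.updateAt ys a ℕ.pred) (lookup ys a) (suc (lookup vs a)) q
    (λ { refl → cong (us ,_) (pred-inc a vs) , Vec.lookup∘updateAt a vs })
    (λ x≢ eq → decidable-stable (lookup ys a ℕ.≟ 0) λ ≢0 → x≢ (trans (cong (xs ,_) (sym (inc-pred a ys ≢0))) (cong (incy a) eq)))

-- The factor `k` produced by a derivation is the quotient of the two factorial scalings.
nf-step : ∀ {n} (P P′ : Poly n) m m⁺ k → coeff P′ m ≡ qℕ k * coeff P m⁺ → facM m⁺ ≡ ι k * facM m → nf P′ m ≡ nf P m⁺
nf-step P P′ m m⁺ k eq fac-eq = begin
  facM m * coeff P′ m               ≡⟨ cong (facM m *_) eq ⟩
  facM m * (qℕ k * coeff P m⁺)      ≡⟨ cong (λ z → facM m * (z * coeff P m⁺)) (ι≡qℕ k) ⟨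
  facM m * (ι k * coeff P m⁺)       ≡⟨ ℚ.*-assoc (facM m) (ι k) _ ⟨
  facM m * ι k * coeff P m⁺ ≡⟨ cong (_* coeff P m⁺) (trans (ℚ.*-comm (facM m) (ι k)) (sym fac-eq)) ⟩
  nf P m⁺                           ∎

nf-∂x : ∀ {n} (a : Fin n) P m → nf (∂x a P) m ≡ nf P (incx a m)
nf-∂x a P m@(us , vs) = nf-step P (∂x a P) m (incx a m) (suc (lookup us a)) (coeff-∂x a P m)
  (trans (cong ι (trans (cong (ℕ._* fac vs) (fac-inc a us)) (ℕ.*-assoc (suc (lookup us a)) (fac us) (fac vs)))) (ι-* (suc (lookup us a)) (fac us ℕ.* fac vs)))

nf-∂y : ∀ {n} (a : Fin n) P m → nf (∂y a P) m ≡ nf P (incy a m)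
nf-∂y a P m@(us , vs) = nf-step P (∂y a P) m (incy a m) (suc (lookup vs a)) (coeff-∂y a P m)
  (trans (cong ι (trans (cong (fac us ℕ.*_) (fac-inc a vs)) (ℕ*.x∙yz≈y∙xz (fac us) (suc (lookup vs a)) (fac vs)))) (ι-* (suc (lookup vs a)) (fac us ℕ.* fac vs)))

deriv⇒shift : ∀ {n} {D P : Poly n} → IsDeriv D P → ∃ λ m → ∀ m′ → nf P m′ ≡ nf D (m ⊕ m′)
deriv⇒shift {D = D} base = 𝟘 , λ m′ → cong (nf D) (sym (𝟘-⊕ m′))
deriv⇒shift {D = D} (dx {P} a isD) = let (m , eq) = deriv⇒shift isD in
  incx a m , λ m′ → trans (nf-∂x a P m′) (trans (eq (incx a m′)) (cong (nf D) (sym (incx-⊕ a m m′))))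
deriv⇒shift {D = D} (dy {P} a isD) = let (m , eq) = deriv⇒shift isD in
  incy a m , λ m′ → trans (nf-∂y a P m′) (trans (eq (incy a m′)) (cong (nf D) (sym (incy-⊕ a m m′))))

shift⇒deriv : ∀ {n} (D : Poly n) m → ∃ λ P → IsDeriv D P × (∀ m′ → nf P m′ ≡ nf D (m ⊕ m′))
shift⇒deriv D = mono-ind (λ m → ∃ λ P → IsDeriv D P × (∀ m′ → nf P m′ ≡ nf D (m ⊕ m′)))
  (D , base , λ m′ → cong (nf D) (sym (𝟘-⊕ m′)))
  (λ { a m (P , isD , eq) → ∂x a P , dx a isD , λ m′ → trans (nf-∂x a P m′) (trans (eq (incx a m′)) (cong (nf D) (sym (incx-⊕ a m m′)))) })
  (λ { a m (P , isD , eq) → ∂y a P , dy a isD , λ m′ → trans (nf-∂y a P m′) (trans (eq (incy a m′)) (cong (nf D) (sym (incy-⊕ a m m′)))) })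

-- ΔC, M, HC and IsFrobCharC are Δ, InM, H and IsFrobChar for an arbitrary list of cells.
ΔC : ∀ {n} → Cells n → Poly n
ΔC {n} c = det n (λ a b → xyPow a (proj₁ (c b)) (proj₂ (c b)))

-- Introduces a new variable 0 with exponent 0. The minors in the expansion of `ΔC` along the first
-- row are of this form, since they do not involve the variable of that row.
weaken : ∀ {n} → Poly n → Poly (suc n)
weaken = List.map λ t → proj₁ t , (0 ∷ proj₁ (proj₂ t) , 0 ∷ proj₂ (proj₂ t))

scaleP-weaken : ∀ {n} q (P : Poly n) → scaleP q (weaken P) ≡ weaken (scaleP q P)
scaleP-weaken q P = trans (sym (List.map-∘ P)) (List.map-∘ P)

*P-weaken : ∀ {n} (P Q : Poly n) → weaken P *P weaken Q ≡ weaken (P *P Q)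
*P-weaken []      Q = refl
*P-weaken (t ∷ P) Q = trans (cong₂ _++_ (trans (sym (List.map-∘ Q)) (List.map-∘ Q)) (*P-weaken P Q)) (sym (List.map-++ _ _ (P *P Q)))

sumP-weaken : ∀ {n} (Ps : List (Poly n)) → sumP (List.map weaken Ps) ≡ weaken (sumP Ps)
sumP-weaken []       = refl
sumP-weaken (P ∷ Ps) = trans (cong (weaken P ++_) (sumP-weaken Ps)) (sym (List.map-++ _ P (sumP Ps)))

det-weaken : ∀ {N} n (M : Fin n → Fin n → Poly N) → det n (λ a b → weaken (M a b)) ≡ weaken (det n M)
det-weaken zero    M = refl
det-weaken (suc n) M = begin
  sumP (List.map (λ j → scaleP (sign j) (weaken (M zero j) *P det n (λ a b → weaken (M (suc a) (punchIn j b))))) (allFin (suc n)))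
    ≡⟨ cong sumP (List.map-cong (λ j → trans (cong (scaleP (sign j)) (trans (cong (weaken (M zero j) *P_) (det-weaken n (λ a b → M (suc a) (punchIn j b)))) (*P-weaken (M zero j) _))) (scaleP-weaken (sign j) _)) (allFin (suc n))) ⟩
  sumP (List.map (λ j → weaken (scaleP (sign j) (M zero j *P det n (λ a b → M (suc a) (punchIn j b))))) (allFin (suc n)))
    ≡⟨ cong sumP (List.map-∘ (allFin (suc n))) ⟩
  sumP (List.map weaken (List.map (λ j → scaleP (sign j) (M zero j *P det n (λ a b → M (suc a) (punchIn j b)))) (allFin (suc n))))
    ≡⟨ sumP-weaken (List.map (λ j → scaleP (sign j) (M zero j *P det n (λ a b → M (suc a) (punchIn j b)))) (allFin (suc n))) ⟩
  weaken (det (suc n) M) ∎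

zipWith-zeros : ∀ {n} (us : Vec ℕ n) → Vec.zipWith ℕ._+_ (tabulate (λ _ → 0)) us ≡ us
zipWith-zeros []       = refl
zipWith-zeros (u ∷ us) = cong (u ∷_) (zipWith-zeros us)

coeff-xyPow-*P : ∀ {n} c (Q : Poly n) z m →
  coeff (xyPow zero (proj₁ c) (proj₂ c) *P weaken Q) (z ◁ m) ≡ (if does (c ≟² z) then 1ℚ else 0ℚ) * coeff Q m
coeff-xyPow-*P {n} c@(p , q) Q z m = begin
  coeff (List.map F (weaken Q) ++ []) (z ◁ m) ≡⟨ cong (λ R → coeff R (z ◁ m)) (List.++-identityʳ (List.map F (weaken Q))) ⟩
  coeff (List.map F (weaken Q)) (z ◁ m) ≡⟨ cong (λ R → coeff R (z ◁ m)) (List.map-∘ Q) ⟨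
  coeff (List.map _ Q) (z ◁ m) ≡⟨ coeff-map _ (if does (c ≟² z) then 1ℚ else 0ℚ) m (z ◁ m) (λ r x → term r x (c ≟² z)) Q ⟩
  (if does (c ≟² z) then 1ℚ else 0ℚ) * coeff Q m    ∎
  where
  F : ℚ × Mono (suc n) → ℚ × Mono (suc n)
  F u = 1ℚ * proj₁ u , (Vec.zipWith ℕ._+_ (p ∷ tabulate (λ _ → 0)) (proj₁ (proj₂ u)) , Vec.zipWith ℕ._+_ (q ∷ tabulate (λ _ → 0)) (proj₂ (proj₂ u)))
  x⁺ : Mono n → Mono (suc n)
  x⁺ x = proj₂ (F (1ℚ , (0 , 0) ◁ x))
  exponents : ∀ (x : Mono n) → x⁺ x ≡ c ◁ x
  exponents (xs , ys) = cong₂ _,_ (cong₂ _∷_ (ℕ.+-identityʳ p) (zipWith-zeros xs)) (cong₂ _∷_ (ℕ.+-identityʳ q) (zipWith-zeros ys))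
  ◁-injective : ∀ {c z} {x m : Mono n} → c ◁ x ≡ z ◁ m → c ≡ z × x ≡ m
  ◁-injective refl = refl , refl
  term : ∀ r x (dec : Dec (c ≡ z)) → [ proj₂ (F (r , (0 , 0) ◁ x)) ∶ z ◁ m ] (1ℚ * r) ≡ (if does dec then 1ℚ else 0ℚ) * [ x ∶ m ] r
  term r x dec with x ≟M m
  term r x (yes refl) | yes refl = trans ([]-≡ {m = x⁺ x} {z ◁ m} (1ℚ * r) (exponents x)) (cong (1ℚ *_) (sym ([]-≡ {m = x} r refl)))
  term r x (no c≢z)   | yes refl = trans ([]-≢ {m = x⁺ x} {z ◁ m} (1ℚ * r) λ e → c≢z (proj₁ (◁-injective (trans (sym (exponents x)) e)))) (sym (ℚ.*-zeroˡ ([ x ∶ x ] r)))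
  term r x dec        | no x≢m   = trans ([]-≢ {m = x⁺ x} {z ◁ m} (1ℚ * r) λ e → x≢m (proj₂ (◁-injective (trans (sym (exponents x)) e))))
                                     (sym (*-≡0ʳ (if does dec then 1ℚ else 0ℚ) ([]-≢ {m = x} {m} r x≢m)))

coeff-ΔC : ∀ {n} (c : Cells (suc n)) z m →
           coeff (ΔC c) (z ◁ m) ≡ sum λ j → sign j * ((if does (c j ≟² z) then 1ℚ else 0ℚ) * coeff (ΔC (c ∘ punchIn j)) m)
coeff-ΔC {n} c z m = trans (coeff-sumP (suc n) (λ j → scaleP (sign j) (x j *P minor j)) (z ◁ m)) (sum-cong-≗ λ j →
  trans (coeff-scaleP (sign j) (x j *P minor j) (z ◁ m)) (cong (sign j *_)
    (trans (cong (λ R → coeff (x j *P R) (z ◁ m)) (det-weaken n (λ a b → xyPow a (proj₁ (c (punchIn j b))) (proj₂ (c (punchIn j b))))))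
           (coeff-xyPow-*P (c j) (ΔC (c ∘ punchIn j)) z m))))
  where
  x minor : Fin (suc n) → Poly (suc n)
  x j = xyPow zero (proj₁ (c j)) (proj₂ (c j))
  minor j = det n λ a b → xyPow (suc a) (proj₁ (c (punchIn j b))) (proj₂ (c (punchIn j b)))

-- Both determinants are expanded along the first row. The factorials of variable 0 turn the
-- indicator of `c j ≡ (u , v)` into `δ`, and the remaining factorials scale the minor.
nf-ΔC : ∀ {n} (c : Cells n) m → nf (ΔC c) m ≡ φ c m
nf-ΔC c ([] , []) = trans (cong₂ _*_ ι-1 (ℚ.+-identityʳ 1ℚ)) (ℚ.*-identityˡ 1ℚ)
nf-ΔC {suc n} c (u ∷ us , v ∷ vs) = begin
  F * coeff (ΔC c) ((u , v) ◁ m) ≡⟨ cong (F *_) (coeff-ΔC c (u , v) m) ⟩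
  F * sum (λ j → sign j * (I j * coeff (ΔC (c ∘ punchIn j)) m)) ≡⟨ *-distribˡ-sum F (λ j → sign j * (I j * coeff (ΔC (c ∘ punchIn j)) m)) ⟩
  sum (λ j → F * (sign j * (I j * coeff (ΔC (c ∘ punchIn j)) m))) ≡⟨ sum-cong-≗ term ⟩
  φ c (u ∷ us , v ∷ vs)                                     ∎
  where
  open ℚ-Solver
  m = (us , vs)
  F = facM (u ∷ us , v ∷ vs)
  I : Fin (suc n) → ℚ
  I j = if does (c j ≟² (u , v)) then 1ℚ else 0ℚ
  F≡ : F ≡ ι (u ! ℕ.* v !) * facM m
  F≡ = trans (cong ι (ℕ*.interchange (u !) (fac us) (v !) (fac vs))) (ι-* (u ! ℕ.* v !) (fac us ℕ.* fac vs))
  δ≡ : ∀ j → ι (u ! ℕ.* v !) * I j ≡ δ (c j) u v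
  δ≡ j with does (c j ≟² (u , v))
  ... | true  = ℚ.*-identityʳ (ι (u ! ℕ.* v !))
  ... | false = ℚ.*-zeroʳ (ι (u ! ℕ.* v !))
  term : ∀ j → F * (sign j * (I j * coeff (ΔC (c ∘ punchIn j)) m)) ≡ sign j * (δ (c j) u v * φ (c ∘ punchIn j) m)
  term j = begin
    F * (sign j * (I j * K)) ≡⟨ cong (_* (sign j * (I j * K))) F≡ ⟩
    ι (u ! ℕ.* v !) * facM m * (sign j * (I j * K)) ≡⟨ solve 5 (λ w f s i k → w :* f :* (s :* (i :* k)) := s :* (w :* i :* (f :* k))) refl (ι (u ! ℕ.* v !)) (facM m) (sign j) (I j) K ⟩
    sign j * (ι (u ! ℕ.* v !) * I j * (facM m * K)) ≡⟨ cong₂ (λ x y → sign j * (x * y)) (δ≡ j) (nf-ΔC (c ∘ punchIn j) m) ⟩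
    sign j * (δ (c j) u v * φ (c ∘ punchIn j) m)         ∎
    where K = coeff (ΔC (c ∘ punchIn j)) m

M : ∀ {n} → Cells n → Poly n → Set
M {n} c P = Σ (List (ℚ × Poly n)) λ L → All (λ t → IsDeriv (ΔC c) (proj₂ t)) L ×
            (P ≈P sumP (List.map (λ t → scaleP (proj₁ t) (proj₂ t)) L))

M⇒lincomb : ∀ {n} (c : Cells n) {P} → M c P → Σ (List (ℚ × Mono n)) λ L → ∀ m′ → nf P m′ ≡ lincomb (shift c) L m′
M⇒lincomb c {P} (L , derivs , P≈) = proj₁ (go L derivs) , λ m′ → trans (nf-cong {P = P} {sumP (List.map (λ t → scaleP (proj₁ t) (proj₂ t)) L)} P≈ m′) (proj₂ (go L derivs) m′)
  where
  go : ∀ L → All (λ t → IsDeriv (ΔC c) (proj₂ t)) L →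
       Σ (List (ℚ × Mono _)) λ L′ → ∀ m′ → nf (sumP (List.map (λ t → scaleP (proj₁ t) (proj₂ t)) L)) m′ ≡ lincomb (shift c) L′ m′
  go []            []             = [] , λ m′ → ℚ.*-zeroʳ (facM m′)
  go ((q , Q) ∷ L) (isD ∷ derivs) = let (m , eq) = deriv⇒shift isD ; (L′ , eq′) = go L derivs ; R = sumP (List.map (λ t → scaleP (proj₁ t) (proj₂ t)) L) in
    (q , m) ∷ L′ , λ m′ → begin
      facM m′ * coeff (scaleP q Q ++ R) m′ ≡⟨ cong (facM m′ *_) (trans (coeff-++ (scaleP q Q) R m′) (cong (_+ coeff R m′) (coeff-scaleP q Q m′))) ⟩
      facM m′ * (q * coeff Q m′ + coeff R m′) ≡⟨ solve 4 (λ f q a b → f :* (q :* a :+ b) := q :* (f :* a) :+ f :* b) refl (facM m′) q (coeff Q m′) (coeff R m′) ⟩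
      q * nf Q m′ + nf R m′ ≡⟨ cong₂ (λ x y → q * x + y) (trans (eq m′) (nf-ΔC c (m ⊕ m′))) (eq′ m′) ⟩
      q * shift c m m′ + lincomb (shift c) L′ m′    ∎
    where open ℚ-Solver

shift∈M : ∀ {n} (c : Cells n) m → ∃ λ P → M c P × nf P ≗ shift c m
shift∈M c m = let (P , isD , eq) = shift⇒deriv (ΔC c) m in
  P , ((1ℚ , P) ∷ [] , isD ∷ [] , λ m′ → sym (trans (cong (λ R → coeff R m′) (List.++-identityʳ (scaleP 1ℚ P))) (trans (coeff-scaleP 1ℚ P m′) (ℚ.*-identityˡ (coeff P m′)))))
    , λ m′ → trans (eq m′) (nf-ΔC c (m ⊕ m′))

-- Permutations and characters

distinct-∷⁻ : ∀ {N k} (a : Fin N) (v : Vec (Fin N) k) → Vec.foldr (λ _ → Bool) (λ b r → if does (a Fin.≟ b) then false else r) true v ≡ true →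
              ∀ i → lookup v i ≢ a
distinct-∷⁻ a (b ∷ v) eq i vᵢ≡a with a Fin.≟ b | i
... | no a≢b | zero  = a≢b (sym vᵢ≡a)
... | no a≢b | suc i = distinct-∷⁻ a v eq i vᵢ≡a

distinct-∷⁺ : ∀ {N k} (a : Fin N) (v : Vec (Fin N) k) → (∀ i → lookup v i ≢ a) →
              Vec.foldr (λ _ → Bool) (λ b r → if does (a Fin.≟ b) then false else r) true v ≡ true
distinct-∷⁺ a []      v≢a = refl
distinct-∷⁺ a (b ∷ v) v≢a with a Fin.≟ b
... | yes a≡b = contradiction (sym a≡b) (v≢a zero)
... | no _    = distinct-∷⁺ a v (v≢a ∘ suc)

∧-true : ∀ {a b} → a ∧ b ≡ true → a ≡ true × b ≡ true
∧-true {true} {true} refl = refl , refl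

distinct⇒injective : ∀ {N k} (v : Vec (Fin N) k) → distinct v ≡ true → ∀ {i j} → lookup v i ≡ lookup v j → i ≡ j
distinct⇒injective (a ∷ v) d {zero}  {zero}  eq = refl
distinct⇒injective (a ∷ v) d {zero}  {suc j} eq = contradiction (sym eq) (distinct-∷⁻ a v (proj₁ (∧-true d)) j)
distinct⇒injective (a ∷ v) d {suc i} {zero}  eq = contradiction eq (distinct-∷⁻ a v (proj₁ (∧-true d)) i)
distinct⇒injective (a ∷ v) d {suc i} {suc j} eq = cong suc (distinct⇒injective v (proj₂ (∧-true d)) eq)

injective⇒distinct : ∀ {N k} (v : Vec (Fin N) k) → (∀ {i j} → lookup v i ≡ lookup v j → i ≡ j) → distinct v ≡ true
injective⇒distinct []      inj = refl
injective⇒distinct (a ∷ v) inj = cong₂ _∧_ (distinct-∷⁺ a v λ i eq → Fin.0≢1+n (sym (inj eq))) (injective⇒distinct v (Fin.suc-injective ∘ inj))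

injective⇒surjective : ∀ {n} (f : Fin n → Fin n) → (∀ {i j} → f i ≡ f j → i ≡ j) → ∀ b → ∃ λ a → f a ≡ b
injective⇒surjective {suc n} f inj b with Fin.any? (λ a → f a Fin.≟ b)
... | yes ∃a = ∃a
... | no ∄a  = contradiction (Fin.injective⇒≤ {f = g} g-inj) ℕ.1+n≰n
  where
  b≢ : ∀ a → b ≢ f a
  b≢ a eq = ∄a (a , sym eq)
  g : Fin (suc n) → Fin n
  g a = punchOut (b≢ a)
  g-inj : ∀ {i j} → g i ≡ g j → i ≡ j
  g-inj eq = inj (Fin.punchOut-injective (b≢ _) (b≢ _) eq)

module _ {N} (σ : Perm N) (σ-perm : IsPerm σ) where

  perm-injective : ∀ {i j} → lookup σ i ≡ lookup σ j → i ≡ j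
  perm-injective = distinct⇒injective σ σ-perm

  unperm : Fin N → Fin N
  unperm b = proj₁ (injective⇒surjective (lookup σ) perm-injective b)

  perm-unperm : ∀ b → lookup σ (unperm b) ≡ b
  perm-unperm b = proj₂ (injective⇒surjective (lookup σ) perm-injective b)

  unperm-perm : ∀ a → unperm (lookup σ a) ≡ a
  unperm-perm a = perm-injective (perm-unperm (lookup σ a))

-- For permutations the inverse of `permExp σ`, which moves the exponent at a to σ(a); the
-- coefficients of `act σ P` are those of `P` at pulled back exponents.
pull : ∀ {N} → Perm N → Vec ℕ N → Vec ℕ N
pull σ us = tabulate λ a → lookup us (lookup σ a)

pullM : ∀ {N} → Perm N → Mono N → Mono N
pullM σ (us , vs) = pull σ us , pull σ vs

sum-tabulate-single : ∀ {n} (f : Fin n → ℕ) a → (∀ b → b ≢ a → f b ≡ 0) → ℕL.sum (List.tabulate f) ≡ f a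
sum-tabulate-single f zero f≡0 = trans (cong (f zero ℕ.+_) (zeros (f ∘ suc) λ b → f≡0 (suc b) λ ())) (ℕ.+-identityʳ (f zero))
  where
  zeros : ∀ {n} (f : Fin n → ℕ) → (∀ b → f b ≡ 0) → ℕL.sum (List.tabulate f) ≡ 0
  zeros {zero}  f f≡0 = refl
  zeros {suc n} f f≡0 = cong₂ ℕ._+_ (f≡0 zero) (zeros (f ∘ suc) (f≡0 ∘ suc))
sum-tabulate-single f (suc a) f≡0 = cong₂ ℕ._+_ (f≡0 zero λ ()) (sum-tabulate-single (f ∘ suc) a λ b b≢a → f≡0 (suc b) (b≢a ∘ Fin.suc-injective))

lookup-permExp : ∀ {N} (σ : Perm N) → IsPerm σ → ∀ e a → lookup (permExp σ e) (lookup σ a) ≡ lookup e a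
lookup-permExp {N} σ σ-perm e a = begin
  lookup (permExp σ e) (lookup σ a)       ≡⟨ Vec.lookup∘tabulate _ (lookup σ a) ⟩
  ℕL.sum (List.map f (allFin N))          ≡⟨ cong ℕL.sum (List.map-tabulate id f) ⟩
  ℕL.sum (List.tabulate f) ≡⟨ sum-tabulate-single f a (λ b b≢a → if-no (lookup σ b Fin.≟ lookup σ a) (b≢a ∘ perm-injective σ σ-perm)) ⟩
  f a                                     ≡⟨ if-yes (lookup σ a Fin.≟ lookup σ a) refl ⟩
  lookup e a                              ∎
  where
  f : Fin N → ℕ
  f b = if does (lookup σ b Fin.≟ lookup σ a) then lookup e b else 0

lookup-ext : ∀ {A : Set} {n} {us vs : Vec A n} → (∀ i → lookup us i ≡ lookup vs i) → us ≡ vs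
lookup-ext {us = us} {vs} eq = trans (sym (Vec.tabulate∘lookup us)) (trans (Vec.tabulate-cong eq) (Vec.tabulate∘lookup vs))

pull-permExp : ∀ {N} (σ : Perm N) → IsPerm σ → ∀ e → pull σ (permExp σ e) ≡ e
pull-permExp σ σ-perm e = lookup-ext λ a → trans (Vec.lookup∘tabulate _ a) (lookup-permExp σ σ-perm e a)

permExp-pull : ∀ {N} (σ : Perm N) → IsPerm σ → ∀ us → permExp σ (pull σ us) ≡ us
permExp-pull σ σ-perm us = lookup-ext λ b → subst (λ z → lookup (permExp σ (pull σ us)) z ≡ lookup us z) (perm-unperm σ σ-perm b)
  (trans (lookup-permExp σ σ-perm (pull σ us) (unperm σ σ-perm b)) (Vec.lookup∘tabulate _ (unperm σ σ-perm b)))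

coeff-act : ∀ {N} (σ : Perm N) → IsPerm σ → ∀ P m → coeff (act σ P) m ≡ coeff P (pullM σ m)
coeff-act {N} σ σ-perm P m = trans (coeff-map _ 1ℚ (pullM σ m) m term P) (ℚ.*-identityˡ _)
  where
  permM : Mono N → Mono N
  permM (xs , ys) = permExp σ xs , permExp σ ys
  term : ∀ q x → [ permExp σ (proj₁ x) , permExp σ (proj₂ x) ∶ m ] q ≡ 1ℚ * [ x ∶ pullM σ m ] q
  term q x with x ≟M pullM σ m
  ... | yes refl = trans ([]-≡ {m = permM (pullM σ m)} {m} q (cong₂ _,_ (permExp-pull σ σ-perm (proj₁ m)) (permExp-pull σ σ-perm (proj₂ m))))
                         (sym (trans (ℚ.*-identityˡ _) ([]-≡ {m = pullM σ m} q refl)))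
  ... | no x≢    = trans ([]-≢ {m = permM x} {m} q λ { refl → x≢ (sym (cong₂ _,_ (pull-permExp σ σ-perm (proj₁ x)) (pull-permExp σ σ-perm (proj₂ x)))) })
                         (sym (trans (ℚ.*-identityˡ _) ([]-≢ {m = x} {pullM σ m} q x≢)))

fac≡∏ : ∀ {n} (us : Vec ℕ n) → fac us ≡ ℕ∏.sum (λ a → lookup us a !)
fac≡∏ []       = refl
fac≡∏ (u ∷ us) = cong (u ! ℕ.*_) (fac≡∏ us)

fac-pull : ∀ {N} (σ : Perm N) → IsPerm σ → ∀ us → fac (pull σ us) ≡ fac us
fac-pull σ σ-perm us = begin
  fac (pull σ us)                              ≡⟨ fac≡∏ (pull σ us) ⟩
  ℕ∏.sum (λ a → lookup (pull σ us) a !) ≡⟨ ℕ∏.sum-cong-≗ {x = λ a → lookup (pull σ us) a !} {y = λ a → lookup us (lookup σ a) !} (λ a → cong _! (Vec.lookup∘tabulate _ a)) ⟩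
  ℕ∏.sum (λ a → lookup us (lookup σ a) !) ≡⟨ ℕ∏.sum-permute (λ a → lookup us a !) (permutation (lookup σ) (unperm σ σ-perm) (perm-unperm σ σ-perm) (unperm-perm σ σ-perm)) ⟨
  ℕ∏.sum (λ a → lookup us a !)                 ≡⟨ fac≡∏ us ⟨
  fac us                                       ∎

nf-act : ∀ {N} (σ : Perm N) → IsPerm σ → ∀ P m → nf (act σ P) m ≡ nf P (pullM σ m)
nf-act σ σ-perm P m = cong₂ _*_ (cong ι (sym (cong₂ ℕ._*_ (fac-pull σ σ-perm (proj₁ m)) (fac-pull σ σ-perm (proj₂ m))))) (coeff-act σ σ-perm P m)

HC : ∀ {n} → Cells n → ℕ → ℕ → Poly n → Set
HC c h k P = M c P × Bihom h k P

-- The condition on `m` under which the derivative of Δ of exponent `m` has bidegree (h , k),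
-- written additively to avoid truncated subtraction.
HasBidegree : ∀ {n} → Cells n → ℕ → ℕ → Mono n → Set
HasBidegree c h k m = degx m ℕ.+ h ≡ totx c × degy m ℕ.+ k ≡ toty c

hasBidegree? : ∀ {n} (c : Cells n) h k m → Dec (HasBidegree c h k m)
hasBidegree? c h k m = (degx m ℕ.+ h ℕ.≟ totx c) ×-dec (degy m ℕ.+ k ℕ.≟ toty c)

shift≢0 : ∀ {n} (c : Cells n) m m′ → shift c m m′ ≢ 0ℚ → HasBidegree c (degx m′) (degy m′) m
shift≢0 c m m′ ≢0 = let (x , y) = φ-bihomogeneous c (m ⊕ m′) ≢0 in trans (sym (degx-⊕ m m′)) x , trans (sym (degy-⊕ m m′)) y

indep-nf : ∀ {n d} (b : Fin d → Poly n) → (∀ (a : Fin d → ℚ) → comb a b ≈P zeroP → ∀ i → a i ≡ 0ℚ) → Indep (nf ∘ b)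
indep-nf b ind a vanish = ind a (nf-injective {P = comb a b} {zeroP} λ m → trans (nf-comb a b m) (trans (vanish m) (sym (ℚ.*-zeroʳ (facM m)))))

-- `χ` is given through an unknown basis `b` of the bigraded component. `Trace` carries its trace
-- over to the derivatives `shift c ∘ g`, which span all bidegrees at once; only those of bidegree
-- (h , k) contribute to the diagonal.
character : ∀ {n d} (c : Cells n) (g : Fin d → Mono n) → (∀ m → InSpan (shift c ∘ g) (shift c m)) →
  ∀ h k χ → IsChar (HC c h k) χ → ∀ σ → IsPerm σ →
  Σ (Fin d → Fin d → ℚ) λ mat →
    (χ σ ≡ sum λ i → if does (hasBidegree? c h k (g i)) then mat i i else 0ℚ) ×
    (∀ i → HasBidegree c h k (g i) → ∀ m → shift c (g i) (pullM σ m) ≡ lc (λ i′ → mat i′ i) (shift c ∘ g) m)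
character {n} {d} c g g-span h k χ (d′ , b , (b∈H , b-indep , b-span) , acts) σ σ-perm =
  T.mat , trace , λ i m-i → T.mat-acts i (B≡Qe i m-i)
  where
  Masked : Fin d → Set
  Masked i = HasBidegree c h k (g i)
  masked? : ∀ i → Dec (Masked i)
  masked? i = hasBidegree? c h k (g i)
  B : Fin d → Mono n → ℚ
  B = shift c ∘ g
  e : Fin d′ → Mono n → ℚ
  e = nf ∘ b
  P₀ : ∀ j → InSpan B (e j)
  P₀ j = let (L , eq) = M⇒lincomb c {b j} (proj₁ (b∈H j)) ; (a , eq′) = lincomb∈span (shift c) B g-span L in
         a , λ m → trans (eq m) (eq′ m)
  -- Coordinates at derivatives of another bidegree are set to 0. At exponents of bidegree (h , k)
  -- those derivatives vanish, and at all other exponents both sides vanish.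
  P : Fin d → Fin d′ → ℚ
  P i j = if does (masked? i) then proj₁ (P₀ j) i else 0ℚ
  e≢0 : ∀ j m → e j m ≢ 0ℚ → degx m ≡ h × degy m ≡ k
  e≢0 j m ≢0 = proj₂ (b∈H j) m (*≢0ʳ (facM m) (coeff (b j) m) ≢0)
  e≡Pb : ∀ j m → e j m ≡ lc (λ i → P i j) B m
  e≡Pb j m with (degx m ℕ.≟ h) ×-dec (degy m ℕ.≟ k)
  ... | yes (refl , refl) = trans (proj₂ (P₀ j) m) (sum-cong-≗ λ i → term i (masked? i))
    where
    term : ∀ i (dec : Dec (Masked i)) → proj₁ (P₀ j) i * B i m ≡ (if does dec then proj₁ (P₀ j) i else 0ℚ) * B i m
    term i (yes _) = refl
    term i (no ¬m) = trans (cong (proj₁ (P₀ j) i *_) B≡0) (trans (ℚ.*-zeroʳ (proj₁ (P₀ j) i)) (sym (ℚ.*-zeroˡ (B i m))))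
      where
      B≡0 : B i m ≡ 0ℚ
      B≡0 = ¬⇒≡0 λ ≢0 → ¬m (shift≢0 c (g i) m ≢0)
  ... | no ¬deg = trans (¬⇒≡0 (λ ≢0 → ¬deg (e≢0 j m ≢0))) (sym (sum-zero _ λ i → term i (masked? i)))
    where
    term : ∀ i (dec : Dec (Masked i)) → (if does dec then proj₁ (P₀ j) i else 0ℚ) * B i m ≡ 0ℚ
    term i (no _)          = ℚ.*-zeroˡ (B i m)
    term i (yes (mx , my)) = trans (cong (proj₁ (P₀ j) i *_) (¬⇒≡0 λ ≢0 → let (x , y) = shift≢0 c (g i) m ≢0 in
      ¬deg (ℕ.+-cancelˡ-≡ (degx (g i)) _ _ (trans x (sym mx)) , ℕ.+-cancelˡ-≡ (degy (g i)) _ _ (trans y (sym my))))) (ℚ.*-zeroʳ (proj₁ (P₀ j) i))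
  B∈H : ∀ i → HasBidegree c h k (g i) → HC c h k (proj₁ (shift∈M c (g i)))
  B∈H i (mx , my) = let (R , R∈M , nfR≡) = shift∈M c (g i) in R∈M , λ m ≢0 →
    let (x , y) = shift≢0 c (g i) m (λ B≡0 → ≢0 (*-cancel-≡0 (facM m) (coeff R m) (facM-≢0 m) (trans (nfR≡ m) B≡0))) in
    ℕ.+-cancelˡ-≡ (degx (g i)) _ _ (trans x (sym mx)) , ℕ.+-cancelˡ-≡ (degy (g i)) _ _ (trans y (sym my))
  -- Derivatives of bidegree (h , k) belong to the component and have coordinates in `b`; the
  -- default 0 for the others always meets a zero entry of `P`.
  Q-at : ∀ i → Dec (Masked i) → Fin d′ → ℚ
  Q-at i (yes m-i) = proj₁ (b-span (proj₁ (shift∈M c (g i))) (B∈H i m-i))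
  Q-at i (no _)    = λ _ → 0ℚ
  Q : Fin d′ → Fin d → ℚ
  Q j i = Q-at i (masked? i) j
  B≡Qe : ∀ i → HasBidegree c h k (g i) → ∀ m → B i m ≡ lc (λ j → Q j i) e m
  B≡Qe i m-i m = at (masked? i)
    where
    at : ∀ dec → B i m ≡ lc (Q-at i dec) e m
    at (no ¬m)  = contradiction m-i ¬m
    at (yes m′) = let (R , R∈M , nfR≡) = shift∈M c (g i) ; (a , R≈) = b-span R (B∈H i m′) in
      trans (sym (nfR≡ m)) (nf-≈comb R a b R≈ m)
  e≡PQe : ∀ l m → e l m ≡ sum λ i → P i l * lc (λ j → Q j i) e m
  e≡PQe l m = trans (e≡Pb l m) (sum-cong-≗ λ i → term i (masked? i))
    where
    term : ∀ i (dec : Dec (Masked i)) →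
           (if does dec then proj₁ (P₀ l) i else 0ℚ) * B i m ≡ (if does dec then proj₁ (P₀ l) i else 0ℚ) * lc (λ j → Q j i) e m
    term i (yes m-i) = cong (proj₁ (P₀ l) i *_) (B≡Qe i m-i m)
    term i (no _)    = trans (ℚ.*-zeroˡ (B i m)) (sym (ℚ.*-zeroˡ (lc (λ j → Q j i) e m)))
  a : Fin d′ → Fin d′ → ℚ
  a = proj₁ (acts σ σ-perm)
  Te≡ae : ∀ j m → e j (pullM σ m) ≡ lc (λ l → a l j) e m
  Te≡ae j m = trans (sym (nf-act σ σ-perm (b j) m)) (nf-≈comb (act σ (b j)) (λ i → a i j) b (proj₁ (proj₂ (acts σ σ-perm)) j) m)
  module T = Trace (pullM σ) e (indep-nf b b-indep) B P e≡Pb Q e≡PQe a Te≡ae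
  trace : χ σ ≡ sum λ i → if does (masked? i) then T.mat i i else 0ℚ
  trace = begin
    χ σ                       ≡⟨ proj₂ (proj₂ (acts σ σ-perm)) ⟩
    ΣF d′ (λ i → a i i)       ≡⟨ ΣF≡sum d′ (λ i → a i i) ⟩
    sum (λ i → a i i)         ≡⟨ T.trace ⟩
    sum (λ i → T.mat i i)     ≡⟨ sum-cong-≗ (λ i → term i (masked? i)) ⟩
    sum (λ i → if does (masked? i) then T.mat i i else 0ℚ) ∎
    where
    term : ∀ i (dec : Dec (Masked i)) → T.mat i i ≡ (if does dec then T.mat i i else 0ℚ)
    term i (yes _) = refl
    term i (no ¬m) = sum-zero _ λ l → *-≡0ˡ (sum λ j → a l j * Q j i) (if-no (masked? i) ¬m)

-- Cycle types

steps : ∀ {N} → Perm N → Fin N → ℕ → ℕ → Fin N → ℕ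
steps σ i zero    k j = k
steps σ i (suc f) k j = if does (j Fin.≟ i) then k else steps σ i f (suc k) (lookup σ j)

-- The local function of orbitLen cannot be named here; the wildcard in the type of steps-eq is solved
-- to it, once the index and the fuel have been abstracted into distinct variables.
mutual
  orbitLen≡steps : ∀ {N} (σ : Perm N) i → orbitLen σ i ≡ steps σ i N 1 (lookup σ i)
  orbitLen≡steps {suc n} σ i with does (lookup σ i Fin.≟ i)
  ... | true = refl
  ... | false with suc n | σ | i | lookup σ (lookup σ i) | 2
  ...   | N | σ′ | i′ | j | k = steps-eq N n σ′ i′ j k

  steps-eq : ∀ N f (σ : Perm N) i (j : Fin N) k → _ ≡ steps σ i f k j
  steps-eq N zero    σ i j k = refl
  steps-eq N (suc f) σ i j k with does (j Fin.≟ i)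
  ... | true  = refl
  ... | false = steps-eq N f σ i (lookup σ j) (suc k)

steps-map : ∀ {N N′} (t : Fin N → Fin N′) → (∀ {i j} → t i ≡ t j → i ≡ j) → (σ : Perm N) (σ′ : Perm N′) →
            (∀ j → lookup σ′ (t j) ≡ t (lookup σ j)) → ∀ i f k j → steps σ′ (t i) f k (t j) ≡ steps σ i f k j
steps-map t t-inj σ σ′ σ′t≡tσ i zero    k j = refl
steps-map t t-inj σ σ′ σ′t≡tσ i (suc f) k j = begin
  (if does (t j Fin.≟ t i) then k else steps σ′ (t i) f (suc k) (lookup σ′ (t j)))
    ≡⟨ cong₂ (λ b z → if b then k else z) (does-⇔ (mk⇔ t-inj (cong t)) (t j Fin.≟ t i) (j Fin.≟ i))
         (trans (cong (steps σ′ (t i) f (suc k)) (σ′t≡tσ j)) (steps-map t t-inj σ σ′ σ′t≡tσ i f (suc k) (lookup σ j))) ⟩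
  (if does (j Fin.≟ i) then k else steps σ i f (suc k) (lookup σ j)) ∎

steps-≥ : ∀ {N} (σ : Perm N) i f k j → k ≤ steps σ i f k j
steps-≥ σ i zero    k j = ℕ.≤-refl
steps-≥ σ i (suc f) k j with does (j Fin.≟ i)
... | true  = ℕ.≤-refl
... | false = ℕ.≤-trans (ℕ.n≤1+n k) (steps-≥ σ i f (suc k) (lookup σ j))

iterate : ∀ {N} → Perm N → ℕ → Fin N → Fin N
iterate σ zero    j = j
iterate σ (suc r) j = iterate σ r (lookup σ j)

-- `orbitLen` takes its fuel from the number of points, so passing from τ to `ext τ` adds one unit.
-- This changes nothing once the orbit is known to close before the fuel runs out.
steps-hit : ∀ {N} (σ : Perm N) i f k j r → r < f → iterate σ r j ≡ i →
            steps σ i (suc f) k j ≡ steps σ i f k j × steps σ i f k j ≤ k ℕ.+ r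
steps-hit σ i (suc f) k j r r<f hit with j Fin.≟ i
... | yes _ = refl , ℕ.m≤m+n k r
steps-hit σ i (suc f) k j zero    r<f       hit | no j≢i = contradiction hit j≢i
steps-hit σ i (suc f) k j (suc r) (s≤s r<f) hit | no j≢i with steps-hit σ i f (suc k) (lookup σ j) r r<f hit
... | eq , le = eq , ℕ.≤-trans le (ℕ.≤-reflexive (sym (ℕ.+-suc k r)))

iterate-lookup : ∀ {N} (σ : Perm N) r j → iterate σ r (lookup σ j) ≡ lookup σ (iterate σ r j)
iterate-lookup σ zero    j = refl
iterate-lookup σ (suc r) j = iterate-lookup σ r (lookup σ j)

iterate-cancel : ∀ {N} (σ : Perm N) → IsPerm σ → ∀ r s i → iterate σ r i ≡ iterate σ (r ℕ.+ s) i → i ≡ iterate σ s i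
iterate-cancel σ σ-perm zero    s i eq = eq
iterate-cancel σ σ-perm (suc r) s i eq = iterate-cancel σ σ-perm r s i (perm-injective σ σ-perm
  (trans (sym (iterate-lookup σ r i)) (trans eq (iterate-lookup σ (r ℕ.+ s) i))))

-- Among the iterates of `i` with exponents 0 to n two agree by the pigeonhole principle;
-- injectivity cancels the smaller exponent, and what is left is the return time `suc r`.
returns : ∀ {n} (σ : Perm n) → IsPerm σ → ∀ i → ∃ λ r → r < n × iterate σ r (lookup σ i) ≡ i
returns {n} σ σ-perm i with Fin.pigeonhole (ℕ.n<1+n n) (λ a → iterate σ (toℕ a) i)
... | a , b , a<b , eq with ℕ.m≤n⇒∃[o]m+o≡n a<b
... | r , 1+a+r≡b = r , r<n , sym (iterate-cancel σ σ-perm (toℕ a) (suc r) i (trans eq (cong (λ z → iterate σ z i) (sym (trans (ℕ.+-suc (toℕ a) r) 1+a+r≡b)))))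
  where
  r<n : r < n
  r<n = ℕ.≤-pred (ℕ.≤-trans (s≤s (ℕ.≤-trans (s≤s (ℕ.m≤n+m r (toℕ a))) (ℕ.≤-reflexive 1+a+r≡b))) (Fin.toℕ<n b))

ext : ∀ {n} → Perm n → Perm (suc n)
ext τ = zero ∷ Vec.map suc τ

lookup-ext-suc : ∀ {n} (τ : Perm n) i → lookup (ext τ) (suc i) ≡ suc (lookup τ i)
lookup-ext-suc τ i = Vec.lookup-map i suc τ

orbitLen-ext-suc : ∀ {n} (τ : Perm n) → IsPerm τ → ∀ i →
                   orbitLen (ext τ) (suc i) ≡ orbitLen τ i × orbitLen τ i ≤ n
orbitLen-ext-suc {n} τ τ-perm i with returns τ τ-perm i
... | r , r<n , hit with steps-hit τ i n 1 (lookup τ i) r r<n hit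
... | fuel , bound =
  (begin
    orbitLen (ext τ) (suc i) ≡⟨ orbitLen≡steps (ext τ) (suc i) ⟩
    steps (ext τ) (suc i) (suc n) 1 (lookup (ext τ) (suc i)) ≡⟨ cong (steps (ext τ) (suc i) (suc n) 1) (lookup-ext-suc τ i) ⟩
    steps (ext τ) (suc i) (suc n) 1 (suc (lookup τ i)) ≡⟨ steps-map suc Fin.suc-injective τ (ext τ) (lookup-ext-suc τ) i (suc n) 1 (lookup τ i) ⟩
    steps τ i (suc n) 1 (lookup τ i)                          ≡⟨ fuel ⟩
    steps τ i n 1 (lookup τ i)                                ≡⟨ orbitLen≡steps τ i ⟨
    orbitLen τ i                                              ∎) ,
  ℕ.≤-trans (ℕ.≤-reflexive (orbitLen≡steps τ i)) (ℕ.≤-trans bound r<n)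

does-orbitLen≡1 : ∀ {n} (σ : Perm (suc n)) i → does (orbitLen σ i ℕ.≟ 1) ≡ does (lookup σ i Fin.≟ i)
does-orbitLen≡1 {n} σ i rewrite orbitLen≡steps σ i with does (lookup σ i Fin.≟ i)
... | true  = refl
... | false = dec-false (steps σ i n 2 (lookup σ (lookup σ i)) ℕ.≟ 1) λ eq → ℕ.<-irrefl (sym eq) (steps-≥ σ i n 2 (lookup σ (lookup σ i)))

bit : Bool → ℕ
bit b = if b then 1 else 0

count : ∀ {N} → (Fin N → Bool) → ℕ
count p = ℕ∑.sum (bit ∘ p)

count≡length : ∀ {N} (p : Fin N → Bool) → List.length (List.filterᵇ p (allFin N)) ≡ count p
count≡length {N} p = go id
  where
  go : ∀ {n} (f : Fin n → Fin N) → List.length (List.filterᵇ p (List.tabulate f)) ≡ count (p ∘ f)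
  go {zero}  f = refl
  go {suc n} f with p (f zero)
  ... | true  = cong suc (go (f ∘ suc))
  ... | false = go (f ∘ suc)

count-cong : ∀ {N} {f g : Fin N → ℕ} L → f ≗ g → count (λ i → does (f i ℕ.≟ L)) ≡ count (λ i → does (g i ℕ.≟ L))
count-cong {f = f} {g} L f≗g = ℕ∑.sum-cong-≗ {x = λ i → bit (does (f i ℕ.≟ L))} {y = λ i → bit (does (g i ℕ.≟ L))} λ i → cong (λ z → bit (does (z ℕ.≟ L))) (f≗g i)

-- Counts the points on cycles of length `L`, not the cycles; `parts` therefore divides by the
-- length.
orbits : ∀ {N} → Perm N → ℕ → ℕ
orbits {N} σ L = List.length (List.filterᵇ (λ i → does (orbitLen σ i ℕ.≟ L)) (allFin N))

parts : (ℕ → ℕ) → ℕ → List ℕ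
parts cnt l = List.replicate (cnt (suc l) ℕ./ suc l) (suc l)

orbits-ext-1 : ∀ {n} (τ : Perm n) → IsPerm τ → orbits (ext τ) 1 ≡ suc (orbits τ 1)
orbits-ext-1 τ τ-perm = trans (count≡length (λ i → does (orbitLen (ext τ) i ℕ.≟ 1)))
  (cong suc (trans (count-cong 1 (proj₁ ∘ orbitLen-ext-suc τ τ-perm)) (sym (count≡length λ i → does (orbitLen τ i ℕ.≟ 1)))))

orbits-ext-≥2 : ∀ {n} (τ : Perm n) → IsPerm τ → ∀ l → orbits (ext τ) (suc (suc l)) ≡ orbits τ (suc (suc l))
orbits-ext-≥2 τ τ-perm l = trans (count≡length (λ i → does (orbitLen (ext τ) i ℕ.≟ suc (suc l))))
  (trans (count-cong (suc (suc l)) (proj₁ ∘ orbitLen-ext-suc τ τ-perm)) (sym (count≡length λ i → does (orbitLen τ i ℕ.≟ suc (suc l)))))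

orbits-> : ∀ {n} (τ : Perm n) → IsPerm τ → orbits τ (suc n) ≡ 0
orbits-> {n} τ τ-perm = trans (count≡length (λ i → does (orbitLen τ i ℕ.≟ suc n)))
  (trans (ℕ∑.sum-cong-≗ {x = λ i → bit (does (orbitLen τ i ℕ.≟ suc n))} {y = λ _ → 0}
    (λ i → cong bit (dec-false (orbitLen τ i ℕ.≟ suc n) λ eq → ℕ.<-irrefl eq (s≤s (proj₂ (orbitLen-ext-suc τ τ-perm i)))))) (ℕ∑.sum-replicate-zero n))

replicate-∷ʳ : ∀ {A : Set} k (x : A) → List.replicate (suc k) x ≡ List.replicate k x ++ x ∷ []
replicate-∷ʳ zero    x = refl
replicate-∷ʳ (suc k) x = cong (x ∷_) (replicate-∷ʳ k x)

concatMap-parts-∷ʳ : ∀ cnt cnt′ → cnt 1 ≡ suc (cnt′ 1) → (∀ l → cnt (suc (suc l)) ≡ cnt′ (suc (suc l))) → ∀ k →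
  List.concatMap (parts cnt) (List.downFrom (suc k)) ≡ List.concatMap (parts cnt′) (List.downFrom (suc k)) ++ 1 ∷ []
concatMap-parts-∷ʳ cnt cnt′ eq₁ eq₂ zero = begin
  List.replicate (cnt 1 ℕ./ 1) 1 ++ []           ≡⟨ List.++-identityʳ _ ⟩
  List.replicate (cnt 1 ℕ./ 1) 1 ≡⟨ cong (λ z → List.replicate z 1) (trans (n/1≡n (cnt 1)) eq₁) ⟩
  List.replicate (suc (cnt′ 1)) 1                ≡⟨ replicate-∷ʳ (cnt′ 1) 1 ⟩
  List.replicate (cnt′ 1) 1 ++ 1 ∷ [] ≡⟨ cong (λ z → List.replicate z 1 ++ 1 ∷ []) (n/1≡n (cnt′ 1)) ⟨
  List.replicate (cnt′ 1 ℕ./ 1) 1 ++ 1 ∷ [] ≡⟨ cong (_++ 1 ∷ []) (List.++-identityʳ (List.replicate (cnt′ 1 ℕ./ 1) 1)) ⟨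
  (List.replicate (cnt′ 1 ℕ./ 1) 1 ++ []) ++ 1 ∷ [] ∎
concatMap-parts-∷ʳ cnt cnt′ eq₁ eq₂ (suc k) = trans
  (cong₂ (λ z w → List.replicate (z ℕ./ suc (suc k)) (suc (suc k)) ++ w) (eq₂ k) (concatMap-parts-∷ʳ cnt cnt′ eq₁ eq₂ k))
  (sym (List.++-assoc (parts cnt′ (suc k)) (List.concatMap (parts cnt′) (List.downFrom (suc k))) (1 ∷ [])))

-- `ext` adds one fixed point and keeps all other orbit lengths. The additional length that
-- `cycleType` tests for `ext τ` exceeds the number of points of `τ` and does not occur; the new
-- part 1 stands at the end because larger parts are listed first.
cycleType-ext : ∀ {n} (τ : Perm (suc n)) → IsPerm τ → cycleType (ext τ) ≡ cycleType τ ++ 1 ∷ []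
cycleType-ext {n} τ τ-perm = begin
  parts (orbits (ext τ)) (suc n) ++ rest
    ≡⟨ cong (λ z → List.replicate (z ℕ./ suc (suc n)) (suc (suc n)) ++ rest) (trans (orbits-ext-≥2 τ τ-perm n) (orbits-> τ τ-perm)) ⟩
  rest
    ≡⟨ concatMap-parts-∷ʳ (orbits (ext τ)) (orbits τ) (orbits-ext-1 τ τ-perm) (orbits-ext-≥2 τ τ-perm) n ⟩
  cycleType τ ++ 1 ∷ [] ∎
  where rest = List.concatMap (parts (orbits (ext τ))) (List.downFrom (suc n))

ones : List ℕ → ℕ
ones lam = List.length (List.filterᵇ (λ n → does (n ℕ.≟ 1)) lam)

ones-++ : ∀ xs ys → ones (xs ++ ys) ≡ ones xs ℕ.+ ones ys
ones-++ xs ys = trans (cong List.length (List.filter-++ (λ n → T? (does (n ℕ.≟ 1))) xs ys)) (List.length-++ (List.filterᵇ (λ n → does (n ℕ.≟ 1)) xs))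

ones-replicate-1 : ∀ k → ones (List.replicate k 1) ≡ k
ones-replicate-1 zero    = refl
ones-replicate-1 (suc k) = cong suc (ones-replicate-1 k)

ones-replicate-≥2 : ∀ k l → ones (List.replicate k (suc (suc l))) ≡ 0
ones-replicate-≥2 zero    l = refl
ones-replicate-≥2 (suc k) l = ones-replicate-≥2 k l

ones-parts : ∀ cnt k → ones (List.concatMap (parts cnt) (List.downFrom (suc k))) ≡ cnt 1
ones-parts cnt zero    = trans (ones-++ (parts cnt 0) []) (trans (ℕ.+-identityʳ _) (trans (ones-replicate-1 (cnt 1 ℕ./ 1)) (n/1≡n (cnt 1))))
ones-parts cnt (suc k) = trans (ones-++ (parts cnt (suc k)) (List.concatMap (parts cnt) (List.downFrom (suc k))))
  (cong₂ ℕ._+_ (ones-replicate-≥2 (cnt (suc (suc k)) ℕ./ suc (suc k)) k) (ones-parts cnt k))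

ones-cycleType : ∀ {n} (σ : Perm (suc n)) → ones (cycleType σ) ≡ count λ i → does (lookup σ i Fin.≟ i)
ones-cycleType {n} σ = trans (ones-parts (orbits σ) n) (trans (count≡length (λ i → does (orbitLen σ i ℕ.≟ 1)))
  (ℕ∑.sum-cong-≗ {x = λ i → bit (does (orbitLen σ i ℕ.≟ 1))} {y = λ i → bit (does (lookup σ i Fin.≟ i))} λ i → cong bit (does-orbitLen≡1 σ i)))

-- An involution is enough, since the conjugations to be made are by transpositions of 0 with
-- another point.
module Conjugation {N} (t : Fin N → Fin N) (t-involutive : ∀ i → t (t i) ≡ i) where

  t-injective : ∀ {i j} → t i ≡ t j → i ≡ j
  t-injective {i} {j} eq = trans (sym (t-involutive i)) (trans (cong t eq) (t-involutive j))

  conj : Perm N → Perm N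
  conj σ = tabulate λ i → t (lookup σ (t i))

  lookup-conj : ∀ σ i → lookup (conj σ) i ≡ t (lookup σ (t i))
  lookup-conj σ i = Vec.lookup∘tabulate _ i

  conj-involutive : ∀ σ → conj (conj σ) ≡ σ
  conj-involutive σ = lookup-ext λ i → begin
    lookup (conj (conj σ)) i          ≡⟨ lookup-conj (conj σ) i ⟩
    t (lookup (conj σ) (t i))         ≡⟨ cong t (lookup-conj σ (t i)) ⟩
    t (t (lookup σ (t (t i))))        ≡⟨ t-involutive _ ⟩
    lookup σ (t (t i))                ≡⟨ cong (lookup σ) (t-involutive i) ⟩
    lookup σ i                        ∎

  conj-perm : ∀ σ → IsPerm σ → IsPerm (conj σ)
  conj-perm σ σ-perm = injective⇒distinct (conj σ) λ {i} {j} eq →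
    t-injective (perm-injective σ σ-perm (t-injective (trans (sym (lookup-conj σ i)) (trans eq (lookup-conj σ j)))))

  orbitLen-conj : ∀ σ i → orbitLen (conj σ) (t i) ≡ orbitLen σ i
  orbitLen-conj σ i = begin
    orbitLen (conj σ) (t i) ≡⟨ orbitLen≡steps (conj σ) (t i) ⟩
    steps (conj σ) (t i) N 1 (lookup (conj σ) (t i)) ≡⟨ cong (steps (conj σ) (t i) N 1) (along i) ⟩
    steps (conj σ) (t i) N 1 (t (lookup σ i)) ≡⟨ steps-map t t-injective σ (conj σ) along i N 1 (lookup σ i) ⟩
    steps σ i N 1 (lookup σ i)                           ≡⟨ orbitLen≡steps σ i ⟨
    orbitLen σ i                                         ∎
    where
    along : ∀ j → lookup (conj σ) (t j) ≡ t (lookup σ j)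
    along j = trans (lookup-conj σ (t j)) (cong (t ∘ lookup σ) (t-involutive j))

  orbits-conj : ∀ σ L → orbits (conj σ) L ≡ orbits σ L
  orbits-conj σ L = begin
    orbits (conj σ) L ≡⟨ count≡length (λ i → does (orbitLen (conj σ) i ℕ.≟ L)) ⟩
    count (λ i → does (orbitLen (conj σ) i ℕ.≟ L)) ≡⟨ ℕ∑.sum-permute (λ i → bit (does (orbitLen (conj σ) i ℕ.≟ L))) (permutation t t t-involutive t-involutive) ⟩
    count (λ i → does (orbitLen (conj σ) (t i) ℕ.≟ L)) ≡⟨ count-cong L (orbitLen-conj σ) ⟩
    count (λ i → does (orbitLen σ i ℕ.≟ L)) ≡⟨ count≡length (λ i → does (orbitLen σ i ℕ.≟ L)) ⟨
    orbits σ L                                                ∎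

  cycleType-conj : ∀ σ → cycleType (conj σ) ≡ cycleType σ
  cycleType-conj σ = cong List.concat (List.map-cong (λ l → cong (λ z → List.replicate (z ℕ./ suc l) (suc l)) (orbits-conj σ (suc l))) (List.downFrom N))

-- Sums over the symmetric group; characters as class functions

listSum : ∀ {A : Set} → (A → ℚ) → List A → ℚ
listSum f xs = sumℚ (List.map f xs)

listSum-cong-∈ : ∀ {A : Set} {f g : A → ℚ} xs → (∀ x → x ∈ xs → f x ≡ g x) → listSum f xs ≡ listSum g xs
listSum-cong-∈ []       eq = refl
listSum-cong-∈ (x ∷ xs) eq = cong₂ _+_ (eq x (here refl)) (listSum-cong-∈ xs λ y y∈ → eq y (there y∈))

listSum-sum : ∀ {A : Set} {n} (F : Fin n → A → ℚ) xs → listSum (λ x → sum λ i → F i x) xs ≡ sum λ i → listSum (F i) xs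
listSum-sum F []       = sym (sum-zero _ λ i → refl)
listSum-sum F (x ∷ xs) = trans (cong (sum (λ i → F i x) +_) (listSum-sum F xs)) (sym (∑-distrib-+ (λ i → F i x) (λ i → listSum (F i) xs)))

listSum-*ˡ : ∀ {A : Set} q (f : A → ℚ) xs → q * listSum f xs ≡ listSum (λ x → q * f x) xs
listSum-*ˡ q f []       = ℚ.*-zeroʳ q
listSum-*ˡ q f (x ∷ xs) = trans (ℚ.*-distribˡ-+ q (f x) (listSum f xs)) (cong (q * f x +_) (listSum-*ˡ q f xs))

listSum-filter : ∀ {A : Set} (f : A → ℚ) (p : A → Bool) xs → listSum f (List.filterᵇ p xs) ≡ listSum (λ x → if p x then f x else 0ℚ) xs
listSum-filter f p []       = refl
listSum-filter f p (x ∷ xs) with p x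
... | true  = cong (f x +_) (listSum-filter f p xs)
... | false = trans (listSum-filter f p xs) (sym (ℚ.+-identityˡ _))

listSum-map : ∀ {A B : Set} (f : B → ℚ) (g : A → B) xs → listSum f (List.map g xs) ≡ listSum (f ∘ g) xs
listSum-map f g xs = cong sumℚ (sym (List.map-∘ xs))

listSum-↭ : ∀ {A : Set} (f : A → ℚ) {xs ys} → xs ↭ ys → listSum f xs ≡ listSum f ys
listSum-↭ f _↭_.refl            = refl
listSum-↭ f (_↭_.prep x p)      = cong (f x +_) (listSum-↭ f p)
listSum-↭ f {_ ∷ _ ∷ xs} (_↭_.swap x y p) = trans (cong (λ z → f x + (f y + z)) (listSum-↭ f p)) (solve 3 (λ x y z → x :+ (y :+ z) := y :+ (x :+ z)) refl (f x) (f y) _)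
  where open ℚ-Solver
listSum-↭ f (_↭_.trans p q)     = trans (listSum-↭ f p) (listSum-↭ f q)

unique⇒↭ : ∀ {A : Set} {xs ys : List A} → Unique xs → Unique ys → (∀ {x} → x ∈ xs → x ∈ ys) → (∀ {x} → x ∈ ys → x ∈ xs) → xs ↭ ys
unique⇒↭ uxs uys to from = ∼bag⇒↭ (unique∧set⇒bag uxs uys (mk⇔ to from))

T-does⇒ : ∀ {P : Set} (P? : Dec P) → T (does P?) → P
T-does⇒ (yes p) _ = p

∈-allVecs : ∀ N k (v : Vec (Fin N) k) → v ∈ allVecs N k
∈-allVecs N zero    []      = here refl
∈-allVecs N (suc k) (a ∷ v) = ∈-cartesianProductWith⁺ Vec._∷_ (∈-allFin a) (∈-allVecs N k v)

allVecs-unique : ∀ N k → Unique (allVecs N k)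
allVecs-unique N zero    = [] ∷ []
allVecs-unique N (suc k) = Unique.cartesianProductWith⁺ Vec._∷_ (λ { refl → refl , refl }) (Unique.allFin⁺ N) (allVecs-unique N k)

∈-perms⁺ : ∀ {N} {σ : Perm N} → IsPerm σ → σ ∈ perms N
∈-perms⁺ {N} {σ} σ-perm = ∈-filter⁺ (T? ∘ distinct) (∈-allVecs N N σ) (Equivalence.from T-≡ σ-perm)

∈-perms⁻ : ∀ {N} {σ : Perm N} → σ ∈ perms N → IsPerm σ
∈-perms⁻ {N} σ∈ = Equivalence.to T-≡ (proj₂ (∈-filter⁻ (T? ∘ distinct) {xs = allVecs N N} σ∈))

perms-unique : ∀ N → Unique (perms N)
perms-unique N = Unique.filter⁺ (T? ∘ distinct) (allVecs-unique N N)

listSum-conj : ∀ {N} (t : Fin N → Fin N) (t-inv : ∀ i → t (t i) ≡ i) (f : Perm N → ℚ) →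
               listSum f (perms N) ≡ listSum (f ∘ Conjugation.conj t t-inv) (perms N)
listSum-conj {N} t t-inv f = trans (listSum-↭ f (unique⇒↭ (perms-unique N) (Unique.map⁺ conj-injective (perms-unique N)) to from)) (listSum-map f conj (perms N))
  where
  open Conjugation t t-inv
  conj-injective : ∀ {σ τ} → conj σ ≡ conj τ → σ ≡ τ
  conj-injective {σ} {τ} eq = trans (sym (conj-involutive σ)) (trans (cong conj eq) (conj-involutive τ))
  to : ∀ {σ} → σ ∈ perms N → σ ∈ List.map conj (perms N)
  to {σ} σ∈ = subst (_∈ List.map conj (perms N)) (conj-involutive σ) (∈-map⁺ conj (∈-perms⁺ {σ = conj σ} (conj-perm σ (∈-perms⁻ σ∈))))
  from : ∀ {σ} → σ ∈ List.map conj (perms N) → σ ∈ perms N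
  from σ∈ with ∈-map⁻ conj σ∈
  ... | τ , τ∈ , refl = ∈-perms⁺ (conj-perm τ (∈-perms⁻ τ∈))

ext-perm : ∀ {n} (τ : Perm n) → IsPerm τ → IsPerm (ext τ)
ext-perm τ τ-perm = injective⇒distinct (ext τ) inj
  where
  inj : ∀ {i j} → lookup (ext τ) i ≡ lookup (ext τ) j → i ≡ j
  inj {zero}  {zero}  eq = refl
  inj {zero}  {suc j} eq = contradiction (trans eq (lookup-ext-suc τ j)) λ ()
  inj {suc i} {zero}  eq = contradiction (trans (sym eq) (lookup-ext-suc τ i)) λ ()
  inj {suc i} {suc j} eq = cong suc (perm-injective τ τ-perm (Fin.suc-injective (trans (sym (lookup-ext-suc τ i)) (trans eq (lookup-ext-suc τ j)))))

ext-injective : ∀ {n} {τ τ′ : Perm n} → ext τ ≡ ext τ′ → τ ≡ τ′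
ext-injective {τ = τ} {τ′} eq = lookup-ext λ i → Fin.suc-injective (trans (sym (lookup-ext-suc τ i)) (trans (cong (λ z → lookup z (suc i)) eq) (lookup-ext-suc τ′ i)))

ext-surjective : ∀ {n} (σ : Perm (suc n)) → IsPerm σ → lookup σ zero ≡ zero → ∃ λ τ → IsPerm τ × σ ≡ ext τ
ext-surjective {n} σ σ-perm σ0≡0 = τ , τ-perm , lookup-ext pointwise
  where
  0≢ : ∀ i → zero ≢ lookup σ (suc i)
  0≢ i eq = Fin.0≢1+n (perm-injective σ σ-perm (trans σ0≡0 eq))
  τ : Perm n
  τ = tabulate λ i → punchOut (0≢ i)
  suc-τ : ∀ i → suc (lookup τ i) ≡ lookup σ (suc i)
  suc-τ i = trans (cong suc (Vec.lookup∘tabulate _ i)) (Fin.punchIn-punchOut (0≢ i))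
  τ-perm : IsPerm τ
  τ-perm = injective⇒distinct τ λ {i} {j} eq → Fin.suc-injective (perm-injective σ σ-perm (trans (sym (suc-τ i)) (trans (cong suc eq) (suc-τ j))))
  pointwise : ∀ i → lookup σ i ≡ lookup (ext τ) i
  pointwise zero    = σ0≡0
  pointwise (suc i) = trans (sym (suc-τ i)) (sym (lookup-ext-suc τ i))

-- `ext` is a bijection from the smaller symmetric group onto the stabiliser of 0.
listSum-ext : ∀ {n} (f : Perm (suc n) → ℚ) →
  listSum (λ σ → if does (lookup σ zero Fin.≟ zero) then f σ else 0ℚ) (perms (suc n)) ≡ listSum (f ∘ ext) (perms n)
listSum-ext {n} f = begin
  listSum (λ σ → if fixes0 σ then f σ else 0ℚ) (perms (suc n)) ≡⟨ listSum-filter f fixes0 (perms (suc n)) ⟨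
  listSum f (List.filterᵇ fixes0 (perms (suc n))) ≡⟨ listSum-↭ f (unique⇒↭ (Unique.filter⁺ (T? ∘ fixes0) (perms-unique (suc n))) (Unique.map⁺ ext-injective (perms-unique n)) to from) ⟩
  listSum f (List.map ext (perms n)) ≡⟨ listSum-map f ext (perms n) ⟩
  listSum (f ∘ ext) (perms n)                                     ∎
  where
  fixes0 : Perm (suc n) → Bool
  fixes0 σ = does (lookup σ zero Fin.≟ zero)
  to : ∀ {σ} → σ ∈ List.filterᵇ fixes0 (perms (suc n)) → σ ∈ List.map ext (perms n)
  to {σ} σ∈ with ∈-filter⁻ (T? ∘ fixes0) {xs = perms (suc n)} σ∈
  ... | σ∈perms , fixed with ext-surjective σ (∈-perms⁻ σ∈perms) (T-does⇒ (lookup σ zero Fin.≟ zero) fixed)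
  ... | τ , τ-perm , refl = ∈-map⁺ ext (∈-perms⁺ τ-perm)
  from : ∀ {σ} → σ ∈ List.map ext (perms n) → σ ∈ List.filterᵇ fixes0 (perms (suc n))
  from σ∈ with ∈-map⁻ ext σ∈
  ... | τ , τ∈ , refl = ∈-filter⁺ (T? ∘ fixes0) (∈-perms⁺ (ext-perm τ (∈-perms⁻ τ∈))) _

transpose₀ : ∀ {n} → Fin (suc n) → Fin (suc n) → Fin (suc n)
transpose₀ x i = if does (i Fin.≟ zero) then x else if does (i Fin.≟ x) then zero else i

transpose₀-x : ∀ {n} (x : Fin (suc n)) → transpose₀ x x ≡ zero
transpose₀-x zero    = refl
transpose₀-x (suc x) = if-yes (suc x Fin.≟ suc x) refl

transpose₀-involutive : ∀ {n} (x i : Fin (suc n)) → transpose₀ x (transpose₀ x i) ≡ i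
transpose₀-involutive x zero    = transpose₀-x x
transpose₀-involutive x (suc i) with suc i Fin.≟ x
... | yes refl = refl
... | no i≢x   = if-no (suc i Fin.≟ x) i≢x

-- `IsChar` provides a matrix for each permutation separately. With A the matrix of `t` and a that
-- of `σ`, independence identifies the matrix of the conjugate with AaA, and `Trace` applied to the
-- basis moved by `t` shows that AaA and a have the same trace.
character-conj : ∀ {N} (S : Poly N → Set) χ → IsChar S χ → (t : Fin N → Fin N) (t-inv : ∀ i → t (t i) ≡ i) →
                 ∀ σ → IsPerm σ → χ (Conjugation.conj t t-inv σ) ≡ χ σ
character-conj {N} S χ (d , b , (_ , b-indep , _) , acts) t t-inv σ σ-perm = begin
  χ (conj σ)               ≡⟨ χ≡ (conj σ) (conj-perm σ σ-perm) ⟩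
  sum (λ i → a (conj σ) (conj-perm σ σ-perm) i i) ≡⟨ sum-cong-≗ (λ i → coords-unique e-indep (λ l → a (conj σ) (conj-perm σ σ-perm) l i) (λ l → Tr.mat l i) (same i) i) ⟩
  sum (λ i → Tr.mat i i)   ≡⟨ Tr.trace ⟨
  sum (λ i → a σ σ-perm i i) ≡⟨ χ≡ σ σ-perm ⟨
  χ σ                      ∎
  where
  open Conjugation t t-inv
  e : Fin d → Mono N → ℚ
  e = nf ∘ b
  e-indep : Indep e
  e-indep = indep-nf b b-indep
  a : ∀ σ → IsPerm σ → Fin d → Fin d → ℚ
  a σ σ-perm = proj₁ (acts σ σ-perm)
  χ≡ : ∀ σ (σ-perm : IsPerm σ) → χ σ ≡ sum λ i → a σ σ-perm i i
  χ≡ σ σ-perm = trans (proj₂ (proj₂ (acts σ σ-perm))) (ΣF≡sum d (λ i → a σ σ-perm i i))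
  act-e : ∀ σ (σ-perm : IsPerm σ) j m → e j (pullM σ m) ≡ lc (λ l → a σ σ-perm l j) e m
  act-e σ σ-perm j m = trans (sym (nf-act σ σ-perm (b j) m)) (nf-≈comb (act σ (b j)) (λ i → a σ σ-perm i j) b (proj₁ (proj₂ (acts σ σ-perm)) j) m)
  tv : Perm N
  tv = tabulate t
  lookup-tv : ∀ i → lookup tv i ≡ t i
  lookup-tv = Vec.lookup∘tabulate t
  tv-perm : IsPerm tv
  tv-perm = injective⇒distinct tv λ {i} {j} eq → t-injective (trans (sym (lookup-tv i)) (trans eq (lookup-tv j)))
  pull-lookup : ∀ σ us i → lookup (pull σ us) i ≡ lookup us (lookup σ i)
  pull-lookup σ us i = Vec.lookup∘tabulate _ i
  pull-tv² : ∀ us → pull tv (pull tv us) ≡ us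
  pull-tv² us = lookup-ext λ i → begin
    lookup (pull tv (pull tv us)) i ≡⟨ trans (pull-lookup tv (pull tv us) i) (pull-lookup tv us (lookup tv i)) ⟩
    lookup us (lookup tv (lookup tv i)) ≡⟨ cong (lookup us) (trans (lookup-tv (lookup tv i)) (trans (cong t (lookup-tv i)) (t-inv i))) ⟩
    lookup us i                             ∎
  pull-conj : ∀ us → pull (conj σ) us ≡ pull tv (pull σ (pull tv us))
  pull-conj us = lookup-ext λ i → begin
    lookup (pull (conj σ) us) i ≡⟨ trans (pull-lookup (conj σ) us i) (cong (lookup us) (lookup-conj σ i)) ⟩
    lookup us (t (lookup σ (t i))) ≡⟨ cong (lookup us) (trans (lookup-tv (lookup σ (lookup tv i))) (cong (t ∘ lookup σ) (lookup-tv i))) ⟨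
    lookup us (lookup tv (lookup σ (lookup tv i))) ≡⟨ trans (pull-lookup tv (pull σ (pull tv us)) i) (trans (pull-lookup σ (pull tv us) (lookup tv i)) (pull-lookup tv us (lookup σ (lookup tv i)))) ⟨
    lookup (pull tv (pull σ (pull tv us))) i        ∎
  e′ : Fin d → Mono N → ℚ
  e′ j m = e j (pullM tv m)
  A : Fin d → Fin d → ℚ
  A = a tv tv-perm
  e≡Ae′ : ∀ j m → e j m ≡ lc (λ i → A i j) e′ m
  e≡Ae′ j m = trans (cong (e j) (sym (cong₂ _,_ (pull-tv² (proj₁ m)) (pull-tv² (proj₂ m))))) (act-e tv tv-perm j (pullM tv m))
  module Tr = Trace (pullM σ) e e-indep e′ A e≡Ae′ A
                (λ l m → trans (e≡Ae′ l m) (sum-cong-≗ λ i → cong (A i l *_) (act-e tv tv-perm i m))) (a σ σ-perm) (act-e σ σ-perm)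
  same : ∀ i m → lc (λ l → a (conj σ) (conj-perm σ σ-perm) l i) e m ≡ lc (λ l → Tr.mat l i) e m
  same i m = begin
    lc (λ l → a (conj σ) (conj-perm σ σ-perm) l i) e m ≡⟨ act-e (conj σ) (conj-perm σ σ-perm) i m ⟨
    e i (pullM (conj σ) m) ≡⟨ cong (e i) (cong₂ _,_ (pull-conj (proj₁ m)) (pull-conj (proj₂ m))) ⟩
    e′ i (pullM σ (pullM tv m)) ≡⟨ Tr.mat-acts i (act-e tv tv-perm i) (pullM tv m) ⟩
    lc (λ l → Tr.mat l i) e′ (pullM tv m) ≡⟨ sum-cong-≗ (λ l → cong (λ z → Tr.mat l i * e l z) (cong₂ _,_ (pull-tv² (proj₁ m)) (pull-tv² (proj₂ m)))) ⟩
    lc (λ l → Tr.mat l i) e m                              ∎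

opaque
  unfolding sum
  ι-count : ∀ {N} (p : Fin N → Bool) x → ι (count p) * x ≡ sum λ i → if p i then x else 0ℚ
  ι-count {zero}  p x = *-≡0ˡ x ι-0
  ι-count {suc N} p x with p zero
  ... | true  = trans (cong (_* x) (ι-+ 1 (count (p ∘ suc)))) (trans (ℚ.*-distribʳ-+ x (ι 1) (ι (count (p ∘ suc))))
                  (cong₂ _+_ (trans (cong (_* x) ι-1) (ℚ.*-identityˡ x)) (ι-count (p ∘ suc) x)))
  ... | false = trans (ι-count (p ∘ suc) x) (sym (ℚ.+-identityˡ _))

sum-const : ∀ n x → sum {n} (λ _ → x) ≡ ι n * x
sum-const n x = sym (trans (cong (λ z → ι z * x) (sym (count-true n))) (ι-count {n} (λ _ → true) x))
  where
  count-true : ∀ n → count {n} (λ _ → true) ≡ n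
  count-true zero    = refl
  count-true (suc n) = cong suc (count-true n)

_≟L_ : (xs ys : List ℕ) → Dec (xs ≡ ys)
_≟L_ = List.≡-dec ℕ._≟_

-- Each permutation of cycle type lam ++ [1] has 1 + ones lam fixed points; conjugation moves any of them to 0.
restriction-sum : ∀ {n} (S : Poly (suc (suc n)) → Set) χ → IsChar S χ → ∀ lam →
  ι (suc (ones lam)) * listSum χ (List.filterᵇ (λ σ → does (cycleType σ ≟L (lam ++ 1 ∷ []))) (perms (suc (suc n)))) ≡
  ι (suc (suc n)) * listSum (χ ∘ ext) (List.filterᵇ (λ τ → does (cycleType τ ≟L lam)) (perms (suc n)))
restriction-sum {n} S χ isChar lam = begin
  ι (suc (ones lam)) * listSum χ (List.filterᵇ has-type (perms N))
    ≡⟨ cong (ι (suc (ones lam)) *_) (listSum-filter χ has-type (perms N)) ⟩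
  ι (suc (ones lam)) * listSum Θ (perms N)
    ≡⟨ listSum-*ˡ (ι (suc (ones lam))) Θ (perms N) ⟩
  listSum (λ σ → ι (suc (ones lam)) * Θ σ) (perms N)
    ≡⟨ listSum-cong-∈ (perms N) (λ σ _ → fixed-points σ (cycleType σ ≟L (lam ++ 1 ∷ []))) ⟩
  listSum (λ σ → sum λ x → fixing x σ) (perms N)
    ≡⟨ listSum-sum fixing (perms N) ⟩
  sum (λ x → listSum (fixing x) (perms N))
    ≡⟨ sum-cong-≗ (λ x → trans (listSum-conj (transpose₀ x) (transpose₀-involutive x) (fixing x)) (listSum-cong-∈ (perms N) (λ σ σ∈ → move x σ (∈-perms⁻ σ∈)))) ⟩
  sum {N} (λ _ → listSum (fixing zero) (perms N))
    ≡⟨ sum-const N (listSum (fixing zero) (perms N)) ⟩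
  ι N * listSum (fixing zero) (perms N)
    ≡⟨ cong (ι N *_) (listSum-ext Θ) ⟩
  ι N * listSum (Θ ∘ ext) (perms (suc n))
    ≡⟨ cong (ι N *_) (listSum-cong-∈ (perms (suc n)) (λ τ τ∈ → restrict τ (∈-perms⁻ τ∈))) ⟩
  ι N * listSum (λ τ → if does (cycleType τ ≟L lam) then χ (ext τ) else 0ℚ) (perms (suc n))
    ≡⟨ cong (ι N *_) (listSum-filter (χ ∘ ext) (λ τ → does (cycleType τ ≟L lam)) (perms (suc n))) ⟨
  ι N * listSum (χ ∘ ext) (List.filterᵇ (λ τ → does (cycleType τ ≟L lam)) (perms (suc n))) ∎
  where
  N = suc (suc n)
  has-type : Perm N → Bool
  has-type σ = does (cycleType σ ≟L (lam ++ 1 ∷ []))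
  Θ : Perm N → ℚ
  Θ σ = if has-type σ then χ σ else 0ℚ
  fixing : Fin N → Perm N → ℚ
  fixing x σ = if does (lookup σ x Fin.≟ x) then Θ σ else 0ℚ
  fixed-points : ∀ σ (dec : Dec (cycleType σ ≡ lam ++ 1 ∷ [])) →
    ι (suc (ones lam)) * (if does dec then χ σ else 0ℚ) ≡ sum λ x → if does (lookup σ x Fin.≟ x) then (if does dec then χ σ else 0ℚ) else 0ℚ
  fixed-points σ (yes eq) = trans (cong (λ z → ι z * χ σ) ones≡) (ι-count (λ x → does (lookup σ x Fin.≟ x)) (χ σ))
    where
    ones≡ : suc (ones lam) ≡ count λ x → does (lookup σ x Fin.≟ x)
    ones≡ = trans (sym (trans (cong ones eq) (trans (ones-++ lam (1 ∷ [])) (ℕ.+-comm (ones lam) 1)))) (ones-cycleType σ)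
  fixed-points σ (no _) = trans (ℚ.*-zeroʳ (ι (suc (ones lam)))) (sym (sum-zero _ λ x → both (does (lookup σ x Fin.≟ x))))
    where
    both : ∀ b → (if b then 0ℚ else 0ℚ) ≡ 0ℚ
    both true  = refl
    both false = refl
  move : ∀ x σ → IsPerm σ → fixing x (Conjugation.conj (transpose₀ x) (transpose₀-involutive x) σ) ≡ fixing zero σ
  move x σ σ-perm = cong₂ (λ b z → if b then z else 0ℚ) fixes (cong₂ (λ ct y → if does (ct ≟L (lam ++ 1 ∷ [])) then y else 0ℚ) (cycleType-conj σ) (character-conj S χ isChar t (transpose₀-involutive x) σ σ-perm))
    where
    t = transpose₀ x
    open Conjugation t (transpose₀-involutive x)
    fixes : does (lookup (conj σ) x Fin.≟ x) ≡ does (lookup σ zero Fin.≟ zero)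
    fixes = does-⇔ (mk⇔
      (λ eq → t-injective (trans (cong (t ∘ lookup σ) (sym (transpose₀-x x))) (trans (sym (lookup-conj σ x)) eq)))
      (λ eq → trans (lookup-conj σ x) (trans (cong (t ∘ lookup σ) (transpose₀-x x)) (cong t eq)))) (lookup (conj σ) x Fin.≟ x) (lookup σ zero Fin.≟ zero)
  restrict : ∀ τ → IsPerm τ → Θ (ext τ) ≡ (if does (cycleType τ ≟L lam) then χ (ext τ) else 0ℚ)
  restrict τ τ-perm = cong (λ b → if b then χ (ext τ) else 0ℚ) (does-⇔ (mk⇔
    (λ eq → List.++-cancelʳ (1 ∷ []) (cycleType τ) lam (trans (sym (cycleType-ext τ τ-perm)) eq))
    (λ eq → trans (cycleType-ext τ τ-perm) (cong (_++ 1 ∷ []) eq))) (cycleType (ext τ) ≟L (lam ++ 1 ∷ [])) (cycleType τ ≟L lam))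

-- The branching rule

shift-basis : ∀ {n d} (c : Cells n) → HasDim (M c) d →
              Σ (Fin d → Mono n) λ g → Indep (shift c ∘ g) × (∀ m → InSpan (shift c ∘ g) (shift c m))
shift-basis c (b , b∈M , b-indep , b-span) =
  Steinitz.selection (shift c) (nf ∘ b) (indep-nf b b-indep) (λ i → M⇒lincomb c {b i} (b∈M i)) λ m →
    let (P , P∈M , nfP≡) = shift∈M c m ; (a , P≈) = b-span P P∈M in
    a , λ m′ → trans (sym (nfP≡ m′)) (nf-≈comb P a b P≈ m′)

shift-basis⇒HasDim : ∀ {n d} (c : Cells n) (g : Fin d → Mono n) → Indep (shift c ∘ g) →
                     (∀ m → InSpan (shift c ∘ g) (shift c m)) → HasDim (M c) d
shift-basis⇒HasDim {n} {d} c g g-indep g-span = b , (λ i → proj₁ (proj₂ (shift∈M c (g i)))) , indep , span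
  where
  b : Fin d → Poly n
  b i = proj₁ (shift∈M c (g i))
  nf-comb-b : ∀ a m → nf (comb a b) m ≡ lc a (shift c ∘ g) m
  nf-comb-b a m = trans (nf-comb a b m) (sum-cong-≗ λ i → cong (a i *_) (proj₂ (proj₂ (shift∈M c (g i))) m))
  indep : ∀ a → comb a b ≈P zeroP → ∀ i → a i ≡ 0ℚ
  indep a eq = g-indep a λ m → trans (sym (nf-comb-b a m)) (trans (nf-cong {P = comb a b} {zeroP} eq m) (ℚ.*-zeroʳ (facM m)))
  span : ∀ P → M c P → Σ (Fin d → ℚ) λ a → P ≈P comb a b
  span P P∈M = let (L , eq) = M⇒lincomb c {P} P∈M ; (a , eq′) = lincomb∈span (shift c) (shift c ∘ g) g-span L in
    a , nf-injective {P = P} {comb a b} λ m → trans (eq m) (trans (eq′ m) (sym (nf-comb-b a m)))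

IsFrobCharC : ∀ {n} → Cells n → SymQT → Set
IsFrobCharC {n} c C = ∀ h k → Σ (Perm n → ℚ) λ χ → IsChar (HC c h k) χ ×
  (∀ lam → qℕ (n !) * C h k lam ≡ listSum χ (List.filterᵇ (λ σ → does (cycleType σ ≟L lam)) (perms n)))

pullM-ext : ∀ {n} (τ : Perm n) z m → pullM (ext τ) (z ◁ m) ≡ z ◁ pullM τ m
pullM-ext τ (p , q) (us , vs) = cong₂ _,_ (pull-ext p us) (pull-ext q vs)
  where
  pull-ext : ∀ u us → pull (ext τ) (u ∷ us) ≡ u ∷ pull τ us
  pull-ext u us = cong (u ∷_) (Vec.tabulate-cong λ a → cong (lookup (u ∷ us)) (Vec.lookup-map a suc τ))

-- Cancelling `A` leaves X + h = T + p. As `X` is at most `T`, this forces `p ≤ h`, so the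
-- subtraction in `mulB` is not truncated.
bidegree-lift⁻ : ∀ {p A} X h T → p ≤ A → X ≤ T → A ∸ p ℕ.+ X ℕ.+ h ≡ T ℕ.+ A → p ≤ h × X ℕ.+ (h ∸ p) ≡ T
bidegree-lift⁻ {p} {A} X h T p≤A X≤T eq = p≤h , ℕ.+-cancelʳ-≡ p (X ℕ.+ (h ∸ p)) T (begin
  X ℕ.+ (h ∸ p) ℕ.+ p       ≡⟨ ℕ.+-assoc X (h ∸ p) p ⟩
  X ℕ.+ (h ∸ p ℕ.+ p)       ≡⟨ cong (X ℕ.+_) (ℕ.m∸n+n≡m p≤h) ⟩
  X ℕ.+ h                   ≡⟨ X+h≡T+p ⟩
  T ℕ.+ p                   ∎)
  where
  open ℕ-Solver
  X+h≡T+p : X ℕ.+ h ≡ T ℕ.+ p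
  X+h≡T+p = ℕ.+-cancelˡ-≡ A (X ℕ.+ h) (T ℕ.+ p) (begin
    A ℕ.+ (X ℕ.+ h)              ≡⟨ cong (ℕ._+ (X ℕ.+ h)) (ℕ.m∸n+n≡m p≤A) ⟨
    A ∸ p ℕ.+ p ℕ.+ (X ℕ.+ h) ≡⟨ solve 4 (λ a p x h → a :+ p :+ (x :+ h) := a :+ x :+ h :+ p) refl (A ∸ p) p X h ⟩
    A ∸ p ℕ.+ X ℕ.+ h ℕ.+ p      ≡⟨ cong (ℕ._+ p) eq ⟩
    T ℕ.+ A ℕ.+ p ≡⟨ solve 3 (λ t a p → t :+ a :+ p := a :+ (t :+ p)) refl T A p ⟩
    A ℕ.+ (T ℕ.+ p)              ∎)
  p≤h : p ≤ h
  p≤h = ℕ.+-cancelˡ-≤ T p h (ℕ.≤-trans (ℕ.≤-reflexive (sym X+h≡T+p)) (ℕ.+-monoˡ-≤ h X≤T))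

bidegree-lift⁺ : ∀ {p A} X h T → p ≤ A → p ≤ h → X ℕ.+ (h ∸ p) ≡ T → A ∸ p ℕ.+ X ℕ.+ h ≡ T ℕ.+ A
bidegree-lift⁺ {p} {A} X h T p≤A p≤h eq = begin
  A ∸ p ℕ.+ X ℕ.+ h                  ≡⟨ cong (A ∸ p ℕ.+ X ℕ.+_) (ℕ.m∸n+n≡m p≤h) ⟨
  A ∸ p ℕ.+ X ℕ.+ (h ∸ p ℕ.+ p) ≡⟨ solve 4 (λ a x h p → a :+ x :+ (h :+ p) := x :+ h :+ (a :+ p)) refl (A ∸ p) X (h ∸ p) p ⟩
  X ℕ.+ (h ∸ p) ℕ.+ (A ∸ p ℕ.+ p)    ≡⟨ cong₂ ℕ._+_ eq (ℕ.m∸n+n≡m p≤A) ⟩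
  T ℕ.+ A                            ∎
  where
  open ℕ-Solver

-- `mulB` for cells given as a function on indices.
_⋆_ : ∀ {n} → Cells n → SymQT → SymQT
(c ⋆ C) h k lam = sum λ b → if does (proj₁ (c b) ℕ.≤? h) ∧ does (proj₂ (c b) ℕ.≤? k) then C (h ∸ proj₁ (c b)) (k ∸ proj₂ (c b)) lam else 0ℚ

module Branching {n} (c : Fin (suc (suc n)) → ℕ × ℕ) (c′ : Cells (suc n)) (A B : ℕ) (diagram : IsDiagram c)
  (c-last : c (fromℕ (suc n)) ≡ (A , B)) (c-init : ∀ b → c (inject₁ b) ≡ c′ b)
  (c≤ : ∀ b → proj₁ (c b) ≤ A × proj₂ (c b) ≤ B) (dim : HasDim (M c′) (suc n !)) where

  basis = shift-basis c′ dim
  g = proj₁ basis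
  g-indep = proj₁ (proj₂ basis)
  g-span = proj₂ (proj₂ basis)
  open Rectangle c c′ A B diagram c-last c-init c≤ g g-indep

  dim-rectangle : HasDim (M c) (suc (suc n) !)
  dim-rectangle = shift-basis⇒HasDim c lifts family-indep family-span

  totx≡ : totx c ≡ totx c′ ℕ.+ A
  totx≡ = trans (ℕ∑.sum-init-last (proj₁ ∘ c)) (cong₂ ℕ._+_ (ℕ∑.sum-cong-≗ {x = proj₁ ∘ c ∘ inject₁} {y = proj₁ ∘ c′} (λ b → cong proj₁ (c-init b))) (cong proj₁ c-last))

  toty≡ : toty c ≡ toty c′ ℕ.+ B
  toty≡ = trans (ℕ∑.sum-init-last (proj₂ ∘ c)) (cong₂ ℕ._+_ (ℕ∑.sum-cong-≗ {x = proj₂ ∘ c ∘ inject₁} {y = proj₂ ∘ c′} (λ b → cong proj₂ (c-init b))) (cong proj₂ c-last))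

  -- A derivative whose order in x or y exceeds the degree of Δ vanishes, and so cannot belong to an
  -- independent family.
  g-bounded : ∀ f → degx (g f) ≤ totx c′ × degy (g f) ≤ toty c′
  g-bounded f = decidable-stable ((degx (g f) ℕ.≤? totx c′) ×-dec (degy (g f) ℕ.≤? toty c′)) λ ¬bounded →
    contradiction (trans (sym (kron-refl f)) (g-indep (kron f) (λ m → trans (sum-kronˡ f (λ i → shift c′ (g i) m)) (¬⇒≡0 λ ≢0 →
      let (x , y) = shift≢0 c′ (g f) m ≢0 in ¬bounded (ℕ.≤-trans (ℕ.m≤m+n _ _) (ℕ.≤-reflexive x) , ℕ.≤-trans (ℕ.m≤m+n _ _) (ℕ.≤-reflexive y)))) f)) λ ()

  lift-bidegree⁻ : ∀ b f h k → HasBidegree c h k (lift b f) → (p b ≤ h × q b ≤ k) × HasBidegree c′ (h ∸ p b) (k ∸ q b) (g f)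
  lift-bidegree⁻ b f h k (x , y) = (proj₁ x′ , proj₁ y′) , (proj₂ x′ , proj₂ y′)
    where
    x′ = bidegree-lift⁻ (degx (g f)) h (totx c′) (proj₁ (c≤ b)) (proj₁ (g-bounded f)) (trans x totx≡)
    y′ = bidegree-lift⁻ (degy (g f)) k (toty c′) (proj₂ (c≤ b)) (proj₂ (g-bounded f)) (trans y toty≡)

  lift-bidegree⁺ : ∀ b f h k → p b ≤ h → q b ≤ k → HasBidegree c′ (h ∸ p b) (k ∸ q b) (g f) → HasBidegree c h k (lift b f)
  lift-bidegree⁺ b f h k p≤h q≤k (x , y) =
    trans (bidegree-lift⁺ (degx (g f)) h (totx c′) (proj₁ (c≤ b)) p≤h x) (sym totx≡) ,
    trans (bidegree-lift⁺ (degy (g f)) k (toty c′) (proj₂ (c≤ b)) q≤k y) (sym toty≡)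

  module _ (χ : Perm (suc (suc n)) → ℚ) (χ′ : ℕ → ℕ → Perm (suc n) → ℚ) (h k : ℕ)
           (isChar : IsChar (HC c h k) χ) (isChar′ : ∀ h k → IsChar (HC c′ h k) (χ′ h k)) where

    -- The lifts along cell `b` that have bidegree (h , k) come from the members of the smaller
    -- basis of bidegree (h - p b , k - q b), and their diagonal entries agree. Each cell thus
    -- contributes one character value of the smaller module, or 0 if the cell exceeds (h , k).
    character-branching : ∀ τ → IsPerm τ →
      χ (ext τ) ≡ sum λ b → if does (p b ℕ.≤? h) ∧ does (q b ℕ.≤? k) then χ′ (h ∸ p b) (k ∸ q b) τ else 0ℚ
    character-branching τ τ-perm = begin
      χ (ext τ) ≡⟨ proj₁ (proj₂ upstairs) ⟩
      sum (λ i → if does (hasBidegree? c h k (lifts i)) then mat i i else 0ℚ)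
        ≡⟨ sum-combine (suc (suc n)) {suc n !} (λ i → if does (hasBidegree? c h k (lifts i)) then mat i i else 0ℚ) ⟩
      sum (λ b → sum λ f → if does (hasBidegree? c h k (lifts (combine b f))) then mat (combine b f) (combine b f) else 0ℚ)
        ≡⟨ sum-cong-≗ (λ b → sum-cong-≗ λ f → cong (λ z → if does (hasBidegree? c h k (uncurry lift z)) then mat (combine b f) (combine b f) else 0ℚ) (Fin.remQuot-combine b f)) ⟩
      sum (λ b → sum λ f → contribution b f)
        ≡⟨ sum-cong-≗ (λ b → block b (p b ℕ.≤? h) (q b ℕ.≤? k)) ⟩
      sum (λ b → if does (p b ℕ.≤? h) ∧ does (q b ℕ.≤? k) then χ′ (h ∸ p b) (k ∸ q b) τ else 0ℚ) ∎
      where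
      upstairs = character c lifts family-span h k χ isChar (ext τ) (ext-perm τ τ-perm)
      mat = proj₁ upstairs
      contribution : Fin (suc (suc n)) → Fin (suc n !) → ℚ
      contribution b f = if does (hasBidegree? c h k (lift b f)) then mat (combine b f) (combine b f) else 0ℚ
      downstairs : ∀ h k → _
      downstairs h k = character c′ g g-span h k (χ′ h k) (isChar′ h k) τ τ-perm
      entry : ∀ b f → HasBidegree c h k (lift b f) → HasBidegree c′ (h ∸ p b) (k ∸ q b) (g f) →
              mat (combine b f) (combine b f) ≡ proj₁ (downstairs (h ∸ p b) (k ∸ q b)) f f
      -- `ext τ` fixes variable 0, so `pullM (ext τ)` leaves the prefixed exponents alone, as
      -- `diagonal-entry` requires.
      entry b f up down = diagonal-entry (pullM (ext τ)) (pullM τ) (pullM-ext τ) b f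
        (λ f′ → proj₁ (downstairs (h ∸ p b) (k ∸ q b)) f′ f) (proj₂ (proj₂ (downstairs (h ∸ p b) (k ∸ q b))) f down)
        (λ i → mat i (combine b f)) λ m → subst (λ z → shift c z (pullM (ext τ) m) ≡ lc (λ i → mat i (combine b f)) family m) lift≡
          (proj₂ (proj₂ upstairs) (combine b f) (subst (HasBidegree c h k) (sym lift≡) up) m)
        where
        lift≡ : lifts (combine b f) ≡ lift b f
        lift≡ = cong (uncurry lift) (Fin.remQuot-combine b f)
      vanishing : ∀ b → ¬ (p b ≤ h × q b ≤ k) → sum (λ f → contribution b f) ≡ 0ℚ
      vanishing b ¬≤ = sum-zero _ λ f → if-no (hasBidegree? c h k (lift b f)) λ up → ¬≤ (proj₁ (lift-bidegree⁻ b f h k up))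
      block : ∀ b (dp : Dec (p b ≤ h)) (dq : Dec (q b ≤ k)) →
              sum (λ f → contribution b f) ≡
              (if does dp ∧ does dq then χ′ (h ∸ p b) (k ∸ q b) τ else 0ℚ)
      block b (yes p≤h) (yes q≤k) = trans (sum-cong-≗ λ f → term f (hasBidegree? c h k (lift b f)) (hasBidegree? c′ (h ∸ p b) (k ∸ q b) (g f))) (sym (proj₁ (proj₂ (downstairs (h ∸ p b) (k ∸ q b)))))
        where
        term : ∀ f (d₁ : Dec (HasBidegree c h k (lift b f))) (d₂ : Dec (HasBidegree c′ (h ∸ p b) (k ∸ q b) (g f))) →
               (if does d₁ then mat (combine b f) (combine b f) else 0ℚ) ≡ (if does d₂ then proj₁ (downstairs (h ∸ p b) (k ∸ q b)) f f else 0ℚ)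
        term f (yes up) (yes down) = entry b f up down
        term f (yes up) (no ¬down) = contradiction (proj₂ (lift-bidegree⁻ b f h k up)) ¬down
        term f (no ¬up) (yes down) = contradiction (lift-bidegree⁺ b f h k p≤h q≤k down) ¬up
        term f (no _)   (no _)     = refl
      block b (yes _)   (no q≰k)  = vanishing b (q≰k ∘ proj₂)
      block b (no p≰h)  _         = vanishing b (p≰h ∘ proj₁)

  -- Multiplied by N!, the coefficient of `∂p₁ C` is a sum of `χ` over a conjugacy class weighted by
  -- the number of fixed points; `restriction-sum` turns it into N times a sum over the smaller
  -- group, and N (N-1)! = N! restores the factor.
  frobenius-branching : ∀ C C′ → IsFrobCharC c C → IsFrobCharC c′ C′ → ∀ h k lam → ∂p₁ C h k lam ≡ (c ⋆ C′) h k lam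
  frobenius-branching C C′ frob frob′ h k lam = *-cancelˡ-≡ (ι (N !)) _ _ (ι-≢0 (N !) {{N ℕ.!≢0}}) (begin
    ι (N !) * (qℕ (suc (ones lam)) * C h k (lam ++ 1 ∷ []))
      ≡⟨ cong (λ z → ι (N !) * (z * C h k (lam ++ 1 ∷ []))) (ι≡qℕ (suc (ones lam))) ⟨
    ι (N !) * (ι (suc (ones lam)) * C h k (lam ++ 1 ∷ []))
      ≡⟨ solve 3 (λ x y z → x :* (y :* z) := y :* (x :* z)) refl (ι (N !)) (ι (suc (ones lam))) (C h k (lam ++ 1 ∷ [])) ⟩
    ι (suc (ones lam)) * (ι (N !) * C h k (lam ++ 1 ∷ []))
      ≡⟨ cong (ι (suc (ones lam)) *_) (trans (cong (_* C h k (lam ++ 1 ∷ [])) (ι≡qℕ (N !))) (proj₂ (proj₂ (frob h k)) (lam ++ 1 ∷ []))) ⟩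
    ι (suc (ones lam)) * listSum χ (List.filterᵇ (λ σ → does (cycleType σ ≟L (lam ++ 1 ∷ []))) (perms N))
      ≡⟨ restriction-sum (HC c h k) χ (proj₁ (proj₂ (frob h k))) lam ⟩
    ι N * listSum (χ ∘ ext) typed
      ≡⟨ cong (ι N *_) (listSum-cong-∈ typed λ τ τ∈ → character-branching χ χ′ h k (proj₁ (proj₂ (frob h k))) (λ h k → proj₁ (proj₂ (frob′ h k))) τ (∈-perms⁻ (proj₁ (∈-filter⁻ (T? ∘ has-type) {xs = perms (suc n)} τ∈)))) ⟩
    ι N * listSum (λ τ → sum λ b → if ok b then χ′ (h ∸ p b) (k ∸ q b) τ else 0ℚ) typed
      ≡⟨ cong (ι N *_) (listSum-sum (λ b τ → if ok b then χ′ (h ∸ p b) (k ∸ q b) τ else 0ℚ) typed) ⟩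
    ι N * sum (λ b → listSum (λ τ → if ok b then χ′ (h ∸ p b) (k ∸ q b) τ else 0ℚ) typed)
      ≡⟨ cong (ι N *_) (sum-cong-≗ (λ b → term b (ok b))) ⟩
    ι N * sum (λ b → ι (suc n !) * (if ok b then C′ (h ∸ p b) (k ∸ q b) lam else 0ℚ))
      ≡⟨ cong (ι N *_) (*-distribˡ-sum (ι (suc n !)) (λ b → if ok b then C′ (h ∸ p b) (k ∸ q b) lam else 0ℚ)) ⟨
    ι N * (ι (suc n !) * (c ⋆ C′) h k lam)
      ≡⟨ ℚ.*-assoc (ι N) (ι (suc n !)) ((c ⋆ C′) h k lam) ⟨
    ι N * ι (suc n !) * (c ⋆ C′) h k lam
      ≡⟨ cong (_* (c ⋆ C′) h k lam) (ι-* N (suc n !)) ⟨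
    ι (N !) * (c ⋆ C′) h k lam ∎)
    where
    open ℚ-Solver
    N = suc (suc n)
    χ = proj₁ (frob h k)
    χ′ : ℕ → ℕ → Perm (suc n) → ℚ
    χ′ h k = proj₁ (frob′ h k)
    has-type : Perm (suc n) → Bool
    has-type τ = does (cycleType τ ≟L lam)
    typed = List.filterᵇ has-type (perms (suc n))
    ok : Fin N → Bool
    ok b = does (p b ℕ.≤? h) ∧ does (q b ℕ.≤? k)
    term : ∀ b o → listSum (λ τ → if o then χ′ (h ∸ p b) (k ∸ q b) τ else 0ℚ) typed ≡ ι (suc n !) * (if o then C′ (h ∸ p b) (k ∸ q b) lam else 0ℚ)
    term b true  = sym (trans (cong (_* C′ (h ∸ p b) (k ∸ q b) lam) (ι≡qℕ (suc n !))) (proj₂ (proj₂ (frob′ (h ∸ p b) (k ∸ q b))) lam))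
    term b false = trans (zeros typed) (sym (ℚ.*-zeroʳ (ι (suc n !))))
      where
      zeros : ∀ τs → listSum (λ (_ : Perm (suc n)) → 0ℚ) τs ≡ 0ℚ
      zeros []       = refl
      zeros (τ ∷ τs) = trans (ℚ.+-identityˡ _) (zeros τs)

-- The cells of a rectangle

-- The numbers of cells are lengths of lists, related only by a proof. Indices are therefore
-- compared through `toℕ`, and the equation for `N` is matched here once.
branching : ∀ {N n} (c : Cells N) (c′ : Cells n) A B → N ≡ suc n → 1 ≤ n → IsDiagram c →
  (∀ b → toℕ b ≡ n → c b ≡ (A , B)) → (∀ b b′ → toℕ b ≡ toℕ b′ → c b ≡ c′ b′) →
  (∀ b → proj₁ (c b) ≤ A × proj₂ (c b) ≤ B) → HasDim (M c′) (n !) →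
  HasDim (M c) (N !) × (∀ C C′ → IsFrobCharC c C → IsFrobCharC c′ C′ → ∀ h k lam → ∂p₁ C h k lam ≡ (c ⋆ C′) h k lam)
branching {n = suc n} c c′ A B refl _ diagram c-last c-init c≤ dim = R.dim-rectangle , R.frobenius-branching
  where module R = Branching c c′ A B diagram (c-last (fromℕ (suc n)) (Fin.toℕ-fromℕ (suc n))) (λ b → c-init (inject₁ b) b (Fin.toℕ-inject₁ b)) c≤ dim

lookup-∷ʳ-last : ∀ {A : Set} (xs : List A) x (b : Fin (List.length (xs ++ x ∷ []))) → toℕ b ≡ List.length xs → List.lookup (xs ++ x ∷ []) b ≡ x
lookup-∷ʳ-last []       x zero    eq = refl
lookup-∷ʳ-last (y ∷ xs) x (suc b) eq = lookup-∷ʳ-last xs x b (ℕ.suc-injective eq)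

lookup-∷ʳ-init : ∀ {A : Set} (xs : List A) x (b : Fin (List.length (xs ++ x ∷ []))) b′ → toℕ b ≡ toℕ b′ → List.lookup (xs ++ x ∷ []) b ≡ List.lookup xs b′
lookup-∷ʳ-init (y ∷ xs) x zero    zero     eq = refl
lookup-∷ʳ-init (y ∷ xs) x (suc b) (suc b′) eq = lookup-∷ʳ-init xs x b b′ (ℕ.suc-injective eq)

Lex : ℕ × ℕ → ℕ × ℕ → Set
Lex (p , q) (p′ , q′) = p < p′ ⊎ (p ≡ p′ × q < q′)

AllPairs-lookup : ∀ {A : Set} {R : A → A → Set} {xs} → AllPairs R xs → ∀ i j → toℕ i < toℕ j → R (List.lookup xs i) (List.lookup xs j)
AllPairs-lookup (Rx ∷ _)   zero    (suc j) _         = All.lookup Rx (∈-lookup j)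
AllPairs-lookup (_ ∷ Rxs)  (suc i) (suc j) (s≤s i<j) = AllPairs-lookup Rxs i j i<j

rowCells-sorted : ∀ i r → AllPairs Lex (rowCells i r)
rowCells-sorted i r = AllPairs.map⁺ (AllPairs.applyUpTo⁺₁ id r λ j<j′ _ → inj₂ (refl , j<j′))

rowCells-bounds : ∀ i r → All (λ z → proj₁ z ≡ i × proj₂ z < r) (rowCells i r)
rowCells-bounds i r = All.map⁺ (All.applyUpTo⁺₁ id r λ j<r → refl , j<r)

rect-bounds : ∀ i r s → All (λ z → (i ≤ proj₁ z × proj₁ z < i ℕ.+ s) × proj₂ z < r) (cellsFrom i (List.replicate s r))
rect-bounds i r zero    = []
rect-bounds i r (suc s) = All.++⁺
  (All.map (λ { (refl , j<r) → (ℕ.≤-refl , ℕ.≤-trans (s≤s (ℕ.m≤m+n i s)) (ℕ.≤-reflexive (sym (ℕ.+-suc i s)))) , j<r }) (rowCells-bounds i r))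
  (All.map (λ { ((i<p , p<) , q<r) → (ℕ.<⇒≤ i<p , ℕ.≤-trans p< (ℕ.≤-reflexive (sym (ℕ.+-suc i s)))) , q<r }) (rect-bounds (suc i) r s))

rect-sorted : ∀ i r s → AllPairs Lex (cellsFrom i (List.replicate s r))
rect-sorted i r zero    = []
rect-sorted i r (suc s) = AllPairs.++⁺ (rowCells-sorted i r) (rect-sorted (suc i) r s)
  (All.map (λ { (refl , _) → All.map (λ { ((i<p , _) , _) → inj₁ i<p }) (rect-bounds (suc i) r s) }) (rowCells-bounds i r))

∈-rect : ∀ i r s u v → i ≤ u → u < i ℕ.+ s → v < r → (u , v) ∈ cellsFrom i (List.replicate s r)
∈-rect i r zero    u v i≤u u<  v<r = contradiction (ℕ.≤-trans u< (ℕ.≤-reflexive (ℕ.+-identityʳ i))) (ℕ.≤⇒≯ i≤u)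
∈-rect i r (suc s) u v i≤u u<  v<r with i ℕ.≟ u
... | yes refl = ∈-++⁺ˡ (∈-map⁺ (λ j → (i , j)) (∈-upTo⁺ v<r))
... | no i≢u   = ∈-++⁺ʳ (rowCells i r) (∈-rect (suc i) r s u v (ℕ.≤∧≢⇒< i≤u i≢u) (ℕ.≤-trans u< (ℕ.≤-reflexive (ℕ.+-suc i s))) v<r)

-- The cells are sorted lexicographically, and the lexicographic order extends the componentwise
-- one.
rect-diagram : ∀ r s → IsDiagram (List.lookup (cells (rect r s)))
rect-diagram r s = record { down = down ; order = order }
  where
  c = List.lookup (cells (rect r s))
  down : ∀ b u v → u ≤ proj₁ (c b) → v ≤ proj₂ (c b) → ∃ λ b′ → c b′ ≡ (u , v)
  down b u v u≤ v≤ with All.lookup (rect-bounds 0 r s) (∈-lookup b)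
  ... | (_ , p<s) , q<r with ∈-rect 0 r s u v z≤n (ℕ.≤-<-trans u≤ p<s) (ℕ.≤-<-trans v≤ q<r)
  ... | uv∈ = index uv∈ , sym (lookup-index uv∈)
  order : ∀ b b′ → proj₁ (c b′) ≤ proj₁ (c b) → proj₂ (c b′) ≤ proj₂ (c b) → toℕ b′ ≤ toℕ b
  order b b′ p≤ q≤ = ℕ.≮⇒≥ λ b<b′ → [ ℕ.≤⇒≯ p≤ , (λ { (_ , q<) → ℕ.≤⇒≯ q≤ q< }) ]′ (AllPairs-lookup (rect-sorted 0 r s) b b′ b<b′)

cellsFrom-++ : ∀ i xs ys → cellsFrom i (xs ++ ys) ≡ cellsFrom i xs ++ cellsFrom (List.length xs ℕ.+ i) ys
cellsFrom-++ i []       ys = refl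
cellsFrom-++ i (x ∷ xs) ys = trans (cong (rowCells i x ++_) (trans (cellsFrom-++ (suc i) xs ys) (cong (λ z → cellsFrom (suc i) xs ++ cellsFrom z ys) (ℕ.+-suc (List.length xs) i))))
  (sym (List.++-assoc (rowCells i x) (cellsFrom (suc i) xs) _))

rowCells-suc : ∀ i k → rowCells i (suc k) ≡ rowCells i k ++ (i , k) ∷ []
rowCells-suc i k = trans (cong (List.map (i ,_)) (sym (List.upTo-∷ʳ k))) (List.map-++ (i ,_) (List.upTo k) (k ∷ []))

-- Rows of length 1 are separate, because the shortened last row is then omitted from the list of
-- parts instead of being listed as 0.
cells-rect : ∀ r s → cells (rect (suc r) (suc s)) ≡ cells (rectMinusCorner (suc r) (suc s)) ++ (s , r) ∷ []
cells-rect r s = trans (cong cells (replicate-∷ʳ s (suc r))) (trans (cellsFrom-++ 0 (List.replicate s (suc r)) (suc r ∷ []))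
  (trans (cong (λ z → cells (List.replicate s (suc r)) ++ cellsFrom z (suc r ∷ [])) row-index) (corner r)))
  where
  row-index : List.length (List.replicate s (suc r)) ℕ.+ 0 ≡ s
  row-index = trans (ℕ.+-identityʳ _) (List.length-replicate s)
  corner : ∀ r → cells (List.replicate s (suc r)) ++ (rowCells s (suc r) ++ []) ≡ cells (rectMinusCorner (suc r) (suc s)) ++ (s , r) ∷ []
  corner zero    = cong (λ z → cells z ++ (s , 0) ∷ []) (sym (List.++-identityʳ (List.replicate s 1)))
  corner (suc k) = begin
    full ++ (rowCells s (suc (suc k)) ++ []) ≡⟨ cong (full ++_) (trans (List.++-identityʳ _) (rowCells-suc s (suc k))) ⟩
    full ++ (rowCells s (suc k) ++ (s , suc k) ∷ []) ≡⟨ List.++-assoc full (rowCells s (suc k)) _ ⟨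
    (full ++ rowCells s (suc k)) ++ (s , suc k) ∷ [] ≡⟨ cong (λ z → (full ++ z) ++ (s , suc k) ∷ []) (List.++-identityʳ (rowCells s (suc k))) ⟨
    (full ++ cellsFrom s (suc k ∷ [])) ++ (s , suc k) ∷ [] ≡⟨ cong (λ z → (full ++ cellsFrom z (suc k ∷ [])) ++ (s , suc k) ∷ []) (trans (ℕ.+-identityʳ _) (List.length-replicate s)) ⟨
    (full ++ cellsFrom (List.length (List.replicate s (suc (suc k))) ℕ.+ 0) (suc k ∷ [])) ++ (s , suc k) ∷ [] ≡⟨ cong (_++ (s , suc k) ∷ []) (cellsFrom-++ 0 (List.replicate s (suc (suc k))) (suc k ∷ [])) ⟨
    cells (List.replicate s (suc (suc k)) ++ suc k ∷ []) ++ (s , suc k) ∷ [] ∎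
    where full = cells (List.replicate s (suc (suc k)))

size-rect : ∀ r s → size (rect r s) ≡ r ℕ.* s
size-rect r s = trans (go 0 s) (ℕ.*-comm s r)
  where
  go : ∀ i s → List.length (cellsFrom i (List.replicate s r)) ≡ s ℕ.* r
  go i zero    = refl
  go i (suc s) = trans (List.length-++ (rowCells i r)) (cong₂ ℕ._+_ (trans (List.length-map (i ,_) (List.upTo r)) (List.length-upTo r)) (go (suc i) s))

opaque
  unfolding sum
  sum-lookup : ∀ {A : Set} (f : A → ℚ) xs → sum (λ b → f (List.lookup xs b)) ≡ listSum f xs
  sum-lookup f []       = refl
  sum-lookup f (x ∷ xs) = cong (f x +_) (sum-lookup f xs)

-- The Hilbert series and the theorem

iter-suc : ∀ n f C → iter n f (f C) ≡ f (iter n f C)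
iter-suc zero    f C = refl
iter-suc (suc n) f C = cong f (iter-suc n f C)

iter-∂p₁-cong : ∀ n {C C′ : SymQT} → (∀ h k lam → C h k lam ≡ C′ h k lam) → ∀ h k lam → iter n ∂p₁ C h k lam ≡ iter n ∂p₁ C′ h k lam
iter-∂p₁-cong zero    eq = eq
iter-∂p₁-cong (suc n) eq h k lam = cong (qℕ (suc (ones lam)) *_) (iter-∂p₁-cong n eq h k (lam ++ 1 ∷ []))

-- `∂p₁` acts on the power-sum index and `mulB` on the bidegree, so they commute.
∂p₁-mulB : ∀ μ C h k lam → ∂p₁ (mulB μ C) h k lam ≡ mulB μ (∂p₁ C) h k lam
∂p₁-mulB μ C h k lam = trans (listSum-*ˡ (qℕ (suc (ones lam))) _ (cells μ)) (listSum-cong-∈ (cells μ) λ c _ → inside (does (proj₁ c ℕ.≤? h) ∧ does (proj₂ c ℕ.≤? k)))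
  where
  inside : ∀ b {x} → qℕ (suc (ones lam)) * (if b then x else 0ℚ) ≡ (if b then qℕ (suc (ones lam)) * x else 0ℚ)
  inside true  = refl
  inside false = ℚ.*-zeroʳ (qℕ (suc (ones lam)))

iter-∂p₁-mulB : ∀ n μ C h k lam → iter n ∂p₁ (mulB μ C) h k lam ≡ mulB μ (iter n ∂p₁ C) h k lam
iter-∂p₁-mulB zero    μ C h k lam = refl
iter-∂p₁-mulB (suc n) μ C h k lam = trans (cong (qℕ (suc (ones lam)) *_) (iter-∂p₁-mulB n μ C h k (lam ++ 1 ∷ []))) (∂p₁-mulB μ (iter n ∂p₁ C) h k lam)

module CornerRemoval (r s : ℕ) (2≤rs : 2 ≤ suc r ℕ.* suc s) where

  μ = rect (suc r) (suc s)
  ν = rectMinusCorner (suc r) (suc s)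

  size-μ : size μ ≡ suc (size ν)
  size-μ = trans (cong List.length (cells-rect r s)) (trans (List.length-++ (cells ν)) (ℕ.+-comm (size ν) 1))

  size-ν : size ν ≡ suc r ℕ.* suc s ∸ 1
  size-ν = cong ℕ.pred (trans (sym size-μ) (size-rect (suc r) (suc s)))

  lookup-along : ∀ {L L′ : List (ℕ × ℕ)} → L ≡ L′ → (P : ∀ {n} → Cells n → Set) → P (List.lookup L′) → P (List.lookup L)
  lookup-along refl P x = x

  result : dimM ν (size ν !) → dimM μ (size μ !) ×
    (∀ C C′ → IsFrobChar μ C → IsFrobChar ν C′ → ∀ h k lam → ∂p₁ C h k lam ≡ (List.lookup (cells μ) ⋆ C′) h k lam)
  result = branching (List.lookup (cells μ)) (List.lookup (cells ν)) s r size-μ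
    -- That rs is at least 2 leaves a cell in `ν`.
    (ℕ.≤-trans (ℕ.≤-pred 2≤rs) (ℕ.≤-reflexive (sym size-ν))) (rect-diagram (suc r) (suc s))
    (lookup-along (cells-rect r s) (λ c → ∀ b → toℕ b ≡ size ν → c b ≡ (s , r)) (lookup-∷ʳ-last (cells ν) (s , r)))
    (lookup-along (cells-rect r s) (λ c → ∀ b b′ → toℕ b ≡ toℕ b′ → c b ≡ List.lookup (cells ν) b′) (lookup-∷ʳ-init (cells ν) (s , r)))
    (λ b → let ((_ , p<) , q<) = All.lookup (rect-bounds 0 (suc r) (suc s)) (∈-lookup b) in ℕ.≤-pred p< , ℕ.≤-pred q<)

  frobenius : dimM ν (size ν !) → ∀ C C′ → IsFrobChar μ C → IsFrobChar ν C′ → ∀ h k lam → ∂p₁ C h k lam ≡ mulB μ C′ h k lam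
  frobenius dim C C′ frob frob′ h k lam = trans (proj₂ (result dim) C C′ frob frob′ h k lam)
    (sum-lookup (λ c → if does (proj₁ c ℕ.≤? h) ∧ does (proj₂ c ℕ.≤? k) then C′ (h ∸ proj₁ c) (k ∸ proj₂ c) lam else 0ℚ) (cells μ))

  -- There is one derivation more for `μ` than for `ν`: it is used up by the branching rule, and the
  -- others pass through the multiplication by B.
  hilbert : ∀ C C′ → (∀ h k lam → ∂p₁ C h k lam ≡ mulB μ C′ h k lam) →
            ∀ h k → Gser μ C h k ≡ mulB μ (λ h′ k′ _ → Gser ν C′ h′ k′) h k []
  hilbert C C′ eq h k = begin
    iter (size μ) ∂p₁ C h k []             ≡⟨ cong (λ n → iter n ∂p₁ C h k []) size-μ ⟩
    iter (suc (size ν)) ∂p₁ C h k [] ≡⟨ cong (λ F → F h k []) (iter-suc (size ν) ∂p₁ C) ⟨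
    iter (size ν) ∂p₁ (∂p₁ C) h k []       ≡⟨ iter-∂p₁-cong (size ν) eq h k [] ⟩
    iter (size ν) ∂p₁ (mulB μ C′) h k []   ≡⟨ iter-∂p₁-mulB (size ν) μ C′ h k [] ⟩
    mulB μ (iter (size ν) ∂p₁ C′) h k []   ∎

theorem1p1 : (r s : ℕ) → 1 ≤ r → 1 ≤ s → 2 ≤ r ℕ.* s →
    dimM (rectMinusCorner r s) ((r ℕ.* s ∸ 1) !) →
    dimM (rect r s) ((r ℕ.* s) !) ×
    ((C C' : SymQT) → IsFrobChar (rect r s) C → IsFrobChar (rectMinusCorner r s) C' →
    ((h k : ℕ) (lam : List ℕ) → ∂p₁ C h k lam ≡ mulB (rect r s) C' h k lam) ×
    ((h k : ℕ) → Gser (rect r s) C h k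
    ≡ mulB (rect r s) (λ h' k' _ → Gser (rectMinusCorner r s) C' h' k') h k []))
theorem1p1 (suc r) (suc s) _ _ 2≤rs dim =
  subst (dimM μ ∘ _!) (size-rect (suc r) (suc s)) (proj₁ (result dim′)) ,
  λ C C′ frob frob′ → frobenius dim′ C C′ frob frob′ , hilbert C C′ (frobenius dim′ C C′ frob frob′)
  where
  open CornerRemoval r s 2≤rs
  dim′ : dimM ν (size ν !)
  dim′ = subst (dimM ν ∘ _!) (sym size-ν) dim
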